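{- Let $M$ be a simple matroid with an element $x$ such that $\mathrm{si}(M/x)\cong M(K_n)$ for some $n\ge 4$, and each parallel class of $M/x$ has size $t\ge 2$. If there is no element $e\in E(M)$ for which $M/e$ has a $U_{2,t+2}$-restriction, then there is a group $\Gamma$ such that $M\cong \mathrm{LG}^+(n,\Gamma)$.
   Context: $\mathrm{si}(N)$ denotes the simplification of $N$; $M(K_n)$ the cycle matroid of the complete graph; $U_{2,b}$ the rank-2 uniform matroid on $b$ elements. For a finite group $\Gamma$ with $|\Gamma|\ge2$ and $k\ge3$: let $G$ be the loopless graph on $k$ vertices with exactly $|\Gamma|$ parallel edges between each pair of distinct vertices, edges between a given pair having the same orientation and labeled by the distinct elements of $\Gamma$ via $\phi$. A cycle is balanced if some simple closed walk around it with edges $e_1,\dots,e_m$ has $\prod_i\phi(e_i)^{\epsilon_i}=1$ ($\epsilon_i=\pm1$ for forward/backward traversal). $\mathrm{LG}(k,\Gamma)$ is the matroid on $E(G)$ whose circuits are: balanced cycles; two vertex-disjoint unbalanced cycles; two unbalanced cycles sharing exactly one vertex; theta subgraphs all of whose cycles are unbalanced. $\mathrm{LG}^+(k,\Gamma)$ is the extension of $\mathrm{LG}(k,\Gamma)$ by a new element $e_0$ with $\mathrm{LG}^+(k,\Gamma)\backslash e_0=\mathrm{LG}(k,\Gamma)$ and $\mathrm{LG}^+(k,\Gamma)/e_0$ equal to the cycle matroid of $G$. -}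

module Defs where

open import Level using (0ℓ)
open import Data.Nat using (ℕ; zero; suc; _≤_; _+_)
open import Data.Fin using (Fin; zero; suc; inject₁; fromℕ)
open import Data.Fin.Subset
  using (Subset; _∈_; _∉_; _⊆_; _∪_; _∩_; _-_; ⁅_⁆; ∣_∣; ⊤; Nonempty; outside)
open import Data.Vec using (Vec; _∷_; tabulate; lookup)
open import Data.List using (List; foldr)
import Data.List as List
open import Data.Product using (Σ; ∃; ∃-syntax; _×_; _,_)
open import Data.Sum using (_⊎_; [_,_])
open import Relation.Nullary using (¬_)
open import Relation.Binary.PropositionalEquality using (_≡_; _≢_)
open import Function using (Injective; _⇔_)
open import Algebra.Structures using (IsGroup)

-- Finite "circuit systems": a ground set (a subset of Fin size) together
-- with a predicate saying which subsets are circuits.  A matroid is a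
-- circuit system satisfying the circuit axioms.  Minors and the specific
-- matroids of the paper are built as circuit systems.

record CircuitSys : Set₁ where
  field
    size    : ℕ
    ground  : Subset size
    Circuit : Subset size → Set
open CircuitSys public

record IsMatroid (M : CircuitSys) : Set where
  field
    circ-ground   : ∀ C → Circuit M C → C ⊆ ground M
    circ-nonempty : ∀ C → Circuit M C → Nonempty C
    circ-incomp   : ∀ C D → Circuit M C → Circuit M D → C ⊆ D → C ≡ D
    circ-elim     : ∀ C D e → Circuit M C → Circuit M D → C ≢ D →
                    e ∈ C → e ∈ D →
                    ∃[ C′ ] (Circuit M C′ × C′ ⊆ (C ∪ D) - e)

delete : (M : CircuitSys) → Fin (size M) → CircuitSys
delete M e = record
  { size = size M
  ; ground = ground M - e
  ; Circuit = λ C → Circuit M C × e ∉ C }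

contract : (M : CircuitSys) → Fin (size M) → CircuitSys
contract M e = record
  { size = size M
  ; ground = ground M - e
  ; Circuit = λ D → Nonempty D × Cand D ×
                    (∀ D′ → Nonempty D′ → Cand D′ → D′ ⊆ D → D′ ≡ D) }
  where
  Cand : Subset (size M) → Set
  Cand D = ∃[ C ] (Circuit M C × D ≡ C - e)

-- restriction M | X  (X ⊆ E(M) is imposed where used)
restrict : (M : CircuitSys) → Subset (size M) → CircuitSys
restrict M X = record
  { size = size M
  ; ground = X
  ; Circuit = λ C → Circuit M C × C ⊆ X }

preimage : ∀ {m n} → (Fin m → Fin n) → Subset n → Subset m
preimage f D = tabulate (λ x → lookup D (f x))

record _≅_ (M N : CircuitSys) : Set where
  field
    to      : Fin (size M) → Fin (size N)
    from    : Fin (size N) → Fin (size M)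
    to-gr   : ∀ x → x ∈ ground M → to x ∈ ground N
    from-gr : ∀ y → y ∈ ground N → from y ∈ ground M
    from-to : ∀ x → x ∈ ground M → from (to x) ≡ x
    to-from : ∀ y → y ∈ ground N → to (from y) ≡ y
    circ-to   : ∀ D → D ⊆ ground N →
                Circuit N D ⇔ Circuit M (preimage to D ∩ ground M)
    circ-from : ∀ C → C ⊆ ground M →
                Circuit M C ⇔ Circuit N (preimage from C ∩ ground N)

Loop : (M : CircuitSys) → Fin (size M) → Set
Loop M e = Circuit M ⁅ e ⁆

NonLoop : (M : CircuitSys) → Fin (size M) → Set
NonLoop M e = e ∈ ground M × ¬ Loop M e

Parallel : (M : CircuitSys) → Fin (size M) → Fin (size M) → Set
Parallel M e f = NonLoop M e × NonLoop M f ×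
                 (e ≡ f ⊎ (e ≢ f × Circuit M (⁅ e ⁆ ∪ ⁅ f ⁆)))

Simple : CircuitSys → Set
Simple M = ∀ C → Circuit M C → 3 ≤ ∣ C ∣

IsSimplificationSet : (N : CircuitSys) → Subset (size N) → Set
IsSimplificationSet N S =
  S ⊆ ground N ×
  (∀ s → s ∈ S → NonLoop N s) ×
  (∀ e → NonLoop N e → ∃[ s ] (s ∈ S × Parallel N e s)) ×
  (∀ s s′ → s ∈ S → s′ ∈ S → Parallel N s s′ → s ≡ s′)

SiIso : CircuitSys → CircuitSys → Set
SiIso N K = ∃[ S ] (IsSimplificationSet N S × (restrict N S ≅ K))

ParallelClassesOfSize : CircuitSys → ℕ → Set
ParallelClassesOfSize N t =
  ∀ e → NonLoop N e →
  ∃[ P ] ((∀ f → f ∈ P ⇔ Parallel N e f) × ∣ P ∣ ≡ t)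

U : ℕ → ℕ → CircuitSys
U r b = record { size = b ; ground = ⊤ ; Circuit = λ C → ∣ C ∣ ≡ suc r }

HasURestriction : CircuitSys → ℕ → ℕ → Set
HasURestriction N r b = ∃[ X ] (X ⊆ ground N × (restrict N X ≅ U r b))

record Graph (k : ℕ) : Set where
  field
    nE   : ℕ
    tail : Fin nE → Fin k
    head : Fin nE → Fin k
open Graph public

module _ {k : ℕ} (G : Graph k) where

  Forward : Fin (nE G) → Fin k → Fin k → Set
  Forward e v w = tail G e ≡ v × head G e ≡ w

  Joins : Fin (nE G) → Fin k → Fin k → Set
  Joins e v w = Forward e v w ⊎ Forward e w v

  -- a cycle of length suc l, given as a simple closed walk
  -- v₀ e₀ v₁ e₁ … e_l v_{l+1} = v₀ with v₀,…,v_l distinct, edges distinct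
  record Cycle : Set where
    field
      len    : ℕ
      vs     : Fin (suc (suc len)) → Fin k
      es     : Fin (suc len) → Fin (nE G)
      closed : vs (fromℕ (suc len)) ≡ vs zero
      vs-inj : ∀ i j → vs (inject₁ i) ≡ vs (inject₁ j) → i ≡ j
      es-inj : Injective _≡_ _≡_ es
      joins  : ∀ i → Joins (es i) (vs (inject₁ i)) (vs (suc i))

  record Path (u v : Fin k) : Set where
    field
      len    : ℕ
      vs     : Fin (suc len) → Fin k
      es     : Fin len → Fin (nE G)
      start  : vs zero ≡ u
      end    : vs (fromℕ len) ≡ v
      vs-inj : Injective _≡_ _≡_ vs
      es-inj : Injective _≡_ _≡_ es
      joins  : ∀ i → Joins (es i) (vs (inject₁ i)) (vs (suc i))

  CycleEdges : Cycle → Subset (nE G) → Set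
  CycleEdges Z C = ∀ f → f ∈ C ⇔ (∃[ i ] (Cycle.es Z i ≡ f))

  PathEdges : ∀ {u v} → Path u v → Subset (nE G) → Set
  PathEdges P C = ∀ f → f ∈ C ⇔ (∃[ i ] (Path.es P i ≡ f))

  IsCycle : Subset (nE G) → Set
  IsCycle C = ∃[ Z ] CycleEdges Z C

  VertexOf : Subset (nE G) → Fin k → Set
  VertexOf C v = ∃[ e ] (e ∈ C × (tail G e ≡ v ⊎ head G e ≡ v))

  IsTheta : Subset (nE G) → Set
  IsTheta T =
    ∃[ u ] ∃[ v ] (u ≢ v × Σ (Fin 3 → Path u v) λ P →
      Σ (Fin 3 → Subset (nE G)) λ PE →
        (∀ a → PathEdges (P a) (PE a)) ×
        (∀ a → 1 ≤ Path.len (P a)) ×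
        (∀ a b → a ≢ b → ∀ f → f ∈ PE a → f ∉ PE b) ×
        (∀ a b → a ≢ b → ∀ i j →
           Path.vs (P a) i ≡ Path.vs (P b) j →
           Path.vs (P a) i ≡ u ⊎ Path.vs (P a) i ≡ v) ×
        (T ≡ PE zero ∪ PE (suc zero) ∪ PE (suc (suc zero))))

cycleSys : ∀ {k} → Graph k → CircuitSys
cycleSys G = record { size = nE G ; ground = ⊤ ; Circuit = IsCycle G }

SameEnds : ∀ {k} (G : Graph k) → Fin (nE G) → Fin (nE G) → Set
SameEnds G e f = (tail G e ≡ tail G f × head G e ≡ head G f) ⊎
                 (tail G e ≡ head G f × head G e ≡ tail G f)

IsComplete : ∀ {n} → Graph n → Set
IsComplete {n} G =
  (∀ e → tail G e ≢ head G e) ×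
  (∀ (i j : Fin n) → i ≢ j → ∃[ e ] Joins G e i j) ×
  (∀ e f → SameEnds G e f → e ≡ f)

IsoMK : CircuitSys → ℕ → Set
IsoMK N n = Σ (Graph n) λ G → IsComplete G × (N ≅ cycleSys G)

record FinGroup : Set where
  field
    order   : ℕ
    _∙_     : Fin order → Fin order → Fin order
    ε       : Fin order
    _⁻¹     : Fin order → Fin order
    isGroup : IsGroup _≡_ _∙_ ε _⁻¹
open FinGroup public

module _ {k : ℕ} (Γ : FinGroup) (G : Graph k)
         (φ : Fin (nE G) → Fin (order Γ)) where

  walkGain : Cycle G → Fin (order Γ)
  walkGain Z =
    foldr (_∙_ Γ) (ε Γ)
      (List.tabulate (λ i →
         [ (λ _ → φ (Cycle.es Z i)) , (λ _ → _⁻¹ Γ (φ (Cycle.es Z i))) ]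
           (Cycle.joins Z i)))

  Balanced : Subset (nE G) → Set
  Balanced C = ∃[ Z ] (CycleEdges G Z C × walkGain Z ≡ ε Γ)

  UnbalancedCycle : Subset (nE G) → Set
  UnbalancedCycle C = IsCycle G C × ¬ Balanced C

  LGCircuit : Subset (nE G) → Set
  LGCircuit C =
    (IsCycle G C × Balanced C)
    ⊎ (∃[ C₁ ] ∃[ C₂ ] (UnbalancedCycle C₁ × UnbalancedCycle C₂ ×
         (∀ v → VertexOf G C₁ v → ¬ VertexOf G C₂ v) × C ≡ C₁ ∪ C₂))
    ⊎ (∃[ C₁ ] ∃[ C₂ ] (UnbalancedCycle C₁ × UnbalancedCycle C₂ ×
         (∃[ v ] (VertexOf G C₁ v × VertexOf G C₂ v ×
            (∀ w → VertexOf G C₁ w → VertexOf G C₂ w → w ≡ v))) ×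
         C ≡ C₁ ∪ C₂))
    ⊎ (IsTheta G C × (∀ D → D ⊆ C → IsCycle G D → ¬ Balanced D))

IsLGGraph : ∀ {k} (Γ : FinGroup) (G : Graph k) →
            (Fin (nE G) → Fin (order Γ)) → Set
IsLGGraph {k} Γ G φ =
  (∀ e → tail G e ≢ head G e) ×
  (∀ (i j : Fin k) → i ≢ j → ∀ γ → ∃[ e ] (Joins G e i j × φ e ≡ γ)) ×
  (∀ e f → SameEnds G e f → φ e ≡ φ f → e ≡ f) ×
  (∀ e f → SameEnds G e f → tail G e ≡ tail G f)

-- N ≅ LG⁺(k, Γ): LG⁺ is realised on Fin (suc (nE G)) with e₀ = zero and
-- the edge e of G as suc e; its circuits Circ satisfy
-- LG⁺ \ e₀ = LG(k,Γ) and LG⁺ / e₀ = M(G).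
IsoLGPlus : CircuitSys → ℕ → FinGroup → Set₁
IsoLGPlus N k Γ =
  Σ (Graph k) λ G → Σ (Fin (nE G) → Fin (order Γ)) λ φ →
  IsLGGraph Γ G φ ×
  Σ (Subset (suc (nE G)) → Set) λ Circ →
    let L : CircuitSys
        L = record { size = suc (nE G) ; ground = ⊤ ; Circuit = Circ }
    in (∀ C → Circuit (delete L zero) (outside ∷ C) ⇔ LGCircuit Γ G φ C) ×
       (∀ C → Circuit (contract L zero) (outside ∷ C) ⇔ IsCycle G C) ×
       (N ≅ L)

SiIsoMK : CircuitSys → ℕ → Set
SiIsoMK N n = ∃[ S ] (IsSimplificationSet N S × IsoMK (restrict N S) n)

{-# OPTIONS --safe #-}
-- Write M/x as a complete graph with t parallel edges per pair. Every circuit of M meets each vertex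
-- cut of this graph in no edge or at least two, and every triangle of it is a circuit either alone or
-- together with x. If a ∈ L i j and b ∈ L j k had no c ∈ L i k with {a , b , c} a circuit, then
-- b, x and L i k would form a U₂,ₜ₊₂ in M/a; so c exists, it is unique, and (a , b) ↦ c is an
-- associative partial product, since three circuit faces of a tetrahedron force the fourth. It is the
-- partial product of a group labelling of the edges. Chord by chord, a cycle of gain 1 is a circuit
-- of M and any other cycle is one together with x. Eliminating x from two unbalanced cycles and using
-- that circuits have no pendant edges, the remaining circuits are the handcuffs and thetas of LG.
module Submission where

open import Defs
open import Data.Nat using (ℕ; zero; suc; _≤_; _+_; z≤n; s≤s)
import Data.Nat as ℕ
import Data.Nat.Properties as ℕₚ
open import Data.Bool using (Bool; true; false)
open import Data.Fin using (Fin; zero; suc; inject₁; fromℕ; fromℕ<; toℕ; _<_)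
import Data.Fin.Properties as Finₚ
open import Data.Fin.Relation.Unary.Top using (view; ‵fromℕ; ‵inject₁)
open import Data.Fin.Subset
open import Data.Fin.Subset.Properties
open import Data.Vec using (Vec; []; _∷_; tabulate; lookup; here; there)
open import Data.Vec.Properties using (lookup∘tabulate; []=⇒lookup; lookup⇒[]=; ∷-injective)
import Data.List as List
open import Data.Product using (Σ; ∃; ∃-syntax; _×_; _,_; proj₁; proj₂)
open import Data.Sum using (_⊎_; inj₁; inj₂; [_,_])
import Data.Sum as Sum
open import Data.Empty using (⊥-elim) renaming (⊥ to Void)
open import Relation.Nullary using (¬_; Dec; yes; no; does)
open import Relation.Nullary.Decidable using (_×-dec_; _⊎-dec_; ¬?; dec-true)
open import Relation.Binary using (Tri; tri<; tri≈; tri>)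
open import Relation.Binary.PropositionalEquality hiding (J; [_])
open import Function using (Injective; _⇔_; mk⇔; Equivalence)
open import Algebra.Bundles using (Group)
open import Algebra.Structures using (IsGroup)
import Algebra.Properties.Group as GroupProps

-- Only the circuit axioms are given: there is no rank function, and `Circuit` is not assumed
-- decidable. Cuts take over the role of rank, since they forbid leaves and so determine most
-- eliminations. Case distinctions must carry their own evidence. For a triangle, the isomorphism
-- with the complete graph produces an actual circuit, and whether x lies in it can be read off.
-- Searching the t edges of a bundle then yields either the wanted edge or t circuits through x,
-- which is the input for the forbidden line. The isomorphism speaks only of one representative per
-- parallel class. This is why circuits are moved to representatives before the cut property can be
-- taken from the graph. Edges between the same two vertices cannot be multiplied directly. Vertex
-- zero is therefore taken as a root: edges at the root are points, the other edges act on these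
-- points, and the product of two labels is the effect of an action. Composing two such actions
-- takes three vertices besides the root, and here n ≥ 4 enters.

-- Finite search and subsets

⊎-second : ∀ {A B C : Set} → A ⊎ B ⊎ C → B ⊎ A ⊎ C
⊎-second (inj₁ a) = inj₂ (inj₁ a)
⊎-second (inj₂ (inj₁ b)) = inj₁ b
⊎-second (inj₂ (inj₂ c)) = inj₂ (inj₂ c)

⊎-third : ∀ {A B C : Set} → A ⊎ B ⊎ C → C ⊎ A ⊎ B
⊎-third (inj₁ a) = inj₂ (inj₁ a)
⊎-third (inj₂ (inj₁ b)) = inj₂ (inj₂ b)
⊎-third (inj₂ (inj₂ c)) = inj₁ c

-- Being a circuit is not decidable, so the search runs on a proof of one of two alternatives at
-- each index; neither alternative needs to be the negation of the other.
search : ∀ {n} {P Q : Fin n → Set} → (∀ i → P i ⊎ Q i) → ∃ P ⊎ (∀ i → Q i)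
search {zero} h = inj₂ λ ()
search {suc n} h with h zero
... | inj₁ p = inj₁ (zero , p)
... | inj₂ q with search (λ i → h (suc i))
...   | inj₁ (i , p) = inj₁ (suc i , p)
...   | inj₂ qs = inj₂ λ { zero → q ; (suc i) → qs i }

find : ∀ {n} {P : Fin n → Set} → (∀ i → Dec (P i)) → ∃ P ⊎ (∀ i → ¬ P i)
find d = search λ i → decide (d i)
  where
  decide : ∀ {A : Set} → Dec A → A ⊎ ¬ A
  decide (yes a) = inj₁ a
  decide (no ¬a) = inj₂ ¬a

find-∉ : ∀ {n} (C D : Subset n) → (∃[ f ] (f ∈ C × f ∉ D)) ⊎ C ⊆ D
find-∉ C D with search {P = λ f → f ∈ C × f ∉ D} {Q = λ f → f ∈ C → f ∈ D} test
  where
  test : ∀ f → (f ∈ C × f ∉ D) ⊎ (f ∈ C → f ∈ D)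
  test f with f ∈? D | f ∈? C
  ... | yes d | _ = inj₂ λ _ → d
  ... | no ¬d | yes c = inj₁ (c , ¬d)
  ... | no ¬d | no ¬c = inj₂ λ c → ⊥-elim (¬c c)
... | inj₁ r = inj₁ r
... | inj₂ q = inj₂ λ {f} → q f

module _ {m n} {f : Fin m → Fin n} {D : Subset n} where

  ∈-preimage⁻ : ∀ {x} → x ∈ preimage f D → f x ∈ D
  ∈-preimage⁻ {x} p = lookup⇒[]= (f x) D
    (trans (sym (lookup∘tabulate (λ x → lookup D (f x)) x)) ([]=⇒lookup p))

  ∈-preimage⁺ : ∀ {x} → f x ∈ D → x ∈ preimage f D
  ∈-preimage⁺ {x} p = lookup⇒[]= x _
    (trans (lookup∘tabulate (λ x → lookup D (f x)) x) ([]=⇒lookup p))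

module _ {n} {p : Subset n} {x : Fin n} where

  ∈-remove⁻ : ∀ {y} → y ∈ p - x → y ∈ p × y ≢ x
  ∈-remove⁻ {y} q = p─q⊆p p ⁅ x ⁆ q , λ { refl → notIn p x q }
    where
    notIn : ∀ {n} (p : Subset n) x → x ∉ p - x
    notIn (s ∷ p) zero ()
    notIn (s ∷ p) (suc x) (there q) = notIn p x q

∈-∪⁻ : ∀ {n} {p q : Subset n} {x} → x ∈ p ∪ q → x ∈ p ⊎ x ∈ q
∈-∪⁻ {p = p} {q} = x∈p∪q⁻ p q

∈-⁅⁆⁻ : ∀ {n} {x y : Fin n} → x ∈ ⁅ y ⁆ → x ≡ y
∈-⁅⁆⁻ {y = y} = x∈⁅y⁆⇒x≡y y

-- Circuit axioms, strong elimination and enumerations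

-- Elimination asks for an f in C outside D in place of C ≢ D, because strong elimination has to
-- retain such an f.
record Circuits {N : ℕ} (K : Subset N → Set) : Set where
  field
    nonempty : ∀ {C} → K C → Nonempty C
    incomp   : ∀ {C D} → K C → K D → C ⊆ D → D ⊆ C
    elim     : ∀ {C D e f} → K C → K D → e ∈ C → e ∈ D → f ∈ C → f ∉ D →
               ∃[ C′ ] (K C′ × (∀ {y} → y ∈ C′ → y ≢ e × (y ∈ C ⊎ y ∈ D)))

  -- An elimination C₃ of e that misses f contains some g ∈ D ∖ C; eliminating g from D and C₃
  -- keeps e, and the result C₄ then meets C in e with f still private to C and a smaller union.
  private
    strong : ∀ k {C D e f} → ∣ C ∪ D ∣ ℕ.< k → K C → K D → e ∈ C → e ∈ D → f ∈ C → f ∉ D →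
             ∃[ C′ ] (K C′ × f ∈ C′ × (∀ {y} → y ∈ C′ → y ≢ e × (y ∈ C ⊎ y ∈ D)))
    strong (suc k) {C} {D} {e} {f} (s≤s lt) KC KD eC eD fC f∉D
      with elim KC KD eC eD fC f∉D
    ... | C₃ , K₃ , b₃ with f ∈? C₃
    ...   | yes f3 = C₃ , K₃ , f3 , b₃
    ...   | no f∉3 with find-∉ C₃ C
    ...     | inj₂ sub = ⊥-elim (proj₁ (b₃ (incomp K₃ KC sub eC)) refl)
    ...     | inj₁ (g , g3 , g∉C) = result
      where
      fromD : ∀ {y} → y ∈ C ⊎ y ∈ D → y ∉ C → y ∈ D
      fromD (inj₁ c) n = ⊥-elim (n c)
      fromD (inj₂ d) n = d
      gD = fromD (proj₂ (b₃ g3)) g∉C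
      small₁ : ∣ D ∪ C₃ ∣ ℕ.< k
      small₁ = ℕₚ.<-≤-trans (p⊂q⇒∣p∣<∣q∣ (sub , f , x∈p∪q⁺ (inj₁ fC) , λ fu → out (∈-∪⁻ fu))) lt
        where
        case : ∀ {y} → y ∈ D ⊎ y ∈ C₃ → y ∈ C ∪ D
        case (inj₁ d) = x∈p∪q⁺ (inj₂ d)
        case (inj₂ c) = x∈p∪q⁺ (proj₂ (b₃ c))
        sub : D ∪ C₃ ⊆ C ∪ D
        sub yu = case (∈-∪⁻ yu)
        out : ¬ (f ∈ D ⊎ f ∈ C₃)
        out (inj₁ d) = f∉D d
        out (inj₂ c) = f∉3 c
      Result : Set
      Result = ∃[ C′ ] (K C′ × f ∈ C′ × (∀ {y} → y ∈ C′ → y ≢ e × (y ∈ C ⊎ y ∈ D)))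
      result : Result
      result with strong k small₁ KD K₃ gD g3 eD (λ e3 → proj₁ (b₃ e3) refl)
      ... | C₄ , K₄ , e4 , b₄ = finish
        where
        in4 : ∀ {y} → y ∈ C₄ → y ∈ C ⊎ y ∈ D
        in4 y4 with proj₂ (b₄ y4)
        ... | inj₁ d = inj₂ d
        ... | inj₂ c = proj₂ (b₃ c)
        f∉4 : f ∉ C₄
        f∉4 f4 with proj₂ (b₄ f4)
        ... | inj₁ d = f∉D d
        ... | inj₂ c = f∉3 c
        small₂ : ∣ C ∪ C₄ ∣ ℕ.< k
        small₂ = ℕₚ.<-≤-trans (p⊂q⇒∣p∣<∣q∣ (sub , g , x∈p∪q⁺ (inj₂ gD) , λ gu → out (∈-∪⁻ gu))) lt
          where
          case : ∀ {y} → y ∈ C ⊎ y ∈ C₄ → y ∈ C ∪ D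
          case (inj₁ c) = x∈p∪q⁺ (inj₁ c)
          case (inj₂ c) = x∈p∪q⁺ (in4 c)
          sub : C ∪ C₄ ⊆ C ∪ D
          sub yu = case (∈-∪⁻ yu)
          out : ¬ (g ∈ C ⊎ g ∈ C₄)
          out (inj₁ c) = g∉C c
          out (inj₂ c) = proj₁ (b₄ c) refl
        finish : Result
        finish with strong k small₂ KC K₄ eC e4 fC f∉4
        ... | C₅ , K₅ , f5 , b₅ = C₅ , K₅ , f5 , bound
          where
          bound : ∀ {y} → y ∈ C₅ → y ≢ e × (y ∈ C ⊎ y ∈ D)
          bound y5 with b₅ y5
          ... | ne , inj₁ c = ne , inj₁ c
          ... | ne , inj₂ c = ne , in4 c

  strong-elim : ∀ {C D e f} → K C → K D → e ∈ C → e ∈ D → f ∈ C → f ∉ D →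
                ∃[ C′ ] (K C′ × f ∈ C′ × (∀ {y} → y ∈ C′ → y ≢ e × (y ∈ C ⊎ y ∈ D)))
  strong-elim {C} {D} = strong (suc ∣ C ∪ D ∣) ℕₚ.≤-refl

-- P is a predicate and not a subset, since bundles of edges between two vertices are enumerated as
-- well. By `elt-idx` and `elt-inj` the index does not depend on the proof of P.
record Enum {N : ℕ} (P : Fin N → Set) (k : ℕ) : Set where
  field
    elt     : Fin k → Fin N
    elt-∈   : ∀ i → P (elt i)
    idx     : ∀ {x} → P x → Fin k
    elt-idx : ∀ {x} (p : P x) → elt (idx p) ≡ x
    elt-inj : ∀ {i j} → elt i ≡ elt j → i ≡ j

enum : ∀ {N} (P : Subset N) → Enum (_∈ P) ∣ P ∣
enum [] = record { elt = λ () ; elt-∈ = λ () ; idx = λ () ; elt-idx = λ () ; elt-inj = λ { {()} } }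
enum (inside ∷ P) = record
  { elt = λ { zero → zero ; (suc i) → suc (elt i) }
  ; elt-∈ = λ { zero → here ; (suc i) → there (elt-∈ i) }
  ; idx = λ { here → zero ; (there p) → suc (idx p) }
  ; elt-idx = λ { here → refl ; (there p) → cong suc (elt-idx p) }
  ; elt-inj = λ { {zero} {zero} _ → refl
                ; {suc i} {suc j} eq → cong suc (elt-inj (Finₚ.suc-injective eq)) } }
  where open Enum (enum P)
enum (outside ∷ P) = record
  { elt = λ i → suc (elt i)
  ; elt-∈ = λ i → there (elt-∈ i)
  ; idx = λ { (there p) → idx p }
  ; elt-idx = λ { (there p) → cong suc (elt-idx p) }
  ; elt-inj = λ eq → elt-inj (Finₚ.suc-injective eq) }
  where open Enum (enum P)

-- Walks, paths and cycles

module Walks {n : ℕ} (G : Graph n) (loopless : ∀ e → tail G e ≢ head G e) where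

  E V : Set
  E = Fin (nE G)
  V = Fin n

  J : E → V → V → Set
  J = Joins G

  At : E → V → Set
  At e v = tail G e ≡ v ⊎ head G e ≡ v

  J-sym : ∀ {e u v} → J e u v → J e v u
  J-sym (inj₁ x) = inj₂ x
  J-sym (inj₂ x) = inj₁ x

  J-ends : ∀ {e u v z} → J e u v → At e z → z ≡ u ⊎ z ≡ v
  J-ends (inj₁ (refl , refl)) (inj₁ refl) = inj₁ refl
  J-ends (inj₁ (refl , refl)) (inj₂ refl) = inj₂ refl
  J-ends (inj₂ (refl , refl)) (inj₁ refl) = inj₂ refl
  J-ends (inj₂ (refl , refl)) (inj₂ refl) = inj₁ refl

  J-at₁ : ∀ {e u v} → J e u v → At e u
  J-at₁ (inj₁ (a , b)) = inj₁ a
  J-at₁ (inj₂ (a , b)) = inj₂ b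

  J-at₂ : ∀ {e u v} → J e u v → At e v
  J-at₂ j = J-at₁ (J-sym j)

  J-≢ : ∀ {e u v} → J e u v → u ≢ v
  J-≢ {e} (inj₁ (refl , refl)) eq = loopless e eq
  J-≢ {e} (inj₂ (refl , refl)) eq = loopless e (sym eq)

  J-self : ∀ e → J e (tail G e) (head G e)
  J-self e = inj₁ (refl , refl)

  -- Walks as an inductive family can be concatenated, split and reversed by recursion; `FromFun`
  -- and `ToFun` translate from and to the paths and cycles given by functions on `Fin`.
  data P : V → V → Set where
    nil  : ∀ u → P u u
    cons : ∀ {u v w} (e : E) → J e u v → P v w → P u w

  _∈V_ : ∀ {u w} → V → P u w → Set
  z ∈V nil u = z ≡ u
  z ∈V cons {u} e j p = z ≡ u ⊎ z ∈V p

  _∈E_ : ∀ {u w} → E → P u w → Set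
  f ∈E nil u = Void
  f ∈E cons e j p = f ≡ e ⊎ f ∈E p

  _∈V?_ : ∀ {u w} z (p : P u w) → Dec (z ∈V p)
  z ∈V? nil u = z Finₚ.≟ u
  z ∈V? cons {u} e j p = (z Finₚ.≟ u) ⊎-dec (z ∈V? p)

  _∈E?_ : ∀ {u w} f (p : P u w) → Dec (f ∈E p)
  f ∈E? nil u = no λ ()
  f ∈E? cons e j p = (f Finₚ.≟ e) ⊎-dec (f ∈E? p)

  Simple-path : ∀ {u w} → P u w → Set
  Simple-path (nil u) = u ≡ u
  Simple-path (cons {u} e j p) = ¬ (u ∈V p) × Simple-path p

  start-∈ : ∀ {u w} (p : P u w) → u ∈V p
  start-∈ (nil u) = refl
  start-∈ (cons e j p) = inj₁ refl

  end-∈ : ∀ {u w} (p : P u w) → w ∈V p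
  end-∈ (nil u) = refl
  end-∈ (cons e j p) = inj₂ (end-∈ p)

  edge-ends : ∀ {u w e z} (p : P u w) → e ∈E p → At e z → z ∈V p
  edge-ends (cons e j p) (inj₁ refl) a with J-ends j a
  ... | inj₁ refl = inj₁ refl
  ... | inj₂ refl = inj₂ (start-∈ p)
  edge-ends (cons e j p) (inj₂ i) a = inj₂ (edge-ends p i a)

  first-∉ : ∀ {u v w e} {j : J e u v} {p : P v w} → ¬ (u ∈V p) → ¬ (e ∈E p)
  first-∉ {j = j} {p} h i = h (edge-ends p i (J-at₁ j))

  vertex-at-cons : ∀ {u v w z} e (j : J e u v) (p : P v w) → z ∈V cons e j p →
                   ∃[ f ] (f ∈E cons e j p × At f z)
  vertex-at-cons e j p (inj₁ refl) = e , inj₁ refl , J-at₁ j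
  vertex-at-cons e j (nil _) (inj₂ refl) = e , inj₁ refl , J-at₂ j
  vertex-at-cons e j (cons e′ j′ p) (inj₂ i) with vertex-at-cons e′ j′ p i
  ... | f , fp , a = f , inj₂ fp , a

  vertex-at : ∀ {u w z} (p : P u w) → z ∈V p → u ≢ w → ∃[ e ] (e ∈E p × At e z)
  vertex-at (nil u) _ ne = ⊥-elim (ne refl)
  vertex-at (cons e j p) i ne = vertex-at-cons e j p i

  infixr 5 _++_
  _++_ : ∀ {u v w} → P u v → P v w → P u w
  nil u ++ q = q
  cons e j p ++ q = cons e j (p ++ q)

  ∈V-++⁻ : ∀ {u v w z} (p : P u v) {q : P v w} → z ∈V (p ++ q) → z ∈V p ⊎ z ∈V q
  ∈V-++⁻ (nil u) i = inj₂ i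
  ∈V-++⁻ (cons e j p) (inj₁ eq) = inj₁ (inj₁ eq)
  ∈V-++⁻ (cons e j p) (inj₂ i) with ∈V-++⁻ p i
  ... | inj₁ a = inj₁ (inj₂ a)
  ... | inj₂ b = inj₂ b

  ∈V-++⁺ˡ : ∀ {u v w z} (p : P u v) {q : P v w} → z ∈V p → z ∈V (p ++ q)
  ∈V-++⁺ˡ (nil u) {q} refl = start-∈ q
  ∈V-++⁺ˡ (cons e j p) (inj₁ eq) = inj₁ eq
  ∈V-++⁺ˡ (cons e j p) (inj₂ i) = inj₂ (∈V-++⁺ˡ p i)

  ∈V-++⁺ʳ : ∀ {u v w z} (p : P u v) {q : P v w} → z ∈V q → z ∈V (p ++ q)
  ∈V-++⁺ʳ (nil u) i = i
  ∈V-++⁺ʳ (cons e j p) i = inj₂ (∈V-++⁺ʳ p i)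

  ∈E-++⁻ : ∀ {u v w f} (p : P u v) {q : P v w} → f ∈E (p ++ q) → f ∈E p ⊎ f ∈E q
  ∈E-++⁻ (nil u) i = inj₂ i
  ∈E-++⁻ (cons e j p) (inj₁ eq) = inj₁ (inj₁ eq)
  ∈E-++⁻ (cons e j p) (inj₂ i) with ∈E-++⁻ p i
  ... | inj₁ a = inj₁ (inj₂ a)
  ... | inj₂ b = inj₂ b

  ∈E-++⁺ : ∀ {u v w f} (p : P u v) {q : P v w} → f ∈E p ⊎ f ∈E q → f ∈E (p ++ q)
  ∈E-++⁺ (nil u) (inj₂ i) = i
  ∈E-++⁺ (cons e j p) (inj₁ (inj₁ eq)) = inj₁ eq
  ∈E-++⁺ (cons e j p) (inj₁ (inj₂ i)) = inj₂ (∈E-++⁺ p (inj₁ i))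
  ∈E-++⁺ (cons e j p) (inj₂ i) = inj₂ (∈E-++⁺ p (inj₂ i))

  simple-++⁺ : ∀ {u v w} (p : P u v) {q : P v w} → Simple-path p → Simple-path q →
               (∀ z → z ∈V p → z ∈V q → z ≡ v) → Simple-path (p ++ q)
  simple-++⁺ (nil u) sp sq h = sq
  simple-++⁺ (cons {u} e j p) {q} (u∉ , sp) sq h =
    out , simple-++⁺ p sp sq (λ z a b → h z (inj₂ a) b)
    where
    out : ¬ (u ∈V (p ++ q))
    out i with ∈V-++⁻ p i
    ... | inj₁ a = u∉ a
    ... | inj₂ b with h u (inj₁ refl) b
    ...   | refl = u∉ (end-∈ p)

  simple-++⁻ : ∀ {u v w} (p : P u v) {q : P v w} → Simple-path (p ++ q) →
               Simple-path p × Simple-path q × (∀ z → z ∈V p → z ∈V q → z ≡ v)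
  simple-++⁻ (nil u) s = refl , s , λ z a b → a
  simple-++⁻ (cons {u} e j p) {q} (u∉ , s) with simple-++⁻ p s
  ... | sp , sq , h = ((λ i → u∉ (∈V-++⁺ˡ p i)) , sp) , sq , meet
    where
    meet : ∀ z → z ≡ u ⊎ z ∈V p → z ∈V q → z ≡ _
    meet z (inj₁ refl) b = ⊥-elim (u∉ (∈V-++⁺ʳ p b))
    meet z (inj₂ a) b = h z a b

  rev : ∀ {u v} → P u v → P v u
  rev (nil u) = nil u
  rev (cons {u} e j p) = rev p ++ cons e (J-sym j) (nil u)

  ∈V-rev : ∀ {u v z} (p : P u v) → z ∈V rev p → z ∈V p
  ∈V-rev (nil u) i = i
  ∈V-rev (cons e j p) i with ∈V-++⁻ (rev p) i
  ... | inj₁ a = inj₂ (∈V-rev p a)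
  ... | inj₂ (inj₁ refl) = inj₂ (start-∈ p)
  ... | inj₂ (inj₂ refl) = inj₁ refl

  ∈E-rev⁻ : ∀ {u v f} (p : P u v) → f ∈E rev p → f ∈E p
  ∈E-rev⁻ (cons e j p) i with ∈E-++⁻ (rev p) i
  ... | inj₁ a = inj₂ (∈E-rev⁻ p a)
  ... | inj₂ (inj₁ refl) = inj₁ refl

  ∈E-rev⁺ : ∀ {u v f} (p : P u v) → f ∈E p → f ∈E rev p
  ∈E-rev⁺ (cons e j p) (inj₁ refl) = ∈E-++⁺ (rev p) (inj₂ (inj₁ refl))
  ∈E-rev⁺ (cons e j p) (inj₂ i) = ∈E-++⁺ (rev p) (inj₁ (∈E-rev⁺ p i))

  simple-rev : ∀ {u v} (p : P u v) → Simple-path p → Simple-path (rev p)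
  simple-rev (nil u) s = s
  simple-rev (cons {u} {v} e j p) (u∉ , s) =
    simple-++⁺ (rev p) (simple-rev p s) ((λ eq → J-≢ j (sym eq)) , refl) meet
    where
    meet : ∀ z → z ∈V rev p → z ≡ v ⊎ z ≡ u → z ≡ v
    meet z a (inj₁ eq) = eq
    meet z a (inj₂ refl) = ⊥-elim (u∉ (∈V-rev p a))

  split : ∀ {u w z} (p : P u w) → z ∈V p → Σ (P u z) λ l → Σ (P z w) λ r → p ≡ l ++ r
  split (nil u) refl = nil u , nil u , refl
  split (cons {u} e j p) (inj₁ refl) = nil u , cons e j p , refl
  split (cons e j p) (inj₂ i) with split p i
  ... | l , r , refl = cons e j l , r , refl

  module _ {B : V → Set} (B? : ∀ v → Dec (B v)) where

    first-hit : ∀ {u w} (p : P u w) →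
      (∃[ z ] (B z × Σ (P u z) λ l → Σ (P z w) λ r → p ≡ l ++ r × (∀ y → y ∈V l → B y → y ≡ z)))
      ⊎ (∀ y → y ∈V p → ¬ B y)
    first-hit (nil u) with B? u
    ... | yes b = inj₁ (u , b , nil u , nil u , refl , λ y a _ → a)
    ... | no ¬b = inj₂ λ { y refl → ¬b }
    first-hit (cons {u} e j p) with B? u
    ... | yes b = inj₁ (u , b , nil u , cons e j p , refl , λ y a _ → a)
    ... | no ¬b with first-hit p
    ...   | inj₁ (z , b , l , r , refl , h) =
      inj₁ (z , b , cons e j l , r , refl ,
            λ { y (inj₁ refl) by → ⊥-elim (¬b by) ; y (inj₂ i) by → h y i by })
    ...   | inj₂ h = inj₂ λ { y (inj₁ refl) → ¬b ; y (inj₂ i) → h y i }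

    last-hit : ∀ {u w} (p : P u w) →
      (∃[ z ] (B z × Σ (P u z) λ l → Σ (P z w) λ r → p ≡ l ++ r × (∀ y → y ∈V r → B y → y ≡ z)))
      ⊎ (∀ y → y ∈V p → ¬ B y)
    last-hit (nil u) with B? u
    ... | yes b = inj₁ (u , b , nil u , nil u , refl , λ y a _ → a)
    ... | no ¬b = inj₂ λ { y refl → ¬b }
    last-hit (cons {u} e j p) with last-hit p
    ... | inj₁ (z , b , l , r , refl , h) = inj₁ (z , b , cons e j l , r , refl , h)
    ... | inj₂ h with B? u
    ...   | yes b = inj₁ (u , b , nil u , cons e j p , refl ,
                          λ { y (inj₁ eq) _ → eq ; y (inj₂ i) by → ⊥-elim (h y i by) })
    ...   | no ¬b = inj₂ λ { y (inj₁ refl) → ¬b ; y (inj₂ i) → h y i }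

  -- A closing edge d and a simple path back. The field `d∉` excludes the walk along d and back
  -- along d; for longer p it holds anyway, as d joins the two ends of p.
  record Cyc (w : V) : Set where
    constructor cyc
    field
      {u}    : V
      d      : E
      j      : J d w u
      p      : P u w
      simple : Simple-path p
      d∉     : ¬ (d ∈E p)

  _∈C_ : ∀ {w} → E → Cyc w → Set
  f ∈C Z = f ≡ Cyc.d Z ⊎ f ∈E Cyc.p Z

  _∈VC_ : ∀ {w} → V → Cyc w → Set
  z ∈VC Z = z ∈V Cyc.p Z

  _∈C?_ : ∀ {w} f (Z : Cyc w) → Dec (f ∈C Z)
  f ∈C? Z = (f Finₚ.≟ Cyc.d Z) ⊎-dec (f ∈E? Cyc.p Z)

  cyc-ends : ∀ {w e z} (Z : Cyc w) → e ∈C Z → At e z → z ∈VC Z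
  cyc-ends (cyc d j p _ _) (inj₁ refl) a with J-ends j a
  ... | inj₁ refl = end-∈ p
  ... | inj₂ refl = start-∈ p
  cyc-ends (cyc d j p _ _) (inj₂ i) a = edge-ends p i a

  cyc-at : ∀ {w z} (Z : Cyc w) → z ∈VC Z → ∃[ e ] (e ∈C Z × At e z)
  cyc-at (cyc d j p _ _) i with vertex-at p i (λ eq → J-≢ j (sym eq))
  ... | e , a , b = e , inj₂ a , b

  -- The closed walk is cut open at z instead of w: it starts with e, follows r to w, crosses d and
  -- returns along l.
  rotate-at : ∀ {w u z y} {d} (j : J d w u) {e} (l : P u z) (k : J e z y) (r : P y w) →
              Simple-path (l ++ cons e k r) → ¬ (d ∈E (l ++ cons e k r)) →
              Σ (Cyc z) λ Z′ → Cyc.d Z′ ≡ e ×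
                (∀ f → f ≡ d ⊎ f ∈E (l ++ cons e k r) → f ∈C Z′) ×
                (∀ f → f ∈C Z′ → f ≡ d ⊎ f ∈E (l ++ cons e k r))
  rotate-at {w} {u} {z} {y} {d} j {e} l k r s d∉ = cyc e k q simple-q e∉ , refl , to , from
    where
    parts = simple-++⁻ l s
    sr : Simple-path r
    sr = proj₂ (proj₁ (proj₂ parts))
    z∉r : ¬ (z ∈V r)
    z∉r = proj₁ (proj₁ (proj₂ parts))
    meet = proj₂ (proj₂ parts)
    q : P y z
    q = r ++ cons d j l
    w∉l : ¬ (w ∈V l)
    w∉l a with meet w a (inj₂ (end-∈ r))
    ... | refl = z∉r (end-∈ r)
    over : ∀ v → v ∈V r → v ≡ w ⊎ v ∈V l → v ≡ w
    over v a (inj₁ eq) = eq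
    over v a (inj₂ b) with meet v b (inj₂ a)
    ... | refl = ⊥-elim (z∉r a)
    simple-q : Simple-path q
    simple-q = simple-++⁺ r sr (w∉l , proj₁ parts) over
    e∉ : ¬ (e ∈E q)
    e∉ a with ∈E-++⁻ r a
    ... | inj₁ b = z∉r (edge-ends r b (J-at₁ k))
    ... | inj₂ (inj₁ refl) = d∉ (∈E-++⁺ l (inj₂ (inj₁ refl)))
    ... | inj₂ (inj₂ b) with meet y (edge-ends l b (J-at₂ k)) (inj₂ (start-∈ r))
    ...   | refl = J-≢ k refl
    to : ∀ f → f ≡ d ⊎ f ∈E (l ++ cons e k r) → f ≡ e ⊎ f ∈E q
    to f (inj₁ refl) = inj₂ (∈E-++⁺ r (inj₂ (inj₁ refl)))
    to f (inj₂ a) with ∈E-++⁻ l a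
    ... | inj₁ b = inj₂ (∈E-++⁺ r (inj₂ (inj₂ b)))
    ... | inj₂ (inj₁ refl) = inj₁ refl
    ... | inj₂ (inj₂ b) = inj₂ (∈E-++⁺ r (inj₁ b))
    from : ∀ f → f ≡ e ⊎ f ∈E q → f ≡ d ⊎ f ∈E (l ++ cons e k r)
    from f (inj₁ refl) = inj₂ (∈E-++⁺ l (inj₂ (inj₁ refl)))
    from f (inj₂ a) with ∈E-++⁻ r a
    ... | inj₁ b = inj₂ (∈E-++⁺ l (inj₂ (inj₂ b)))
    ... | inj₂ (inj₁ refl) = inj₁ refl
    ... | inj₂ (inj₂ b) = inj₂ (∈E-++⁺ l (inj₁ b))

  rotate : ∀ {w z} (Z : Cyc w) → z ∈VC Z →
           Σ (Cyc z) λ Z′ → (∀ f → f ∈C Z → f ∈C Z′) × (∀ f → f ∈C Z′ → f ∈C Z)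
  rotate Z@(cyc d j p s d∉) i with split p i
  ... | l , nil _ , refl = Z , (λ f x → x) , (λ f x → x)
  ... | l , cons e k r , refl with rotate-at j l k r s d∉
  ...   | Z′ , _ , to , from = Z′ , to , from

  split-edge : ∀ {u w e} (p : P u w) → e ∈E p →
               ∃[ z ] ∃[ y ] Σ (P u z) λ l → Σ (J e z y) λ k → Σ (P y w) λ r → p ≡ l ++ cons e k r
  split-edge (cons {u} e j p) (inj₁ refl) = _ , _ , nil u , j , p , refl
  split-edge (cons e j p) (inj₂ i) with split-edge p i
  ... | _ , _ , l , k , r , refl = _ , _ , cons e j l , k , r , refl

  rotate-edge : ∀ {w e} (Z : Cyc w) → e ∈C Z →
                ∃[ z ] Σ (Cyc z) λ Z′ → Cyc.d Z′ ≡ e × (∀ f → f ∈C Z′ → f ∈C Z)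
  rotate-edge Z (inj₁ refl) = _ , Z , refl , λ f i → i
  rotate-edge (cyc d j p s d∉) (inj₂ i) with split-edge p i
  ... | _ , _ , l , k , r , refl with rotate-at j l k r s d∉
  ...   | Z′ , eq , _ , from = _ , Z′ , eq , from

  Leafless : Subset (nE G) → Set
  Leafless C = ∀ v e → e ∈ C → At e v → ∃[ f ] (f ∈ C × f ≢ e × At f v)

  module _ (C : Subset (nE G)) (leafless : Leafless C) where

    -- At an inner vertex of q the only possible edges of C are the two of q, and leaflessness
    -- admits both or neither. Membership in C thus spreads in both directions along q.
    path-all : ∀ {a b} (q : P a b) → Simple-path q →
      (∀ z g → z ∈V q → z ≢ a → z ≢ b → g ∈ C → At g z → g ∈E q) →
      ∀ {e f} → e ∈E q → e ∈ C → f ∈E q → f ∈ C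
    path-all (cons e₁ j₁ (nil _)) s h (inj₁ refl) ec (inj₁ refl) = ec
    path-all {a} {b} (cons {v = y} e₁ j₁ (cons e₂ j₂ q)) (a∉ , y∉ , s) h = go
      where
      q′ = cons e₂ j₂ q
      only : ∀ g → g ∈ C → At g y → g ≡ e₁ ⊎ g ≡ e₂
      only g gc at with h y g (inj₂ (inj₁ refl)) (λ eq → J-≢ j₁ (sym eq)) (λ { refl → y∉ (end-∈ q) }) gc at
      ... | inj₁ eq = inj₁ eq
      ... | inj₂ (inj₁ eq) = inj₂ eq
      ... | inj₂ (inj₂ i) = ⊥-elim (y∉ (edge-ends q i at))
      step : e₁ ∈ C → e₂ ∈ C
      step c with leafless y e₁ c (J-at₂ j₁)
      ... | f , fc , ne , at with only f fc at
      ...   | inj₁ eq = ⊥-elim (ne eq)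
      ...   | inj₂ refl = fc
      back : e₂ ∈ C → e₁ ∈ C
      back c with leafless y e₂ c (J-at₁ j₂)
      ... | f , fc , ne , at with only f fc at
      ...   | inj₁ refl = fc
      ...   | inj₂ eq = ⊥-elim (ne eq)
      h′ : ∀ z g → z ∈V q′ → z ≢ y → z ≢ b → g ∈ C → At g z → g ∈E q′
      h′ z g zi z≢y z≢b gc at with h z g (inj₂ zi) (λ { refl → a∉ zi }) z≢b gc at
      ... | inj₂ i = i
      ... | inj₁ refl with J-ends j₁ at
      ...   | inj₁ refl = ⊥-elim (a∉ zi)
      ...   | inj₂ eq = ⊥-elim (z≢y eq)
      rec : ∀ {e f} → e ∈E q′ → e ∈ C → f ∈E q′ → f ∈ C
      rec = path-all q′ (y∉ , s) h′
      go : ∀ {e f} → e ≡ e₁ ⊎ e ∈E q′ → e ∈ C → f ≡ e₁ ⊎ f ∈E q′ → f ∈ C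
      go (inj₁ refl) ec (inj₁ refl) = ec
      go (inj₁ refl) ec (inj₂ f) = rec (inj₁ refl) (step ec) f
      go (inj₂ e) ec (inj₁ refl) = back (rec e ec (inj₁ refl))
      go (inj₂ e) ec (inj₂ f) = rec e ec f

    -- Around a cycle membership spreads as in `path-all`. The base vertex w is exempt from the
    -- assumption, so that C may contain further edges attached there.
    cycle-all : ∀ {w} (Z : Cyc w) →
      (∀ z g → z ∈VC Z → z ≢ w → g ∈ C → At g z → g ∈C Z) →
      ∀ {e f} → e ∈C Z → e ∈ C → f ∈C Z → f ∈ C
    cycle-all (cyc d j (nil _) s d∉) h = ⊥-elim (J-≢ j refl)
    cycle-all {w} (cyc {u} d j (cons e₁ j₁ q) s@(u∉ , _) d∉) h = go
      where
      p = cons e₁ j₁ q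
      u≢w : u ≢ w
      u≢w eq = J-≢ j (sym eq)
      only : ∀ g → g ∈ C → At g u → g ≡ d ⊎ g ≡ e₁
      only g gc at with h u g (inj₁ refl) u≢w gc at
      ... | inj₁ eq = inj₁ eq
      ... | inj₂ (inj₁ eq) = inj₂ eq
      ... | inj₂ (inj₂ i) = ⊥-elim (u∉ (edge-ends q i at))
      step : d ∈ C → e₁ ∈ C
      step c with leafless u d c (J-at₂ j)
      ... | f , fc , ne , at with only f fc at
      ...   | inj₁ eq = ⊥-elim (ne eq)
      ...   | inj₂ refl = fc
      back : e₁ ∈ C → d ∈ C
      back c with leafless u e₁ c (J-at₁ j₁)
      ... | f , fc , ne , at with only f fc at
      ...   | inj₁ refl = fc
      ...   | inj₂ eq = ⊥-elim (ne eq)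
      h′ : ∀ z g → z ∈V p → z ≢ u → z ≢ w → g ∈ C → At g z → g ∈E p
      h′ z g zi z≢u z≢w gc at with h z g zi z≢w gc at
      ... | inj₂ i = i
      ... | inj₁ refl with J-ends j at
      ...   | inj₁ eq = ⊥-elim (z≢w eq)
      ...   | inj₂ eq = ⊥-elim (z≢u eq)
      rec : ∀ {e f} → e ∈E p → e ∈ C → f ∈E p → f ∈ C
      rec = path-all p s h′
      go : ∀ {e f} → e ≡ d ⊎ e ∈E p → e ∈ C → f ≡ d ⊎ f ∈E p → f ∈ C
      go (inj₁ refl) ec (inj₁ refl) = ec
      go (inj₁ refl) ec (inj₂ f) = rec (inj₁ refl) (step ec) f
      go (inj₂ e) ec (inj₁ refl) = back (rec e ec (inj₁ refl))
      go (inj₂ e) ec (inj₂ f) = rec e ec f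

  Crosses : Subset n → E → Set
  Crosses A e = (tail G e ∈ A × head G e ∉ A) ⊎ (tail G e ∉ A × head G e ∈ A)

  Crosses? : ∀ A e → Dec (Crosses A e)
  Crosses? A e = ((tail G e ∈? A) ×-dec ¬? (head G e ∈? A)) ⊎-dec (¬? (tail G e ∈? A) ×-dec (head G e ∈? A))

  crosses-J : ∀ {A e u v} → J e u v → u ∈ A → v ∉ A → Crosses A e
  crosses-J (inj₁ (refl , refl)) a b = inj₁ (a , b)
  crosses-J (inj₂ (refl , refl)) a b = inj₂ (b , a)

  crosses-vertex : ∀ {v e} → At e v → Crosses ⁅ v ⁆ e
  crosses-vertex {v} {e} (inj₁ refl) = inj₁ (x∈⁅x⁆ v , λ i → loopless e (sym (∈-⁅⁆⁻ i)))
  crosses-vertex {v} {e} (inj₂ refl) = inj₂ ((λ i → loopless e (∈-⁅⁆⁻ i)) , x∈⁅x⁆ v)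

  vertex-crosses : ∀ {v e} → Crosses ⁅ v ⁆ e → At e v
  vertex-crosses (inj₁ (a , _)) = inj₁ (∈-⁅⁆⁻ a)
  vertex-crosses (inj₂ (_ , a)) = inj₂ (∈-⁅⁆⁻ a)

  -- Orthogonality to the cuts of the graph, as a cocircuit never meets a circuit in one element.
  -- The cut around a single vertex gives leaflessness.
  Cuts : Subset (nE G) → Set
  Cuts C = ∀ A e → e ∈ C → Crosses A e → ∃[ f ] (f ∈ C × f ≢ e × Crosses A f)

  path-crosses : ∀ A {u w} (p : P u w) → u ∈ A → w ∉ A → ∃[ f ] (f ∈E p × Crosses A f)
  path-crosses A (nil u) a b = ⊥-elim (b a)
  path-crosses A (cons {v = v} e j p) a b with v ∈? A
  ... | no v∉ = e , inj₁ refl , crosses-J j a v∉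
  ... | yes v∈ with path-crosses A p v∈ b
  ...   | f , i , x = f , inj₂ i , x

  crosses-sides : ∀ {A e u v} → J e u v → Crosses A e → (u ∈ A × v ∉ A) ⊎ (v ∈ A × u ∉ A)
  crosses-sides (inj₁ (refl , refl)) (inj₁ (a , b)) = inj₁ (a , b)
  crosses-sides (inj₁ (refl , refl)) (inj₂ (a , b)) = inj₂ (b , a)
  crosses-sides (inj₂ (refl , refl)) (inj₁ (a , b)) = inj₂ (a , b)
  crosses-sides (inj₂ (refl , refl)) (inj₂ (a , b)) = inj₁ (b , a)

  -- With the cycle rotated to start with e, the remaining path leads from one side of the cut to
  -- the other and has to cross it again.
  cycle-cuts : ∀ {w} (Z : Cyc w) A e → e ∈C Z → Crosses A e → ∃[ f ] (f ∈C Z × f ≢ e × Crosses A f)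
  cycle-cuts Z A e i x with rotate-edge Z i
  ... | _ , cyc d j p _ d∉ , refl , from with crosses-sides j x
  ...   | inj₂ (a , b) with path-crosses A p a b
  ...     | f , fp , y = f , from f (inj₂ fp) , (λ { refl → d∉ fp }) , y
  cycle-cuts Z A e i x | _ , cyc d j p _ d∉ , refl , from | inj₁ (a , b) with path-crosses A (rev p) a b
  ...     | f , fp , y = f , from f (inj₂ (∈E-rev⁻ p fp)) , (λ { refl → d∉ (∈E-rev⁻ p fp) }) , y

  cuts⇒leafless : ∀ {C} → Cuts C → Leafless C
  cuts⇒leafless h v e ec at with h ⁅ v ⁆ e ec (crosses-vertex at)
  ... | f , fc , ne , x = f , fc , ne , vertex-crosses x

  module _ {D : E → Set} (D? : ∀ e → Dec (D e)) (u : V) where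

    private
      Reached : Subset n → Set
      Reached A = ∀ z → z ∈ A →
        Σ (P z u) λ p → Simple-path p × (∀ y → y ∈V p → y ∈ A) × (∀ e → e ∈E p → D e)

      extend : ∀ {A y z e} → Reached A → y ∉ A → z ∈ A → D e → J e y z → Reached (A ∪ ⁅ y ⁆)
      extend {A} {y} {z} {e} R y∉ z∈ de j t t∈ with ∈-∪⁻ t∈
      ... | inj₁ a with R t a
      ...   | p , s , vs , es = p , s , (λ v i → x∈p∪q⁺ (inj₁ (vs v i))) , es
      extend {A} {y} {z} {e} R y∉ z∈ de j t t∈ | inj₂ b with ∈-⁅⁆⁻ b | R z z∈
      ... | refl | p , s , vs , es =
        cons e j p , ((λ i → y∉ (vs y i)) , s) ,
        (λ { v (inj₁ refl) → x∈p∪q⁺ (inj₂ (x∈⁅x⁆ v)) ; v (inj₂ i) → x∈p∪q⁺ (inj₁ (vs v i)) }) ,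
        (λ { f (inj₁ refl) → de ; f (inj₂ i) → es f i })

      grow : ∀ {A : Subset n} {y} → y ∉ A → ∣ A ∣ ℕ.< ∣ A ∪ ⁅ y ⁆ ∣
      grow {A} {y} y∉ = p⊂q⇒∣p∣<∣q∣ (p⊆p∪q ⁅ y ⁆ , y , x∈p∪q⁺ (inj₂ (x∈⁅x⁆ y)) , y∉)

      Closure : Set
      Closure = ∃[ B ] (u ∈ B × Reached B × (∀ e → D e → ¬ Crosses B e))

      -- The number k bounds the vertices that may still be added: each step enlarges A, and at k =
      -- 0 the set would have more than n elements.
      close : ∀ k A → n ℕ.< k + ∣ A ∣ → u ∈ A → Reached A → Closure
      close zero A lt uA R = ⊥-elim (ℕₚ.<⇒≱ lt (∣p∣≤n A))
      close (suc k) A lt uA R with find (λ e → D? e ×-dec Crosses? A e)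
      ... | inj₂ none = A , uA , R , λ e d c → none e (d , c)
      ... | inj₁ (e , de , x) = next x
        where
        next : Crosses A e → Closure
        next′ : ∀ {y z} → y ∉ A → z ∈ A → J e y z → Closure
        next′ {y} y∉ z∈ j = close k (A ∪ ⁅ y ⁆)
          (ℕₚ.<-≤-trans lt (subst (_≤ k + ∣ A ∪ ⁅ y ⁆ ∣) (ℕₚ.+-suc k ∣ A ∣) (ℕₚ.+-monoʳ-≤ k (grow y∉))))
          (x∈p∪q⁺ (inj₁ uA)) (extend R y∉ z∈ de j)
        next (inj₁ (t∈ , h∉)) = next′ h∉ t∈ (J-sym (J-self e))
        next (inj₂ (t∉ , h∈)) = next′ t∉ h∈ (J-self e)

    reach : ∀ v → (Σ (P v u) λ p → Simple-path p × (∀ e → e ∈E p → D e))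
                  ⊎ (∃[ B ] (u ∈ B × v ∉ B × (∀ e → D e → ¬ Crosses B e)))
    reach v with close (suc n) ⁅ u ⁆ (ℕₚ.m≤m+n (suc n) _) (x∈⁅x⁆ u) init
      where
      init : Reached ⁅ u ⁆
      init z z∈ with ∈-⁅⁆⁻ z∈
      ... | refl = nil u , refl , (λ { y refl → x∈⁅x⁆ u }) , λ e ()
    ... | B , uB , R , none with v ∈? B
    ...   | no v∉ = inj₂ (B , uB , v∉ , none)
    ...   | yes v∈ with R v v∈
    ...     | p , s , _ , es = inj₁ (p , s , es)

  -- If C without f did not connect the ends of f, the component of one end would give a cut that
  -- meets C in f alone.
  cycle-through : ∀ {C} → Cuts C → ∀ f → f ∈ C →
                  Σ (Cyc (tail G f)) λ Z → Cyc.d Z ≡ f × (∀ e → e ∈C Z → e ∈ C)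
  cycle-through {C} cuts f fC
    with reach {D = λ e → e ∈ C × e ≢ f} (λ e → (e ∈? C) ×-dec ¬? (e Finₚ.≟ f)) (tail G f) (head G f)
  ... | inj₁ (p , s , es) =
    cyc f (J-self f) p s (λ i → proj₂ (es f i) refl) , refl ,
    λ { e (inj₁ refl) → fC ; e (inj₂ i) → proj₁ (es e i) }
  ... | inj₂ (B , t∈ , h∉ , none) with cuts B f fC (inj₁ (t∈ , h∉))
  ...   | g , gC , ne , x = ⊥-elim (none g (gC , ne) x)

  edges : ∀ {u w} → P u w → Subset (nE G)
  edges (nil u) = ⊥
  edges (cons e j p) = ⁅ e ⁆ ∪ edges p

  ∈-edges⁻ : ∀ {u w f} (p : P u w) → f ∈ edges p → f ∈E p
  ∈-edges⁻ (nil u) i = ⊥-elim (∉⊥ i)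
  ∈-edges⁻ (cons e j p) i with ∈-∪⁻ i
  ... | inj₁ a = inj₁ (∈-⁅⁆⁻ a)
  ... | inj₂ b = inj₂ (∈-edges⁻ p b)

  ∈-edges⁺ : ∀ {u w f} (p : P u w) → f ∈E p → f ∈ edges p
  ∈-edges⁺ (cons e j p) (inj₁ refl) = x∈p∪q⁺ (inj₁ (x∈⁅x⁆ e))
  ∈-edges⁺ (cons e j p) (inj₂ i) = x∈p∪q⁺ (inj₂ (∈-edges⁺ p i))

  cyc-edges : ∀ {w} → Cyc w → Subset (nE G)
  cyc-edges Z = ⁅ Cyc.d Z ⁆ ∪ edges (Cyc.p Z)

  ∈-cyc⁻ : ∀ {w f} (Z : Cyc w) → f ∈ cyc-edges Z → f ∈C Z
  ∈-cyc⁻ Z i with ∈-∪⁻ i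
  ... | inj₁ a = inj₁ (∈-⁅⁆⁻ a)
  ... | inj₂ b = inj₂ (∈-edges⁻ (Cyc.p Z) b)

  ∈-cyc⁺ : ∀ {w f} (Z : Cyc w) → f ∈C Z → f ∈ cyc-edges Z
  ∈-cyc⁺ Z (inj₁ refl) = x∈p∪q⁺ (inj₁ (x∈⁅x⁆ _))
  ∈-cyc⁺ Z (inj₂ i) = x∈p∪q⁺ (inj₂ (∈-edges⁺ (Cyc.p Z) i))

  module FromFun where

    path : ∀ l (vs : Fin (suc l) → V) (es : Fin l → E) →
           (∀ i → J (es i) (vs (inject₁ i)) (vs (suc i))) → P (vs zero) (vs (fromℕ l))
    path zero vs es js = nil (vs zero)
    path (suc l) vs es js =
      cons (es zero) (js zero) (path l (λ i → vs (suc i)) (λ i → es (suc i)) (λ i → js (suc i)))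

    ∈E⁻ : ∀ l vs es js {f} → f ∈E path l vs es js → ∃[ i ] (es i ≡ f)
    ∈E⁻ (suc l) vs es js (inj₁ refl) = zero , refl
    ∈E⁻ (suc l) vs es js (inj₂ i) with ∈E⁻ l (λ i → vs (suc i)) (λ i → es (suc i)) (λ i → js (suc i)) i
    ... | k , eq = suc k , eq

    ∈E⁺ : ∀ l vs es js i → es i ∈E path l vs es js
    ∈E⁺ (suc l) vs es js zero = inj₁ refl
    ∈E⁺ (suc l) vs es js (suc i) = inj₂ (∈E⁺ l (λ i → vs (suc i)) (λ i → es (suc i)) (λ i → js (suc i)) i)

    ∈V⁻ : ∀ l vs es js {z} → z ∈V path l vs es js → ∃[ i ] (vs i ≡ z)
    ∈V⁻ zero vs es js refl = zero , refl
    ∈V⁻ (suc l) vs es js (inj₁ refl) = zero , refl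
    ∈V⁻ (suc l) vs es js (inj₂ i) with ∈V⁻ l (λ i → vs (suc i)) (λ i → es (suc i)) (λ i → js (suc i)) i
    ... | k , eq = suc k , eq

    simple : ∀ l vs es js → Injective _≡_ _≡_ vs → Simple-path (path l vs es js)
    simple zero vs es js inj = refl
    simple (suc l) vs es js inj =
      (λ i → distinct (∈V⁻ l (λ i → vs (suc i)) (λ i → es (suc i)) (λ i → js (suc i)) i)) ,
      simple l (λ i → vs (suc i)) (λ i → es (suc i)) (λ i → js (suc i)) (λ eq → Finₚ.suc-injective (inj eq))
      where
      distinct : ¬ (∃[ i ] (vs (suc i) ≡ vs zero))
      distinct (i , eq) with inj eq
      ... | ()

  module ToFun where

    len : ∀ {u w} → P u w → ℕ
    len (nil u) = zero
    len (cons e j p) = suc (len p)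

    vs : ∀ {u w} (p : P u w) → Fin (suc (len p)) → V
    vs (nil u) _ = u
    vs (cons {u} e j p) zero = u
    vs (cons e j p) (suc i) = vs p i

    es : ∀ {u w} (p : P u w) → Fin (len p) → E
    es (cons e j p) zero = e
    es (cons e j p) (suc i) = es p i

    vs-start : ∀ {u w} (p : P u w) → vs p zero ≡ u
    vs-start (nil u) = refl
    vs-start (cons e j p) = refl

    vs-end : ∀ {u w} (p : P u w) → vs p (fromℕ (len p)) ≡ w
    vs-end (nil u) = refl
    vs-end (cons e j p) = vs-end p

    js : ∀ {u w} (p : P u w) i → J (es p i) (vs p (inject₁ i)) (vs p (suc i))
    js (cons {u} e j p) zero = subst (J e u) (sym (vs-start p)) j
    js (cons e j p) (suc i) = js p i

    vs-∈ : ∀ {u w} (p : P u w) i → vs p i ∈V p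
    vs-∈ (nil u) i = refl
    vs-∈ (cons e j p) zero = inj₁ refl
    vs-∈ (cons e j p) (suc i) = inj₂ (vs-∈ p i)

    es-∈ : ∀ {u w} (p : P u w) i → es p i ∈E p
    es-∈ (cons e j p) zero = inj₁ refl
    es-∈ (cons e j p) (suc i) = inj₂ (es-∈ p i)

    ∈-es : ∀ {u w f} (p : P u w) → f ∈E p → ∃[ i ] (es p i ≡ f)
    ∈-es (cons e j p) (inj₁ refl) = zero , refl
    ∈-es (cons e j p) (inj₂ i) with ∈-es p i
    ... | k , eq = suc k , eq

    vs-inj : ∀ {u w} (p : P u w) → Simple-path p → Injective _≡_ _≡_ (vs p)
    vs-inj (nil u) s {zero} {zero} eq = refl
    vs-inj (cons e j p) (u∉ , s) {zero} {zero} eq = refl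
    vs-inj (cons e j p) (u∉ , s) {zero} {suc y} refl = ⊥-elim (u∉ (vs-∈ p y))
    vs-inj (cons e j p) (u∉ , s) {suc x} {zero} refl = ⊥-elim (u∉ (vs-∈ p x))
    vs-inj (cons e j p) (u∉ , s) {suc x} {suc y} eq = cong suc (vs-inj p s eq)

    es-inj : ∀ {u w} (p : P u w) → Simple-path p → Injective _≡_ _≡_ (es p)
    es-inj (cons e j p) (u∉ , s) {zero} {zero} eq = refl
    es-inj (cons e j p) (u∉ , s) {zero} {suc y} refl = ⊥-elim (first-∉ {j = j} {p} u∉ (es-∈ p y))
    es-inj (cons e j p) (u∉ , s) {suc x} {zero} refl = ⊥-elim (first-∉ {j = j} {p} u∉ (es-∈ p x))
    es-inj (cons e j p) (u∉ , s) {suc x} {suc y} eq = cong suc (es-inj p s eq)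

    toPath : ∀ {u w} (p : P u w) → Simple-path p → Path G u w
    toPath p s = record
      { len = len p ; vs = vs p ; es = es p ; start = vs-start p ; end = vs-end p
      ; vs-inj = vs-inj p s ; es-inj = es-inj p s ; joins = js p }

    toPath-edges : ∀ {u w} (p : P u w) (s : Simple-path p) → PathEdges G (toPath p s) (edges p)
    toPath-edges p s f = mk⇔ (λ i → ∈-es p (∈-edges⁻ p i))
                             (λ { (i , refl) → ∈-edges⁺ p (es-∈ p i) })

    toCycle : ∀ {w} → Cyc w → Cycle G
    toCycle {w} (cyc {u} d j p s d∉) = record
      { len = len p ; vs = vs′ ; es = es′ ; closed = vs-end p
      ; vs-inj = inj-v ; es-inj = inj-e ; joins = joins′ }
      where
      vs′ : Fin (suc (suc (len p))) → V
      vs′ zero = w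
      vs′ (suc i) = vs p i
      es′ : Fin (suc (len p)) → E
      es′ zero = d
      es′ (suc i) = es p i
      last≢ : ∀ i → w ≡ vs p (inject₁ i) → Void
      last≢ i eq = Finₚ.fromℕ≢inject₁ (vs-inj p s (trans (vs-end p) eq))
      inj-v : ∀ a b → vs′ (inject₁ a) ≡ vs′ (inject₁ b) → a ≡ b
      inj-v zero zero eq = refl
      inj-v zero (suc b) eq = ⊥-elim (last≢ b eq)
      inj-v (suc a) zero eq = ⊥-elim (last≢ a (sym eq))
      inj-v (suc a) (suc b) eq = cong suc (Finₚ.inject₁-injective (vs-inj p s eq))
      inj-e : Injective _≡_ _≡_ es′
      inj-e {zero} {zero} eq = refl
      inj-e {zero} {suc y} refl = ⊥-elim (d∉ (es-∈ p y))
      inj-e {suc x} {zero} refl = ⊥-elim (d∉ (es-∈ p x))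
      inj-e {suc x} {suc y} eq = cong suc (es-inj p s eq)
      joins′ : ∀ i → J (es′ i) (vs′ (inject₁ i)) (vs′ (suc i))
      joins′ zero = subst (J d w) (sym (vs-start p)) j
      joins′ (suc i) = js p i

    toCycle-edges : ∀ {w} (Z : Cyc w) → CycleEdges G (toCycle Z) (cyc-edges Z)
    toCycle-edges Z@(cyc d j p s d∉) f = mk⇔ to from
      where
      to : f ∈ cyc-edges Z → ∃[ i ] (Cycle.es (toCycle Z) i ≡ f)
      to i with ∈-cyc⁻ Z i
      ... | inj₁ refl = zero , refl
      ... | inj₂ a with ∈-es p a
      ...   | k , eq = suc k , eq
      from : ∃[ i ] (Cycle.es (toCycle Z) i ≡ f) → f ∈ cyc-edges Z
      from (zero , refl) = ∈-cyc⁺ Z (inj₁ refl)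
      from (suc i , refl) = ∈-cyc⁺ Z (inj₂ (es-∈ p i))

  Is : ∀ {w} → Cyc w → Subset (nE G) → Set
  Is Z C = (∀ f → f ∈ C → f ∈C Z) × (∀ f → f ∈C Z → f ∈ C)

  isCycle : ∀ {w} (Z : Cyc w) {C} → Is Z C → IsCycle G C
  isCycle Z {C} (to , from) = ToFun.toCycle Z , λ f →
    mk⇔ (λ i → Equivalence.to (ToFun.toCycle-edges Z f) (∈-cyc⁺ Z (to f i)))
        (λ x → from f (∈-cyc⁻ Z (Equivalence.from (ToFun.toCycle-edges Z f) x)))

  fromPath : ∀ {u v} (Q : Path G u v) → Σ (P u v) λ p → Simple-path p ×
             (∀ {f} → f ∈E p → ∃[ i ] (Path.es Q i ≡ f)) × (∀ i → Path.es Q i ∈E p) ×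
             (∀ {z} → z ∈V p → ∃[ i ] (Path.vs Q i ≡ z))
  fromPath record { len = l ; vs = vs ; es = es ; start = refl ; end = refl ; vs-inj = inj ; joins = js } =
    path l vs es js , simple l vs es js inj , ∈E⁻ l vs es js , ∈E⁺ l vs es js , ∈V⁻ l vs es js
    where open FromFun

  -- No group laws are required, so gains can be compared between the two encodings of walks for
  -- arbitrary operations, before any group has been constructed.
  module Gain {A : Set} (_·_ : A → A → A) (ε : A) (inv : A → A) (φ : E → A) where

    label : ∀ {e u v} → J e u v → A
    label {e} = [ (λ _ → φ e) , (λ _ → inv (φ e)) ]

    gain : ∀ {u w} → P u w → A
    gain (nil u) = ε
    gain (cons e j p) = label j · gain p

    gain-path : ∀ l vs es js → gain (FromFun.path l vs es js) ≡
                List.foldr _·_ ε (List.tabulate (λ i → label {es i} (js i)))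
    gain-path zero vs es js = refl
    gain-path (suc l) vs es js =
      cong (label (js zero) ·_) (gain-path l (λ i → vs (suc i)) (λ i → es (suc i)) (λ i → js (suc i)))

    list-path : ∀ {u w} (p : P u w) →
                List.foldr _·_ ε (List.tabulate (λ i → label {ToFun.es p i} (ToFun.js p i))) ≡ gain p
    list-path (nil u) = refl
    list-path (cons {u} e j p) = cong₂ _·_ (lab (ToFun.vs-start p)) (list-path p)
      where
      lab : ∀ {x y} (eq : x ≡ y) {j : J e u y} → label (subst (J e u) (sym eq) j) ≡ label j
      lab refl = refl

  fromCycle : (Y : Cycle G) → Σ (Cyc (Cycle.vs Y zero)) λ Z →
              (∀ {f} → f ∈C Z → ∃[ i ] (Cycle.es Y i ≡ f)) × (∀ i → Cycle.es Y i ∈C Z) ×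
              (∀ {A : Set} (_·_ : A → A → A) ε inv φ → let open Gain _·_ ε inv φ in
                List.foldr _·_ ε (List.tabulate (λ i → label {Cycle.es Y i} (Cycle.joins Y i)))
                ≡ label (Cyc.j Z) · gain (Cyc.p Z))
  -- The path ends at the last value of `vs`, the base vertex is the first. The base vertex of the
  -- first edge is abstracted to w, and matching on `closed` then makes the two agree.
  fromCycle Y = go (Cycle.closed Y) (Cycle.joins Y zero)
    where
    open Cycle Y
    vs⁺ : Fin (suc len) → V
    vs⁺ i = vs (suc i)
    es⁺ : Fin len → E
    es⁺ i = es (suc i)
    js⁺ : ∀ i → J (es⁺ i) (vs⁺ (inject₁ i)) (vs⁺ (suc i))
    js⁺ i = joins (suc i)
    inj⁺ : Injective _≡_ _≡_ vs⁺
    inj⁺ {i} {k} eq with view i | view k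
    ... | ‵fromℕ | ‵fromℕ = refl
    ... | ‵fromℕ | ‵inject₁ b = ⊥-elim (Finₚ.0≢1+n (vs-inj zero (suc b) (trans (sym closed) eq)))
    ... | ‵inject₁ a | ‵fromℕ = ⊥-elim (Finₚ.0≢1+n (vs-inj zero (suc a) (trans (sym closed) (sym eq))))
    ... | ‵inject₁ a | ‵inject₁ b = cong inject₁ (Finₚ.suc-injective (vs-inj (suc a) (suc b) eq))
    d∉ : ¬ (es zero ∈E FromFun.path len vs⁺ es⁺ js⁺)
    d∉ i with FromFun.∈E⁻ len vs⁺ es⁺ js⁺ i
    ... | k , eq = Finₚ.0≢1+n (sym (es-inj eq))
    out : ∀ {f} → f ≡ es zero ⊎ f ∈E FromFun.path len vs⁺ es⁺ js⁺ → ∃[ i ] (es i ≡ f)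
    out (inj₁ refl) = zero , refl
    out (inj₂ i) with FromFun.∈E⁻ len vs⁺ es⁺ js⁺ i
    ... | k , eq = suc k , eq
    into : ∀ i → es i ≡ es zero ⊎ es i ∈E FromFun.path len vs⁺ es⁺ js⁺
    into zero = inj₁ refl
    into (suc i) = inj₂ (FromFun.∈E⁺ len vs⁺ es⁺ js⁺ i)
    go : ∀ {w} → vs (fromℕ (suc len)) ≡ w → (j : J (es zero) w (vs (suc zero))) → Σ (Cyc w) λ Z →
         (∀ {f} → f ∈C Z → ∃[ i ] (es i ≡ f)) × (∀ i → es i ∈C Z) ×
         (∀ {A : Set} (_·_ : A → A → A) ε inv φ → let open Gain _·_ ε inv φ in
           label j · List.foldr _·_ ε (List.tabulate (λ i → label {es (suc i)} (joins (suc i))))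
           ≡ label (Cyc.j Z) · gain (Cyc.p Z))
    go refl j = cyc (es zero) j (FromFun.path len vs⁺ es⁺ js⁺) (FromFun.simple len vs⁺ es⁺ js⁺ inj⁺) d∉ ,
      out , into ,
      λ _·_ ε inv φ → cong (Gain.label _·_ ε inv φ j ·_) (sym (Gain.gain-path _·_ ε inv φ len vs⁺ es⁺ js⁺))

-- The group of a triangle system

-- `L i j` is the bundle of edges between i and j, and `T` marks the triangles that are circuits
-- without x. `fill` and `uniq` make `T` a partial product, `tet` is its associativity, and `line`
-- fixes the order t of the group.
record TriangleSystem (n m t : ℕ) : Set₁ where
  field
    L : Fin (4 + n) → Fin (4 + n) → Fin m → Set
    T : Fin m → Fin m → Fin m → Set
    L-sym : ∀ {i j a} → L i j a → L j i a
    T-swap : ∀ {a b c} → T a b c → T b a c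
    T-rot : ∀ {a b c} → T a b c → T b c a
    some : ∀ {i j} → i ≢ j → ∃[ a ] L i j a
    fill : ∀ {i j k a b} → i ≢ j → j ≢ k → i ≢ k → L i j a → L j k b → ∃[ c ] (L i k c × T a b c)
    uniq : ∀ {i j k a b c c′} → i ≢ j → j ≢ k → i ≢ k → L i j a → L j k b → L i k c → L i k c′ →
           T a b c → T a b c′ → c ≡ c′
    tet : ∀ {i j k l a b c d e f} → i ≢ j → j ≢ k → i ≢ k → k ≢ l → j ≢ l → i ≢ l →
          L i j a → L j k b → L i k c → L k l d → L j l e → L i l f →
          T a b c → T c d f → T b d e → T a e f
    line : Enum (L zero (suc zero)) t

module Labelling {n m t} (S : TriangleSystem n m t) where
  open TriangleSystem S

  private
    W : Set
    W = Fin (3 + n)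
    E : Set
    E = Fin m

    -- Vertex zero is the root and W consists of the other vertices. An edge in `M i j` acts on the
    -- points in `X i` with values in `X j`: `step` applies it, and `unstep` finds the edge that
    -- takes one given point to another.
    X : W → E → Set
    X j = L zero (suc j)

    M : W → W → E → Set
    M i j = L (suc i) (suc j)

    s≢ : {i j : W} → i ≢ j → suc i ≢ suc j
    s≢ ne eq = ne (Finₚ.suc-injective eq)

    p≢ : {i j : W} → _≢_ {A = Fin (4 + n)} (suc i) (suc j) → i ≢ j
    p≢ ne eq = ne (cong suc eq)

    o≢ : {j : W} → _≢_ {A = Fin (4 + n)} zero (suc j)
    o≢ ()

    ≢o : {j : W} → _≢_ {A = Fin (4 + n)} (suc j) zero
    ≢o ()

    T-swap₂ : ∀ {a b c} → T a b c → T a c b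
    T-swap₂ t = T-swap (T-rot (T-rot t))

    -- The star of these edges is the spanning tree on which the gains are normalised to one; see
    -- `base-one`.
    base : W → E
    base j = proj₁ (some (o≢ {j}))

    base-X : ∀ j → X j (base j)
    base-X j = proj₂ (some (o≢ {j}))

    abstract
      step : ∀ {i j x a} → i ≢ j → X i x → M i j a → ∃[ z ] (X j z × T x a z)
      step ne x a = fill o≢ (s≢ ne) o≢ x a

      unstep : ∀ {i j x z} → i ≢ j → X i x → X j z → ∃[ a ] (M i j a × T x a z)
      unstep ne x z with fill ≢o o≢ (s≢ ne) (L-sym x) z
      ... | a , La , t = a , La , T-swap₂ t

    step-uniq : ∀ {i j x a z z′} → i ≢ j → X i x → M i j a → X j z → X j z′ →
                T x a z → T x a z′ → z ≡ z′
    step-uniq ne = uniq o≢ (s≢ ne) o≢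

    unstep-uniq : ∀ {i j x z a a′} → i ≢ j → X i x → X j z → M i j a → M i j a′ →
                  T x a z → T x a′ z → a ≡ a′
    unstep-uniq ne x z a a′ t t′ = uniq ≢o o≢ (s≢ ne) (L-sym x) z a a′ (T-swap₂ t) (T-swap₂ t′)

    -- In the tetrahedron whose apex is the root, acting by a and then by b is acting by the third
    -- side c of the face opposite to the root.
    comp : ∀ {i j k x a y b z c} → i ≢ j → j ≢ k → i ≢ k → X i x → M i j a → X j y → M j k b → X k z → M i k c →
           T x a y → T y b z → T a b c → T x c z
    comp ij jk ik x a y b z c t₁ t₂ t₃ = tet o≢ (s≢ ij) o≢ (s≢ jk) (s≢ ik) o≢ x a y b c z t₁ t₂ t₃

    mid : ∀ {i j k a b} → i ≢ j → j ≢ k → i ≢ k → M i j a → M j k b → ∃[ c ] (M i k c × T a b c)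
    mid ij jk ik a b = fill (s≢ ij) (s≢ jk) (s≢ ik) a b

    -- x ∈ X j and y ∈ X k carry the same label: y arises from x by the edge of gain 1 between j and k.
    data Sim (j k : W) (x y : E) : Set where
      same : j ≡ k → x ≡ y → Sim j k x y
      via  : ∀ {c} → j ≢ k → M j k c → T (base j) c (base k) → T x c y → Sim j k x y

    sim-sym : ∀ {j k x y} → Sim j k x y → Sim k j y x
    sim-sym (same p q) = same (sym p) (sym q)
    sim-sym (via ne c b t) = via (λ eq → ne (sym eq)) (L-sym c) (T-rot (T-swap₂ b)) (T-rot (T-swap₂ t))
    abstract
      sim-move : ∀ j k {x} → X j x → ∃[ y ] (X k y × Sim j k x y)
      sim-move j k {x} p with j Finₚ.≟ k
      ... | yes refl = x , p , same refl refl
      ... | no ne with unstep ne (base-X j) (base-X k)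
      ...   | c , Lc , b with step ne p Lc
      ...     | y , q , t = y , q , via ne Lc b t

    -- For j = l both edges take the same base edge back to where it came from, so they coincide and
    -- undo each other. Otherwise their composite has gain one by `comp` on the base edges, and
    -- relates x to z by `comp` on the points.
    sim-trans : ∀ {j k l x y z} → X j x → X k y → X l z → Sim j k x y → Sim k l y z → Sim j l x z
    sim-trans p q r (same refl refl) s = s
    sim-trans p q r s@(via _ _ _ _) (same refl refl) = s
    sim-trans {j} {k} {l} p q r (via jk c b t) (via kl c′ b′ t′) with j Finₚ.≟ l
    ... | yes refl = same refl (sym (step-uniq (λ eq → jk (sym eq)) q c′ r p t′
            (subst (λ c → T _ c _)
              (unstep-uniq (λ eq → jk (sym eq)) (base-X k) (base-X j) (L-sym c) c′ (T-rot (T-swap₂ b)) b′)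
              (T-rot (T-swap₂ t)))))
    ... | no jl with mid jk kl jl c c′
    ...   | d , Ld , td = via jl Ld (comp jk kl jl (base-X j) c (base-X k) c′ (base-X l) Ld b b′ td)
                                    (comp jk kl jl p c q c′ r Ld t t′ td)

    sim-uniq : ∀ {j x y} → Sim j j x y → x ≡ y
    sim-uniq (same _ eq) = eq
    sim-uniq (via ne _ _ _) = ⊥-elim (ne refl)

    open Enum line

    -- Every point is carried to `X w₀` by an edge of gain one, and its position in the enumeration
    -- there is its label. This places the group on `Fin t`.
    lab : ∀ j {x} → X j x → Fin t
    lab j p = idx (proj₁ (proj₂ (sim-move j zero p)))

    idx-cong : ∀ {x y} (p : X zero x) (q : X zero y) → x ≡ y → idx p ≡ idx q
    idx-cong p q eq = elt-inj (trans (elt-idx p) (trans eq (sym (elt-idx q))))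

    sim⇒lab : ∀ {j k x y} (p : X j x) (q : X k y) → Sim j k x y → lab j p ≡ lab k q
    sim⇒lab {j} {k} p q s with sim-move j zero p | sim-move k zero q
    ... | x′ , p′ , s₁ | y′ , q′ , s₂ =
      idx-cong p′ q′ (sim-uniq (sim-trans p′ p q′ (sim-sym s₁) (sim-trans p q q′ s s₂)))

    lab⇒sim : ∀ {j k x y} (p : X j x) (q : X k y) → lab j p ≡ lab k q → Sim j k x y
    lab⇒sim {j} {k} p q eq with sim-move j zero p | sim-move k zero q
    ... | x′ , p′ , s₁ | y′ , q′ , s₂ with trans (sym (elt-idx p′)) (trans (cong elt eq) (elt-idx q′))
    ...   | refl = sim-trans p p′ q s₁ (sim-sym s₂)

    lab-irr : ∀ {j x y} (p : X j x) (q : X j y) → x ≡ y → lab j p ≡ lab j q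
    lab-irr p q eq = sim⇒lab p q (same refl eq)

    lab-inj : ∀ {j x y} (p : X j x) (q : X j y) → lab j p ≡ lab j q → x ≡ y
    lab-inj p q eq = sim-uniq (lab⇒sim p q eq)

    abstract
      unlab : ∀ j g → Σ E λ x → Σ (X j x) λ p → lab j p ≡ g
      unlab j g with sim-move zero j (elt-∈ g)
      ... | x , p , s = x , p , trans (sym (sim⇒lab (elt-∈ g) p s)) (trans (sim⇒lab (elt-∈ g) (elt-∈ g) (same refl refl)) own)
        where
        own : lab zero (elt-∈ g) ≡ g
        own = elt-inj (elt-idx (elt-∈ g))

    w₀ w₁ w₂ : W
    w₀ = zero
    w₁ = suc zero
    w₂ = suc (suc zero)

    10≢ : w₁ ≢ w₀
    10≢ ()

    abstract
      -- The edge a from w₁ to w₀ that takes the base edge to label h has gain h, and its effect on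
      -- label g is g h. Uniqueness of actions makes the result independent of the elements chosen.
      product : ∀ g h → ∃[ k ] (∀ {x a y z} (p : X w₁ x) (La : M w₁ w₀ a) (q : X w₀ y) (r : X w₀ z) →
                lab w₁ p ≡ g → lab w₀ q ≡ h → T (base w₁) a y → T x a z → lab w₀ r ≡ k)
      product g h with unlab w₁ g | unlab w₀ h
      ... | x , p , eg | y , q , eh with unstep 10≢ (base-X w₁) q
      ...   | a , La , ta with step 10≢ p La
      ...     | z , r , tz = lab w₀ r , unique
        where
        unique : ∀ {x a y z} (p : X w₁ x) (La : M w₁ w₀ a) (q : X w₀ y) (r′ : X w₀ z) →
                 lab w₁ p ≡ g → lab w₀ q ≡ h → T (base w₁) a y → T x a z → lab w₀ r′ ≡ lab w₀ r
        unique p′ La′ q′ r′ eg′ eh′ ta′ tz′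
          with lab-inj p′ p (trans eg′ (sym eg)) | lab-inj q′ q (trans eh′ (sym eh))
        ... | refl | refl with unstep-uniq 10≢ (base-X w₁) q La′ La ta′ ta
        ...   | refl = lab-irr r′ r (step-uniq 10≢ p La r′ r tz′ tz)

    infixl 7 _*_
    _*_ : Fin t → Fin t → Fin t
    g * h = proj₁ (product g h)

    -- An edge acts on labels by right multiplication with its gain, which is the label of the image
    -- of the base edge. For w₁ and w₀ this is the definition of the product; the other pairs have
    -- to be reached from there.
    Mult : W → W → Set
    Mult i j = ∀ {x a y z} (p : X i x) (La : M i j a) (q : X j y) (r : X j z) →
               T (base i) a y → T x a z → lab j r ≡ lab i p * lab j q

    mult-10 : Mult w₁ w₀
    mult-10 p La q r tb tx = proj₂ (product _ _) p La q r refl refl tb tx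

    -- Following the edge a by the edge c of gain one from k to j preserves labels and sends
    -- `base k` to `base j`, so the rule for i and j transfers to i and k. `mult-left` precomposes
    -- in the same way.
    mult-right : ∀ {i j k} → i ≢ j → i ≢ k → k ≢ j → Mult i j → Mult i k
    mult-right {i} {j} {k} ij ik kj h p La q r tb tx
      with unstep kj (base-X k) (base-X j)
    ... | c , Lc , tc with mid ik kj ij La Lc | step kj q Lc | step kj r Lc
    ...   | a′ , La′ , ta | y′ , q′ , ty | z′ , r′ , tz =
      trans (sim⇒lab r r′ (via kj Lc tc tz))
        (trans (h p La′ q′ r′ (comp ik kj ij (base-X i) La q Lc q′ La′ tb ty ta)
                              (comp ik kj ij p La r Lc r′ La′ tx tz ta))
               (cong (lab i p *_) (sym (sim⇒lab q q′ (via kj Lc tc ty)))))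

    mult-left : ∀ {i j k} → i ≢ j → i ≢ k → k ≢ j → Mult i j → Mult k j
    mult-left {i} {j} {k} ij ik kj h p La q r tb tx
      with unstep ik (base-X i) (base-X k)
    ... | c , Lc , tc with mid ik kj ij Lc La | step (λ eq → ik (sym eq)) p (L-sym Lc)
    ...   | a′ , La′ , ta | x′ , p′ , tx′ =
      trans (h p′ La′ q r (comp ik kj ij (base-X i) Lc (base-X k) La q La′ tc tb ta)
                          (comp ik kj ij p′ Lc p La r La′ tx″ tx ta))
            (cong (_* lab j q) (sim⇒lab p′ p (via ik Lc tc tx″)))
      where
      tx″ = T-rot (T-swap₂ tx′)

    mult : ∀ {i j} → i ≢ j → Mult i j
    mult {i} {j} ne with i Finₚ.≟ w₁ | j Finₚ.≟ w₀
    ... | yes refl | yes refl = mult-10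
    ... | yes refl | no j≢0 = mult-right 10≢ ne j≢0 mult-10
    ... | no i≢1 | yes refl = mult-left 10≢ (λ eq → i≢1 (sym eq)) ne mult-10
    ... | no i≢1 | no j≢0 with i Finₚ.≟ w₀
    ...   | no i≢0 = mult-right i≢0 ne j≢0 (mult-left 10≢ (λ eq → i≢1 (sym eq)) i≢0 mult-10)
    ...   | yes refl with j Finₚ.≟ w₁
    ...     | no j≢1 = mult-left (λ eq → j≢1 (sym eq)) 10≢ ne (mult-right 10≢ (λ eq → j≢1 (sym eq)) j≢0 mult-10)
    -- Reversing the pair takes a third vertex: the rule moves from (w₁ , w₀) to (w₁ , w₂), then to
    -- (w₀ , w₂) and finally to (w₀ , w₁).
    ...     | yes refl = mult-right {j = w₂} (λ ()) ne (λ ())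
                           (mult-left {i = w₁} (λ ()) (λ ()) (λ ()) (mult-right 10≢ (λ ()) (λ ()) mult-10))

    01≢ : w₀ ≢ w₁
    01≢ ()

    -- Start from a point of label g and act by an edge of gain h from w₀ to w₁, then by one of gain
    -- k from w₁ to w₂. The composite edge has gain h k, as the base edge shows, and by `comp` it
    -- has the same effect.
    *-assoc : ∀ g h k → (g * h) * k ≡ g * (h * k)
    *-assoc g h k with unlab w₀ g | unlab w₁ h | unlab w₂ k
    ... | x , p , refl | y , q , refl | w , r , refl
      with unstep 01≢ (base-X w₀) q | unstep {w₁} {w₂} (λ ()) (base-X w₁) r
    ... | a , La , ta | b , Lb , tb with step 01≢ p La
    ...   | z , s , tz with step {w₁} {w₂} (λ ()) s Lb | mid {w₀} {w₁} {w₂} (λ ()) (λ ()) (λ ()) La Lb | step {w₁} {w₂} (λ ()) q Lb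
    ...     | v , u , tv | c , Lc , tc | y′ , q′ , ty =
      trans (cong (_* lab w₂ r) (sym (mult 01≢ p La q s ta tz)))
      (trans (sym (mult {w₁} {w₂} (λ ()) s Lb r u tb tv))
      (trans (mult {w₀} {w₂} (λ ()) p Lc q′ u
               (comp {w₀} {w₁} {w₂} (λ ()) (λ ()) (λ ()) (base-X w₀) La q Lb q′ Lc ta ty tc)
               (comp {w₀} {w₁} {w₂} (λ ()) (λ ()) (λ ()) p La s Lb u Lc tz tv tc))
             (cong (lab w₀ p *_) (mult {w₁} {w₂} (λ ()) q Lb r q′ tb ty))))

    one : Fin t
    one = lab w₀ (base-X w₀)

    base-one : ∀ j → lab j (base-X j) ≡ one
    base-one j with j Finₚ.≟ w₀
    ... | yes refl = refl
    ... | no ne with unstep ne (base-X j) (base-X w₀)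
    ...   | c , Lc , t = sim⇒lab (base-X j) (base-X w₀) (via ne Lc t t)

    *-idˡ : ∀ g → one * g ≡ g
    *-idˡ g with unlab w₁ g
    ... | y , q , refl with unstep 01≢ (base-X w₀) q
    ...   | a , La , t = sym (mult 01≢ (base-X w₀) La q q t t)

    *-idʳ : ∀ g → g * one ≡ g
    *-idʳ g with unlab w₀ g
    ... | x , p , refl with unstep 01≢ (base-X w₀) (base-X w₁)
    ...   | a , La , t with step 01≢ p La
    ...     | z , r , tz = trans (cong (lab w₀ p *_) (sym (base-one w₁)))
                 (trans (sym (mult 01≢ p La (base-X w₁) r t tz)) (sym (sim⇒lab p r (via 01≢ La t tz))))

    -- The edge that takes the point of label g to the base edge has the inverse of g as its gain.
    right-inverse : ∀ g → ∃[ h ] (g * h ≡ one)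
    right-inverse g with unlab w₀ g
    ... | x , p , refl with unstep 01≢ p (base-X w₁)
    ...   | a , La , t with step 01≢ (base-X w₀) La
    ...     | y , q , ty = lab w₁ q , trans (sym (mult 01≢ p La q (base-X w₁) ty t)) (base-one w₁)

    inv : Fin t → Fin t
    inv g = proj₁ (right-inverse g)

    *-invʳ : ∀ g → g * inv g ≡ one
    *-invʳ g = proj₂ (right-inverse g)

    *-invˡ : ∀ g → inv g * g ≡ one
    *-invˡ g = begin
      inv g * g                              ≡⟨ sym (*-idʳ _) ⟩
      inv g * g * one                        ≡⟨ cong (inv g * g *_) (sym (*-invʳ (inv g))) ⟩
      inv g * g * (inv g * inv (inv g))      ≡⟨ sym (*-assoc _ _ _) ⟩
      inv g * g * inv g * inv (inv g)        ≡⟨ cong (_* inv (inv g)) (*-assoc _ _ _) ⟩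
      inv g * (g * inv g) * inv (inv g)      ≡⟨ cong (λ z → inv g * z * inv (inv g)) (*-invʳ g) ⟩
      inv g * one * inv (inv g)              ≡⟨ cong (_* inv (inv g)) (*-idʳ _) ⟩
      inv g * inv (inv g)                    ≡⟨ *-invʳ (inv g) ⟩
      one                                    ∎
      where open ≡-Reasoning

    *-isGroup : IsGroup _≡_ _*_ one inv
    *-isGroup = record
      { isMonoid = record
        { isSemigroup = record
          { isMagma = record { isEquivalence = isEquivalence ; ∙-cong = cong₂ _*_ }
          ; assoc = *-assoc }
        ; identity = *-idˡ , *-idʳ }
      ; inverse = *-invˡ , *-invʳ
      ; ⁻¹-cong = cong inv }

    group : Group _ _
    group = record { isGroup = *-isGroup }

    open GroupProps group using (inverseʳ-unique; ⁻¹-anti-homo-∙; ⁻¹-involutive; ⁻¹-injective)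

  Γ : FinGroup
  Γ = record { order = t ; _∙_ = _*_ ; ε = one ; _⁻¹ = inv ; isGroup = *-isGroup }

  -- The gain of an edge walked from i to j. Away from the root it is the factor by which the edge
  -- multiplies labels, read off at the base edge because that has label `one`.
  γ : ∀ i j → i ≢ j → ∀ {a} → L i j a → Fin t
  γ zero zero ne p = ⊥-elim (ne refl)
  γ zero (suc j) ne p = lab j p
  γ (suc i) zero ne p = inv (lab i (L-sym p))
  γ (suc i) (suc j) ne p = lab j (proj₁ (proj₂ (step (p≢ ne) (base-X i) p)))

  private
    γ-step : ∀ {i j} ne {a y} (p : M i j a) (q : X j y) → T (base i) a y → γ (suc i) (suc j) ne p ≡ lab j q
    γ-step {i} {j} ne p q t with step (p≢ ne) (base-X i) p
    ... | y′ , q′ , t′ = lab-irr q′ q (step-uniq (p≢ ne) (base-X i) p q′ q t′ t)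

    γ-mult : ∀ {i j} ne {x a z} (p : X i x) (La : M i j a) (r : X j z) → T x a z →
             lab j r ≡ lab i p * γ (suc i) (suc j) ne La
    γ-mult {i} {j} ne p La r t with step (p≢ ne) (base-X i) La
    ... | y , q , tb = mult (p≢ ne) p La q r tb t

  γ-irr : ∀ i j (ne ne′ : i ≢ j) {a a′} (p : L i j a) (p′ : L i j a′) → a ≡ a′ → γ i j ne p ≡ γ i j ne′ p′
  γ-irr zero zero ne ne′ p p′ eq = ⊥-elim (ne refl)
  γ-irr zero (suc j) ne ne′ p p′ eq = lab-irr p p′ eq
  γ-irr (suc i) zero ne ne′ p p′ eq = cong inv (lab-irr (L-sym p) (L-sym p′) eq)
  γ-irr (suc i) (suc j) ne ne′ p p′ refl with step (p≢ ne′) (base-X i) p′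
  ... | y , q , t = γ-step ne p q t

  γ-inv : ∀ i j (ne : i ≢ j) (ne′ : j ≢ i) {a} (p : L i j a) (p′ : L j i a) →
          γ j i ne′ p′ ≡ inv (γ i j ne p)
  γ-inv zero zero ne ne′ p p′ = ⊥-elim (ne refl)
  γ-inv zero (suc j) ne ne′ p p′ = cong inv (lab-irr (L-sym p′) p refl)
  γ-inv (suc i) zero ne ne′ p p′ = trans (lab-irr p′ (L-sym p) refl) (sym (⁻¹-involutive _))
  γ-inv (suc i) (suc j) ne ne′ p p′ with step (p≢ ne) (base-X i) p
  ... | y , q , t = inverseʳ-unique _ _
    (trans (sym (γ-mult ne′ q p′ (base-X i) (T-rot (T-swap₂ t)))) (base-one i))

  -- If the root is a corner, this is `γ-mult` solved for the wanted side by means of inverses. If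
  -- not, the base edge at i is carried to k along both routes, which agree by `comp`.
  γ-∙ : ∀ {i j k} (ij : i ≢ j) (jk : j ≢ k) (ik : i ≢ k) {a b c} (p : L i j a) (q : L j k b) (r : L i k c) →
        T a b c → γ i k ik r ≡ γ i j ij p * γ j k jk q
  γ-∙ {zero} {zero} ij jk ik p q r t = ⊥-elim (ij refl)
  γ-∙ {zero} {suc j} {zero} ij jk ik p q r t = ⊥-elim (ik refl)
  γ-∙ {suc i} {zero} {zero} ij jk ik p q r t = ⊥-elim (jk refl)
  γ-∙ {zero} {suc j} {suc k} ij jk ik p q r t = γ-mult jk p q r t
  γ-∙ {suc i} {zero} {suc k} ij jk ik p q r t = begin
    γ _ _ ik r                                              ≡⟨ sym (*-idˡ _) ⟩
    one * γ _ _ ik r                                        ≡⟨ cong (_* γ _ _ ik r) (sym (*-invˡ _)) ⟩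
    inv (lab i (L-sym p)) * lab i (L-sym p) * γ _ _ ik r    ≡⟨ *-assoc _ _ _ ⟩
    inv (lab i (L-sym p)) * (lab i (L-sym p) * γ _ _ ik r)  ≡⟨ cong (inv _ *_) (sym (γ-mult ik (L-sym p) r q (T-swap₂ t))) ⟩
    inv (lab i (L-sym p)) * lab k q                         ∎
    where open ≡-Reasoning
  γ-∙ {suc i} {suc j} {zero} ij jk ik p q r t = begin
    inv (lab i (L-sym r))                          ≡⟨ sym (*-idˡ _) ⟩
    one * inv (lab i (L-sym r))                    ≡⟨ cong (_* inv (lab i (L-sym r))) (sym (*-invʳ (γ _ _ ij p))) ⟩
    γ _ _ ij p * inv (γ _ _ ij p) * inv (lab i (L-sym r))
      ≡⟨ *-assoc _ _ _ ⟩
    γ _ _ ij p * (inv (γ _ _ ij p) * inv (lab i (L-sym r)))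
      ≡⟨ cong (γ _ _ ij p *_) (sym (⁻¹-anti-homo-∙ _ _)) ⟩
    γ _ _ ij p * inv (lab i (L-sym r) * γ _ _ ij p)
      ≡⟨ cong (λ z → γ _ _ ij p * inv z) (sym (γ-mult ij (L-sym r) p (L-sym q) (T-rot (T-rot t)))) ⟩
    γ _ _ ij p * inv (lab j (L-sym q))             ∎
    where open ≡-Reasoning
  γ-∙ {suc i} {suc j} {suc k} ij jk ik p q r t with step (p≢ ij) (base-X i) p
  ... | y , u , ty with step (p≢ jk) u q
  ...   | z , v , tz = trans
    (γ-step ik r v (comp (p≢ ij) (p≢ jk) (p≢ ik)
                         (base-X i) p u q v r ty tz t))
    (γ-mult jk u q v tz)

  γ-inj : ∀ i j (ne : i ≢ j) {a a′} (p : L i j a) (p′ : L i j a′) → γ i j ne p ≡ γ i j ne p′ → a ≡ a′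
  γ-inj zero zero ne p p′ eq = ⊥-elim (ne refl)
  γ-inj zero (suc j) ne p p′ eq = lab-inj p p′ eq
  γ-inj (suc i) zero ne p p′ eq = lab-inj (L-sym p) (L-sym p′) (⁻¹-injective eq)
  γ-inj (suc i) (suc j) ne p p′ eq
    with step (p≢ ne) (base-X i) p | step (p≢ ne) (base-X i) p′
  ... | y , q , t | y′ , q′ , t′ with lab-inj q q′ eq
  ...   | refl = unstep-uniq (p≢ ne) (base-X i) q p p′ t t′

  γ-surj : ∀ i j (ne : i ≢ j) g → Σ E λ a → Σ (L i j a) λ p → γ i j ne p ≡ g
  γ-surj zero zero ne g = ⊥-elim (ne refl)
  γ-surj zero (suc j) ne g = unlab j g
  γ-surj (suc i) zero ne g with unlab i (inv g)
  ... | a , p , eq = a , L-sym p , trans (cong inv (trans (lab-irr (L-sym (L-sym p)) p refl) eq)) (⁻¹-involutive g)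
  γ-surj (suc i) (suc j) ne g with unlab j g
  ... | y , q , eq with unstep (p≢ ne) (base-X i) q
  ...   | a , p , t = a , p , trans (γ-step ne p q t) eq

  -- `fill` provides some third side, `γ-∙` computes its gain, and an edge between given ends is
  -- determined by its gain.
  γ-triangle : ∀ {i j k} (ij : i ≢ j) (jk : j ≢ k) (ik : i ≢ k) {a b c} (p : L i j a) (q : L j k b) (r : L i k c) →
               γ i k ik r ≡ γ i j ij p * γ j k jk q → T a b c
  γ-triangle ij jk ik p q r eq with fill ij jk ik p q
  ... | c′ , r′ , t with γ-inj _ _ ik r r′ (trans eq (sym (γ-∙ ij jk ik p q r′ t)))
  ...   | refl = t

-- Lift matroids over a graph

-- Circuits on x together with m edges; the Boolean head of a set tells whether it contains x.
module Pointed {m} (K : Subset (suc m) → Set) (circuits : Circuits K) where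

  -- The edge set is described by a predicate, so that circuits can be respecified without
  -- rearranging unions of subsets.
  IsC : Bool → (Fin m → Set) → Set
  IsC s B = ∃[ C ] (K (s ∷ C) × (∀ g → g ∈ C → B g) × (∀ g → B g → g ∈ C))

  private
    drop : ∀ {s s′ C D} {g : Fin m} → suc g ∈ s ∷ C ⊎ suc g ∈ s′ ∷ D → g ∈ C ⊎ g ∈ D
    drop = Sum.map drop-there drop-there

  elim-edge : ∀ {s s′ C D e f} → K (s ∷ C) → K (s′ ∷ D) → e ∈ C → e ∈ D → f ∈ C → f ∉ D →
              ∃[ s″ ] ∃[ C′ ] (K (s″ ∷ C′) × f ∈ C′ × (∀ g → g ∈ C′ → g ≢ e × (g ∈ C ⊎ g ∈ D)))
  elim-edge KC KD eC eD fC f∉D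
    with Circuits.strong-elim circuits KC KD (there eC) (there eD) (there fC) (λ { (there i) → f∉D i })
  ... | (s″ ∷ C′) , k , there fC′ , bound = s″ , C′ , k , fC′ ,
    λ g gC → (λ { refl → proj₁ (bound (there gC)) refl }) , drop (proj₂ (bound (there gC)))

  elim-free : ∀ {C D e f} → K (false ∷ C) → K (false ∷ D) → e ∈ C → e ∈ D → f ∈ C → f ∉ D →
              ∃[ C′ ] (K (false ∷ C′) × f ∈ C′ × (∀ g → g ∈ C′ → g ≢ e × (g ∈ C ⊎ g ∈ D)))
  elim-free KC KD eC eD fC f∉D
    with Circuits.strong-elim circuits KC KD (there eC) (there eD) (there fC) (λ { (there i) → f∉D i })
  ... | (false ∷ C′) , k , there fC′ , bound = C′ , k , fC′ ,
    λ g gC → (λ { refl → proj₁ (bound (there gC)) refl }) , drop (proj₂ (bound (there gC)))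
  ... | (true ∷ C′) , _ , _ , bound with proj₂ (bound here)
  ...   | inj₁ ()
  ...   | inj₂ ()

  elim-keep-x : ∀ {C D e} → K (true ∷ C) → K (false ∷ D) → e ∈ C → e ∈ D →
                ∃[ C′ ] (K (true ∷ C′) × (∀ g → g ∈ C′ → g ≢ e × (g ∈ C ⊎ g ∈ D)))
  elim-keep-x KC KD eC eD
    with Circuits.strong-elim circuits KC KD (there eC) (there eD) here (λ ())
  ... | (.true ∷ C′) , k , here , bound = C′ , k ,
    λ g gC → (λ { refl → proj₁ (bound (there gC)) refl }) , drop (proj₂ (bound (there gC)))

  elim-x : ∀ {C D f} → K (true ∷ C) → K (true ∷ D) → f ∈ C → f ∉ D →
           ∃[ C′ ] (K (false ∷ C′) × f ∈ C′ × (∀ g → g ∈ C′ → g ∈ C ⊎ g ∈ D))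
  elim-x KC KD fC f∉D
    with Circuits.strong-elim circuits KC KD here here (there fC) (λ { (there i) → f∉D i })
  ... | (false ∷ C′) , k , there fC′ , bound =
    C′ , k , fC′ , λ g gC → drop (proj₂ (bound (there gC)))
  ... | (true ∷ C′) , k , there fC′ , bound = ⊥-elim (proj₁ (bound here) refl)

  incomp : ∀ {s C D} → K (s ∷ C) → K (s ∷ D) → C ⊆ D → D ⊆ C
  incomp KC KD sub i = drop-there (Circuits.incomp circuits KC KD (s⊆s sub) (there i))

  incomp-x : ∀ {C D} → K (false ∷ C) → K (true ∷ D) → ¬ (C ⊆ D)
  incomp-x KC KD sub with Circuits.incomp circuits KC KD (out⊆ sub) here
  ... | ()

  IsC-map : ∀ {s} {B B′ : Fin m → Set} → (∀ g → B g → B′ g) → (∀ g → B′ g → B g) → IsC s B → IsC s B′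
  IsC-map f h (C , k , a , b) = C , k , (λ g i → f g (a g i)) , (λ g i → b g (h g i))

  IsC-set : ∀ {s C} {B : Fin m → Set} → IsC s B → (∀ g → B g → g ∈ C) → (∀ g → g ∈ C → B g) → K (s ∷ C)
  IsC-set {s} (D , k , a , b) f h =
    subst (λ C → K (s ∷ C)) (⊆-antisym (λ {g} i → f g (a g i)) (λ {g} i → b g (h g i))) k

  -- An edge e of a circuit through x is traded for the rest of an x-free circuit. Strong
  -- elimination can retain x as it belongs to only one of the two; if e is absent, nothing has to
  -- be done.
  eliminate : ∀ {C e} {B D : Fin m → Set} → K (true ∷ C) → IsC false D → D e → (∀ g → g ∈ C → g ≡ e ⊎ B g) →
              (∀ g → D g → g ≡ e ⊎ B g) → ∃[ C′ ] (K (true ∷ C′) × (∀ g → g ∈ C′ → B g))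
  eliminate {C} {e} {B} {D} k (C₀ , k₀ , a , b) De hC hD with e ∈? C
  ... | no e∉ = C , k , only
    where
    only : ∀ g → g ∈ C → B g
    only g i with hC g i
    ... | inj₁ refl = ⊥-elim (e∉ i)
    ... | inj₂ Bg = Bg
  ... | yes eC with elim-keep-x k k₀ eC (b e De)
  ...   | C′ , k′ , bound = C′ , k′ , only
    where
    other : ∀ {g} → g ≢ e → g ≡ e ⊎ B g → B g
    other ne (inj₁ eq) = ⊥-elim (ne eq)
    other ne (inj₂ Bg) = Bg
    only : ∀ g → g ∈ C′ → B g
    only g i with bound g i
    ... | ne , inj₁ c = other ne (hC g c)
    ... | ne , inj₂ d = other ne (hD g (a g d))

-- The element x has index zero and edge e has index `suc e`. Orienting every edge towards its
-- larger end gives all edges of a bundle the same orientation.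
record LiftData (n : ℕ) : Set₁ where
  field
    G        : Graph (4 + n)
    ordered  : ∀ e → tail G e < head G e
    K        : Subset (suc (nE G)) → Set
    circuits : Circuits K

  loopless : ∀ e → tail G e ≢ head G e
  loopless e = Finₚ.<⇒≢ (ordered e)

  open Walks G loopless public
  open Pointed K circuits public

  field
    cuts     : ∀ {s C} → K (s ∷ C) → Cuts C
    an-edge  : ∀ {s C} → K (s ∷ C) → Nonempty C
    parallel : ∀ {i j e f} → J e i j → J f i j → e ≢ f → IsC true (λ g → g ≡ e ⊎ g ≡ f)

  J-det : ∀ {e i j k} → J e i j → J e i k → j ≡ k
  J-det p q with J-ends q (J-at₂ p)
  ... | inj₁ eq = ⊥-elim (J-≢ p (sym eq))
  ... | inj₂ eq = eq

  J-miss : ∀ {g u v z} → J g u v → z ≢ u → z ≢ v → ¬ At g z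
  J-miss Jg zu zv at with J-ends Jg at
  ... | inj₁ eq = zu eq
  ... | inj₂ eq = zv eq

  leafless : ∀ {s C} → K (s ∷ C) → Leafless C
  leafless k = cuts⇒leafless (cuts k)

  leaf : ∀ {s C v e} → K (s ∷ C) → At e v → (∀ g → g ∈ C → At g v → g ≡ e) → e ∉ C
  leaf k at only eC with leafless k _ _ eC at
  ... | f , fC , ne , at′ = ne (only f fC at′)

module Exchange {n} (D : LiftData n) where

  open LiftData D

  Triple : E → E → E → E → Set
  Triple a b c g = g ≡ a ⊎ g ≡ b ⊎ g ≡ c

  -- Eliminating a′ from the triangle and {x , a , a′} can retain b. The result lies in the new
  -- triangle, perhaps with x, and a and c are forced since b must not be a leaf at j or at k.
  -- Whether x is present may change.
  exchange : ∀ {i j k s a a′ b c} → i ≢ j → j ≢ k → i ≢ k → J a i j → J a′ i j → J b j k → J c k i →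
             IsC s (Triple a′ b c) → ∃[ s′ ] IsC s′ (Triple a b c)
  exchange {i} {j} {k} {s} {a} {a′} {b} {c} ij jk ik Ja Ja′ Jb Jc t@(C , kC , to₁ , from₁) with a Finₚ.≟ a′
  ... | yes refl = s , t
  ... | no ne with parallel Ja Ja′ ne
  ...   | C₁ , k₁ , to₂ , from₂
    with elim-edge kC k₁ (from₁ a′ (inj₁ refl)) (from₂ a′ (inj₂ refl)) (from₁ b (inj₂ (inj₁ refl))) b∉
    where
    b∉ : b ∉ C₁
    b∉ h with to₂ b h
    ... | inj₁ refl = ik (J-det (J-sym Ja) Jb)
    ... | inj₂ refl = ik (J-det (J-sym Ja′) Jb)
  ...     | s′ , C′ , k′ , b∈ , bound = s′ , C′ , k′ , only , all
    where
    only : ∀ g → g ∈ C′ → Triple a b c g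
    only g h with bound g h
    ... | ne′ , inj₁ p with to₁ g p
    ...   | inj₁ e = ⊥-elim (ne′ e)
    ...   | inj₂ r = inj₂ r
    only g h | ne′ , inj₂ p with to₂ g p
    ...   | inj₁ e = inj₁ e
    ...   | inj₂ e = ⊥-elim (ne′ e)
    a∈ : a ∈ C′
    a∈ with leafless k′ j b b∈ (J-at₁ Jb)
    ... | f , f∈ , f≢b , at with only f f∈
    ...   | inj₁ refl = f∈
    ...   | inj₂ (inj₁ e) = ⊥-elim (f≢b e)
    ...   | inj₂ (inj₂ refl) = ⊥-elim (J-miss Jc jk (≢-sym ij) at)
    c∈ : c ∈ C′
    c∈ with leafless k′ k b b∈ (J-at₂ Jb)
    ... | f , f∈ , f≢b , at with only f f∈
    ...   | inj₁ refl = ⊥-elim (J-miss Ja (≢-sym ik) (≢-sym jk) at)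
    ...   | inj₂ (inj₁ e) = ⊥-elim (f≢b e)
    ...   | inj₂ (inj₂ refl) = f∈
    all : ∀ g → Triple a b c g → g ∈ C′
    all g (inj₁ refl) = a∈
    all g (inj₂ (inj₁ refl)) = b∈
    all g (inj₂ (inj₂ refl)) = c∈

  turn : ∀ {s a b c} → IsC s (Triple a b c) → IsC s (Triple b c a)
  turn = IsC-map (λ _ r → ⊎-third (⊎-third r)) (λ _ → ⊎-third)

record FilledLift (n t : ℕ) : Set₁ where
  field
    liftData : LiftData n

  open LiftData liftData public

  field
    triangle : ∀ {i j k a b c} → i ≢ j → j ≢ k → i ≢ k → J a i j → J b j k → J c i k →
               IsC false (λ g → g ≡ a ⊎ g ≡ b ⊎ g ≡ c) ⊎ IsC true (λ g → g ≡ a ⊎ g ≡ b ⊎ g ≡ c)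
    fill : ∀ {i j k a b} → i ≢ j → j ≢ k → i ≢ k → J a i j → J b j k →
           ∃[ c ] (J c i k × IsC false (λ g → g ≡ a ⊎ g ≡ b ⊎ g ≡ c))
    some : ∀ {i j} → i ≢ j → ∃[ a ] J a i j
    line : Enum (λ e → J e zero (suc zero)) t

module Triangles {n t} (D : FilledLift n t) where

  open FilledLift D
  open Exchange liftData

  T : E → E → E → Set
  T a b c = IsC false (Triple a b c)

  -- Eliminating a from two different triangles leaves an x-free circuit within {b , c , c′}. There
  -- b would be a leaf at j, so the circuit lies within {c , c′}, properly inside the circuit {x , c
  -- , c′}.
  T-uniq : ∀ {i j k a b c c′} → i ≢ j → j ≢ k → i ≢ k → J a i j → J b j k → J c i k → J c′ i k →
           T a b c → T a b c′ → c ≡ c′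
  T-uniq {i} {j} {k} {a} {b} {c} {c′} ij jk ik Ja Jb Jc Jc′ (C , kC , C⊆ , ⊆C) (C₁ , k₁ , C₁⊆ , ⊆C₁)
    with c Finₚ.≟ c′
  ... | yes eq = eq
  ... | no c≢c′ with elim-free kC k₁ (⊆C a (inj₁ refl)) (⊆C₁ a (inj₁ refl)) (⊆C c (inj₂ (inj₂ refl))) c∉
    where
    c∉ : c ∉ C₁
    c∉ i with C₁⊆ c i
    ... | inj₁ refl = jk (J-det Ja Jc)
    ... | inj₂ (inj₁ refl) = ij (J-det (J-sym Jc) (J-sym Jb))
    ... | inj₂ (inj₂ eq) = c≢c′ eq
  ...   | C₂ , k₂ , _ , bound with parallel Jc Jc′ c≢c′
  ...     | C₃ , k₃ , _ , ⊆C₃ = ⊥-elim (incomp-x k₂ k₃ (λ {g} gi → ⊆C₃ g (rest g gi)))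
    where
    three : ∀ g → g ∈ C₂ → g ≡ b ⊎ g ≡ c ⊎ g ≡ c′
    three g gi with bound g gi
    ... | ne , inj₁ x with C⊆ g x
    ...   | inj₁ eq = ⊥-elim (ne eq)
    ...   | inj₂ (inj₁ eq) = inj₁ eq
    ...   | inj₂ (inj₂ eq) = inj₂ (inj₁ eq)
    three g gi | ne , inj₂ x with C₁⊆ g x
    ...   | inj₁ eq = ⊥-elim (ne eq)
    ...   | inj₂ (inj₁ eq) = inj₁ eq
    ...   | inj₂ (inj₂ eq) = inj₂ (inj₂ eq)
    away : ∀ {f} → J f i k → ¬ At f j
    away Jf at with J-ends Jf at
    ... | inj₁ eq = ij (sym eq)
    ... | inj₂ eq = jk eq
    b∉ : b ∉ C₂
    b∉ = leaf k₂ (J-at₁ Jb) λ g gi at → only g (three g gi) at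
      where
      only : ∀ g → g ≡ b ⊎ g ≡ c ⊎ g ≡ c′ → At g j → g ≡ b
      only g (inj₁ eq) at = eq
      only g (inj₂ (inj₁ refl)) at = ⊥-elim (away Jc at)
      only g (inj₂ (inj₂ refl)) at = ⊥-elim (away Jc′ at)
    rest : ∀ g → g ∈ C₂ → g ≡ c ⊎ g ≡ c′
    rest g gi with three g gi
    ... | inj₁ refl = ⊥-elim (b∉ gi)
    ... | inj₂ r = r

  -- Otherwise {x , a , e , f} is a circuit. The three given faces replace f by c and d, then e by b
  -- and d, then c by a and b, always retaining x.
  T-tet : ∀ {i j k l a b c d e f} → i ≢ j → j ≢ k → i ≢ k → k ≢ l → j ≢ l → i ≢ l →
          J a i j → J b j k → J c i k → J d k l → J e j l → J f i l →
          T a b c → T c d f → T b d e → T a e f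
  T-tet {i} {j} {k} {l} {a} {b} {c} {d} {e} {f} ij jk ik kl jl il Ja Jb Jc Jd Je Jf t₁ t₂ t₃
    with triangle ij jl il Ja Je Jf
  ... | inj₁ t = t
  ... | inj₂ (C , kC , C⊆ , _)
    with eliminate {B = λ g → g ≡ a ⊎ g ≡ e ⊎ g ≡ c ⊎ g ≡ d} kC t₂ (inj₂ (inj₂ refl))
           (λ { g i → case₁ g (C⊆ g i) })
           (λ { g (inj₁ eq) → inj₂ (inj₂ (inj₂ (inj₁ eq)))
              ; g (inj₂ (inj₁ eq)) → inj₂ (inj₂ (inj₂ (inj₂ eq)))
              ; g (inj₂ (inj₂ eq)) → inj₁ eq })
    where
    case₁ : ∀ g → g ≡ a ⊎ g ≡ e ⊎ g ≡ f → g ≡ f ⊎ (g ≡ a ⊎ g ≡ e ⊎ g ≡ c ⊎ g ≡ d)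
    case₁ g (inj₁ eq) = inj₂ (inj₁ eq)
    case₁ g (inj₂ (inj₁ eq)) = inj₂ (inj₂ (inj₁ eq))
    case₁ g (inj₂ (inj₂ eq)) = inj₁ eq
  ...   | C₁ , k₁ , C₁⊆
    with eliminate {B = λ g → g ≡ a ⊎ g ≡ b ⊎ g ≡ c ⊎ g ≡ d} k₁ t₃ (inj₂ (inj₂ refl))
           (λ { g i → case₂ g (C₁⊆ g i) })
           (λ { g (inj₁ eq) → inj₂ (inj₂ (inj₁ eq))
              ; g (inj₂ (inj₁ eq)) → inj₂ (inj₂ (inj₂ (inj₂ eq)))
              ; g (inj₂ (inj₂ eq)) → inj₁ eq })
    where
    case₂ : ∀ g → g ≡ a ⊎ g ≡ e ⊎ g ≡ c ⊎ g ≡ d → g ≡ e ⊎ (g ≡ a ⊎ g ≡ b ⊎ g ≡ c ⊎ g ≡ d)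
    case₂ g (inj₁ eq) = inj₂ (inj₁ eq)
    case₂ g (inj₂ (inj₁ eq)) = inj₁ eq
    case₂ g (inj₂ (inj₂ r)) = inj₂ (inj₂ (inj₂ r))
  ...     | C₂ , k₂ , C₂⊆
    with eliminate {B = λ g → g ≡ a ⊎ g ≡ b ⊎ g ≡ d} k₂ t₁ (inj₂ (inj₂ refl))
           (λ { g i → case₃ g (C₂⊆ g i) })
           (λ { g (inj₁ eq) → inj₂ (inj₁ eq)
              ; g (inj₂ (inj₁ eq)) → inj₂ (inj₂ (inj₁ eq))
              ; g (inj₂ (inj₂ eq)) → inj₁ eq })
    where
    case₃ : ∀ g → g ≡ a ⊎ g ≡ b ⊎ g ≡ c ⊎ g ≡ d → g ≡ c ⊎ (g ≡ a ⊎ g ≡ b ⊎ g ≡ d)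
    case₃ g (inj₁ eq) = inj₂ (inj₁ eq)
    case₃ g (inj₂ (inj₁ eq)) = inj₂ (inj₂ (inj₁ eq))
    case₃ g (inj₂ (inj₂ (inj₁ eq))) = inj₁ eq
    case₃ g (inj₂ (inj₂ (inj₂ eq))) = inj₂ (inj₂ (inj₂ eq))
  -- The remaining edges form a path, so no circuit fits.
  ...       | C₃ , k₃ , C₃⊆ = ⊥-elim (empty (an-edge k₃))
    where
    d∉ : d ∉ C₃
    d∉ = leaf k₃ (J-at₂ Jd) λ g gi at → only g (C₃⊆ g gi) at
      where
      only : ∀ g → g ≡ a ⊎ g ≡ b ⊎ g ≡ d → At g l → g ≡ d
      only g (inj₁ refl) at = ⊥-elim (J-miss Ja (≢-sym il) (≢-sym jl) at)
      only g (inj₂ (inj₁ refl)) at = ⊥-elim (J-miss Jb (≢-sym jl) (≢-sym kl) at)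
      only g (inj₂ (inj₂ eq)) at = eq
    a∉ : a ∉ C₃
    a∉ = leaf k₃ (J-at₁ Ja) λ g gi at → only g (C₃⊆ g gi) at
      where
      only : ∀ g → g ≡ a ⊎ g ≡ b ⊎ g ≡ d → At g i → g ≡ a
      only g (inj₁ eq) at = eq
      only g (inj₂ (inj₁ refl)) at = ⊥-elim (J-miss Jb ij ik at)
      only g (inj₂ (inj₂ refl)) at = ⊥-elim (J-miss Jd ik il at)
    b∉ : b ∉ C₃
    b∉ = leaf k₃ (J-at₁ Jb) λ g gi at → only g gi (C₃⊆ g gi)
      where
      only : ∀ g → g ∈ C₃ → g ≡ a ⊎ g ≡ b ⊎ g ≡ d → g ≡ b
      only g gi (inj₁ refl) = ⊥-elim (a∉ gi)
      only g gi (inj₂ (inj₁ eq)) = eq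
      only g gi (inj₂ (inj₂ refl)) = ⊥-elim (d∉ gi)
    empty : ¬ Nonempty C₃
    empty (g , gi) with C₃⊆ g gi
    ... | inj₁ refl = a∉ gi
    ... | inj₂ (inj₁ refl) = b∉ gi
    ... | inj₂ (inj₂ refl) = d∉ gi

  triangleSystem : TriangleSystem n (nE G) t
  triangleSystem = record
    { L = λ i j e → J e i j
    ; T = T
    ; L-sym = J-sym
    ; T-swap = IsC-map (λ _ → ⊎-second) (λ _ → ⊎-second)
    ; T-rot = turn
    ; some = some
    ; fill = fill
    ; uniq = T-uniq
    ; tet = T-tet
    ; line = line }

-- Gains of cycles, handcuffs and thetas

module LiftGraphic {n t} (D : FilledLift n t) where

  open FilledLift D
  open Triangles D
  open Labelling triangleSystem public

  private
    _·_ = _∙_ Γ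
    inv = _⁻¹ Γ
    one = ε Γ

    group : Group _ _
    group = record { isGroup = isGroup Γ }

    open Group group using (identityʳ; inverseˡ)
    open GroupProps group using (inverseˡ-unique; inverseʳ-unique)

  φ : E → Fin t
  φ e = γ (tail G e) (head G e) (loopless e) (J-self e)

  open Gain _·_ one inv φ

  label-γ : ∀ {e u v} (ne : u ≢ v) (j : J e u v) → label j ≡ γ u v ne j
  label-γ ne (inj₁ (refl , refl)) = γ-irr _ _ _ ne _ _ refl
  label-γ {e} ne (inj₂ (refl , refl)) = sym (γ-inv _ _ (loopless e) ne (J-self e) _)

  -- The first alternative is the degenerate case of a path that consists of c alone.
  Chorded : ∀ {u w} → P u w → E → Set
  Chorded p c = ((∀ f → f ∈E p → f ≡ c) × c ∈E p) ⊎ IsC false (λ g → g ≡ c ⊎ g ∈E p)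

  all-of-cycle : ∀ {s C w} → K (s ∷ C) → (Z : Cyc w) → (∀ g → g ∈ C → g ∈C Z) → ∀ g → g ∈C Z → g ∈ C
  all-of-cycle {s} {C} k Z sub g gZ with an-edge k
  ... | f , fC = cycle-all C (leafless k) Z (λ z g _ _ gC _ → sub g gC) (sub f fC) fC gZ

  private
    -- The triangle of e, c′ and c trades the chord c′ of p for e and the longer chord c. What
    -- elimination leaves is a circuit inside the cycle of c and the longer path, hence this whole
    -- cycle.
    widen : ∀ {u v w e c c′} (ne : u ≢ w) (j : J e u v) (p : P v w) → Simple-path (cons e j p) →
            v ≢ w → J c u w → J c′ v w → T e c′ c → Chorded p c′ → Chorded (cons e j p) c
    widen ne j p s v≢w Jc Jc′ t (inj₁ (only , c′∈)) = inj₂ (IsC-map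
      (λ { g (inj₁ eq) → inj₂ (inj₁ eq) ; g (inj₂ (inj₁ refl)) → inj₂ (inj₂ c′∈) ; g (inj₂ (inj₂ eq)) → inj₁ eq })
      (λ { g (inj₁ eq) → inj₂ (inj₂ eq) ; g (inj₂ (inj₁ eq)) → inj₁ eq ; g (inj₂ (inj₂ i)) → inj₂ (inj₁ (only g i)) })
      t)
    widen {u} {v} {w} {e} {c} {c′} ne j p s@(u∉ , _) v≢w Jc Jc′ (C , kC , C⊆ , ⊆C) (inj₂ (C₁ , k₁ , C₁⊆ , ⊆C₁)) =
      inj₂ (finish (elim-free kC k₁ (⊆C c′ (inj₂ (inj₁ refl))) (⊆C₁ c′ (inj₁ refl)) (⊆C e (inj₁ refl)) e∉))
      where
      e∉ : e ∉ C₁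
      e∉ i with C₁⊆ e i
      ... | inj₁ refl = ne (J-det (J-sym j) Jc′)
      ... | inj₂ i′ = first-∉ {j = j} {p} u∉ i′
      Z : Cyc w
      Z = cyc c (J-sym Jc) (cons e j p) s c∉
        where
        c∉ : ¬ (c ∈E cons e j p)
        c∉ (inj₁ refl) = v≢w (J-det j Jc)
        c∉ (inj₂ i) = u∉ (edge-ends p i (J-at₁ Jc))
      finish : ∃[ C′ ] (K (false ∷ C′) × e ∈ C′ × (∀ g → g ∈ C′ → g ≢ c′ × (g ∈ C ⊎ g ∈ C₁))) →
               IsC false (λ g → g ≡ c ⊎ g ∈E cons e j p)
      finish (C′ , k′ , _ , bound) = C′ , k′ , sub , all-of-cycle k′ Z sub
        where
        sub : ∀ g → g ∈ C′ → g ∈C Z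
        sub g i with bound g i
        ... | ne′ , inj₁ a with C⊆ g a
        ...   | inj₁ eq = inj₂ (inj₁ eq)
        ...   | inj₂ (inj₁ eq) = ⊥-elim (ne′ eq)
        ...   | inj₂ (inj₂ eq) = inj₁ eq
        sub g i | ne′ , inj₂ b with C₁⊆ g b
        ...   | inj₁ eq = ⊥-elim (ne′ eq)
        ...   | inj₂ i′ = inj₂ (inj₂ i′)

  -- Induction along the path: some chord c′ of the tail has the gain of the tail, and then e, c′
  -- and c form a triangle of matching gains.
  chord : ∀ {u w} (p : P u w) → Simple-path p → (ne : u ≢ w) → ∀ {c} (Jc : J c u w) →
          γ u w ne Jc ≡ gain p → Chorded p c
  chord (nil u) s ne Jc eq = ⊥-elim (ne refl)
  chord (cons e j (nil _)) s ne Jc eq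
    with γ-inj _ _ ne Jc j (trans eq (trans (identityʳ (label j)) (label-γ ne j)))
  ... | refl = inj₁ ((λ { f (inj₁ eq) → eq }) , inj₁ refl)
  chord {w = w} (cons {u} {v} e j p@(cons _ _ p″)) s@(_ , s′@(v∉ , _)) ne {c} Jc eq =
    go (γ-surj v w v≢w (gain p)) (chord p s′ v≢w)
    where
    v≢w : v ≢ w
    v≢w refl = v∉ (end-∈ p″)
    go : (Σ E λ c′ → Σ (J c′ v w) λ Jc′ → γ v w v≢w Jc′ ≡ gain p) →
         (∀ {c′} (Jc′ : J c′ v w) → γ v w v≢w Jc′ ≡ gain p → Chorded p c′) → Chorded (cons e j p) c
    go (c′ , Jc′ , eq′) rec = widen ne j p s v≢w Jc Jc′
      (γ-triangle (J-≢ j) v≢w ne j Jc′ Jc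
        (trans eq (cong₂ _·_ (label-γ (J-≢ j) j) (sym eq′))))
      (rec Jc′ eq′)

  cyc-gain : ∀ {w} → Cyc w → Fin t
  cyc-gain Z = label (Cyc.j Z) · gain (Cyc.p Z)

  -- Among the edges parallel to d let c be the one whose gain is that of p. The cycle is balanced
  -- exactly when c = d, and c closes p to an x-free circuit in any case, unless p is c itself.
  cycle-circuit : ∀ {w} (Z : Cyc w) →
                  (cyc-gain Z ≡ one × IsC false (_∈C Z)) ⊎ (cyc-gain Z ≢ one × IsC true (_∈C Z))
  cycle-circuit {w} Z@(cyc {u} d j p s d∉) = go (γ-surj u w u≢w (gain p))
    where
    u≢w : u ≢ w
    u≢w eq = J-≢ j (sym eq)
    label-d : label j ≡ inv (γ u w u≢w (J-sym j))
    label-d = trans (label-γ (J-≢ j) j) (γ-inv u w u≢w (J-≢ j) (J-sym j) j)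
    go : (Σ E λ c → Σ (J c u w) λ Jc → γ u w u≢w Jc ≡ gain p) →
         (cyc-gain Z ≡ one × IsC false (_∈C Z)) ⊎ (cyc-gain Z ≢ one × IsC true (_∈C Z))
    go (c , Jc , eq) with c Finₚ.≟ d
    ... | yes refl = inj₁ (balanced , circuit (chord p s u≢w Jc eq))
      where
      balanced : cyc-gain Z ≡ one
      balanced = trans (cong₂ _·_ label-d (trans (sym eq) (γ-irr _ _ u≢w u≢w Jc (J-sym j) refl))) (inverseˡ _)
      circuit : Chorded p c → IsC false (_∈C Z)
      circuit (inj₁ (_ , i)) = ⊥-elim (d∉ i)
      circuit (inj₂ k) = k
    ... | no c≢d = inj₂ (unbalanced , circuit (chord p s u≢w Jc eq))
      where
      unbalanced : cyc-gain Z ≢ one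
      unbalanced b = c≢d (γ-inj _ _ u≢w Jc (J-sym j) (trans eq (sym
        (trans (sym (GroupProps.⁻¹-involutive group _)) (trans (cong inv (sym label-d))
          (sym (inverseʳ-unique (label j) (gain p) b)))))))
      circuit : Chorded p c → IsC true (_∈C Z)
      circuit (inj₁ (only , i)) = IsC-map
        (λ { g (inj₁ refl) → inj₂ i ; g (inj₂ eq) → inj₁ eq })
        (λ { g (inj₁ eq) → inj₂ eq ; g (inj₂ i) → inj₁ (only g i) })
        (parallel Jc (J-sym j) c≢d)
      -- Eliminating c from {x , c , d} and the x-free circuit of c and p retains x and leaves edges
      -- of the cycle only.
      circuit (inj₂ k) = finish (eliminate {B = _∈C Z} (proj₁ (proj₂ pair)) k (inj₁ refl)
          (λ { g i → Sum.map₂ inj₁ (proj₁ (proj₂ (proj₂ pair)) g i) })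
          (λ { g (inj₁ eq) → inj₁ eq ; g (inj₂ i) → inj₂ (inj₂ i) }))
        where
        pair = parallel Jc (J-sym j) c≢d
        finish : ∃[ C ] (K (true ∷ C) × (∀ g → g ∈ C → g ∈C Z)) → IsC true (_∈C Z)
        finish (C , k , sub) = C , k , sub , all-of-cycle k Z sub

  Bal = Balanced Γ G φ
  Unbal = UnbalancedCycle Γ G φ
  LG = LGCircuit Γ G φ

  toCyc : ∀ {C} (Y : Cycle G) → CycleEdges G Y C → Σ (Cyc (Cycle.vs Y zero)) λ Z →
          Is Z C × cyc-gain Z ≡ walkGain Γ G φ Y
  toCyc {C} Y ce with fromCycle Y
  ... | Z , out , into , gains = Z ,
    ((λ f i → mem f (Equivalence.to (ce f) i)) , λ f i → Equivalence.from (ce f) (out i)) ,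
    sym (gains _·_ one inv φ)
    where
    mem : ∀ f → ∃[ i ] (Cycle.es Y i ≡ f) → f ∈C Z
    mem f (i , refl) = into i

  is-circuit : ∀ {w C} (Z : Cyc w) → Is Z C →
               (cyc-gain Z ≡ one × K (false ∷ C)) ⊎ (cyc-gain Z ≢ one × K (true ∷ C))
  is-circuit Z (to , from) with cycle-circuit Z
  ... | inj₁ (b , k) = inj₁ (b , IsC-set k from to)
  ... | inj₂ (b , k) = inj₂ (b , IsC-set k from to)

  balanced⇒circuit : ∀ {C} → Bal C → K (false ∷ C)
  balanced⇒circuit (Y , ce , g) with toCyc Y ce
  ... | Z , is , eq with is-circuit Z is
  ...   | inj₁ (_ , k) = k
  ...   | inj₂ (ne , _) = ⊥-elim (ne (trans eq g))

  circuit⇒unbalanced : ∀ {C} → K (true ∷ C) → ¬ Bal C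
  circuit⇒unbalanced k b = incomp-x (balanced⇒circuit b) k (λ i → i)

  is-balanced : ∀ {w C} (Z : Cyc w) → Is Z C → cyc-gain Z ≡ one → Bal C
  is-balanced Z@(cyc {u} d j p s d∉) is g with isCycle Z is
  ... | Y , ce = ToFun.toCycle Z , proj₂ (isCycle Z is) ,
    trans (cong₂ _·_ (relabel (ToFun.vs-start p)) (list-path p)) g
    where
    relabel : ∀ {x y} (eq : x ≡ y) {j : J d _ y} → label (subst (J d _) (sym eq) j) ≡ label j
    relabel refl = refl

  is-unbalanced : ∀ {w C} (Z : Cyc w) → Is Z C → K (true ∷ C) → Unbal C
  is-unbalanced Z is k = isCycle Z is , circuit⇒unbalanced k

  unbalanced : ∀ {C} → Unbal C → ∃[ w ] Σ (Cyc w) λ Z → Is Z C × K (true ∷ C)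
  unbalanced ((Y , ce) , ¬b) with toCyc Y ce
  ... | Z , is , eq with is-circuit Z is
  ...   | inj₁ (g , _) = ⊥-elim (¬b (Y , ce , trans (sym eq) g))
  ...   | inj₂ (_ , k) = _ , Z , is , k

  is-vertex⁻ : ∀ {w C z} (Z : Cyc w) → Is Z C → VertexOf G C z → z ∈VC Z
  is-vertex⁻ Z (to , _) (e , eC , at) = cyc-ends Z (to e eC) at

  is-vertex⁺ : ∀ {w C z} (Z : Cyc w) → Is Z C → z ∈VC Z → VertexOf G C z
  is-vertex⁺ Z (_ , from) i with cyc-at Z i
  ... | e , eZ , at = e , from e eZ , at

  is-edges : ∀ {w} (Z : Cyc w) → Is Z (cyc-edges Z)
  is-edges Z = (λ f → ∈-cyc⁻ Z) , (λ f → ∈-cyc⁺ Z)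

  -- Eliminating x while retaining an edge of the first cycle gives a circuit that also has an edge
  -- outside that cycle, or it would lie inside a circuit through x. Leaflessness then fills both
  -- cycles. The condition `meet` covers disjoint cycles as well as cycles that share their base
  -- vertex.
  handcuff : ∀ {w₁ w₂ C₁ C₂} (Z₁ : Cyc w₁) (Z₂ : Cyc w₂) → Is Z₁ C₁ → Is Z₂ C₂ →
             K (true ∷ C₁) → K (true ∷ C₂) →
             (∀ z → z ∈VC Z₁ → z ∈VC Z₂ → z ≡ w₁ × z ≡ w₂) → K (false ∷ (C₁ ∪ C₂))
  handcuff {w₁} {w₂} {C₁} {C₂} Z₁ Z₂ is₁ is₂ k₁ k₂ meet =
    go (elim-x k₁ k₂ (proj₂ is₁ d₁ (inj₁ refl)) d∉)
    where
    d₁ = Cyc.d Z₁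
    d∉ : d₁ ∉ C₂
    d∉ i = J-≢ (Cyc.j Z₁) (trans (both (J-at₁ (Cyc.j Z₁))) (sym (both (J-at₂ (Cyc.j Z₁)))))
      where
      both : ∀ {z} → At d₁ z → z ≡ w₁
      both at = proj₁ (meet _ (cyc-ends Z₁ (inj₁ refl) at) (cyc-ends Z₂ (proj₁ is₂ d₁ i) at))
    go : ∃[ C′ ] (K (false ∷ C′) × d₁ ∈ C′ × (∀ g → g ∈ C′ → g ∈ C₁ ⊎ g ∈ C₂)) → K (false ∷ (C₁ ∪ C₂))
    go (C′ , k , dC , bound) with find-∉ C′ C₁
    ... | inj₂ sub = ⊥-elim (incomp-x k k₁ sub)
    ... | inj₁ (f , fC , f∉) =
      subst (λ C → K (false ∷ C)) (⊆-antisym (λ {g} i → x∈p∪q⁺ (bound g i)) (λ i → all (∈-∪⁻ i))) k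
      where
      private₁ : ∀ z g → z ∈VC Z₁ → z ≢ w₁ → g ∈ C′ → At g z → g ∈C Z₁
      private₁ z g zi ne gC at with bound g gC
      ... | inj₁ a = proj₁ is₁ g a
      ... | inj₂ b = ⊥-elim (ne (proj₁ (meet z zi (cyc-ends Z₂ (proj₁ is₂ g b) at))))
      private₂ : ∀ z g → z ∈VC Z₂ → z ≢ w₂ → g ∈ C′ → At g z → g ∈C Z₂
      private₂ z g zi ne gC at with bound g gC
      ... | inj₁ a = ⊥-elim (ne (proj₂ (meet z (cyc-ends Z₁ (proj₁ is₁ g a) at) zi)))
      ... | inj₂ b = proj₁ is₂ g b
      f₂ : f ∈ C₁ ⊎ f ∈ C₂ → f ∈ C₂
      f₂ (inj₁ a) = ⊥-elim (f∉ a)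
      f₂ (inj₂ b) = b
      all : ∀ {g} → g ∈ C₁ ⊎ g ∈ C₂ → g ∈ C′
      all {g} (inj₁ a) = cycle-all C′ (leafless k) Z₁ private₁ (inj₁ refl) dC (proj₁ is₁ g a)
      all {g} (inj₂ b) = cycle-all C′ (leafless k) Z₂ private₂ (proj₁ is₂ f (f₂ (bound f fC))) fC (proj₁ is₂ g b)

  record ThreePaths (u v : V) : Set where
    field
      u≢v    : u ≢ v
      path   : Fin 3 → P u v
      simple : ∀ a → Simple-path (path a)
      meets  : ∀ a b → a ≢ b → ∀ z → z ∈V path a → z ∈V path b → z ≡ u ⊎ z ≡ v
      apart  : ∀ a b → a ≢ b → ∀ f → f ∈E path a → ¬ (f ∈E path b)

    union : Subset (nE G)
    union = edges (path zero) ∪ edges (path (suc zero)) ∪ edges (path (suc (suc zero)))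

    ∈-union⁺ : ∀ a {f} → f ∈E path a → f ∈ union
    ∈-union⁺ zero i = x∈p∪q⁺ (inj₁ (∈-edges⁺ (path zero) i))
    ∈-union⁺ (suc zero) i = x∈p∪q⁺ (inj₂ (x∈p∪q⁺ (inj₁ (∈-edges⁺ (path (suc zero)) i))))
    ∈-union⁺ (suc (suc zero)) i = x∈p∪q⁺ (inj₂ (x∈p∪q⁺ (inj₂ (∈-edges⁺ (path (suc (suc zero))) i))))

    ∈-union⁻ : ∀ {f} → f ∈ union → ∃[ a ] (f ∈E path a)
    ∈-union⁻ i with ∈-∪⁻ i
    ... | inj₁ a = zero , ∈-edges⁻ (path zero) a
    ... | inj₂ i′ with ∈-∪⁻ i′
    ...   | inj₁ a = suc zero , ∈-edges⁻ (path (suc zero)) a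
    ...   | inj₂ a = suc (suc zero) , ∈-edges⁻ (path (suc (suc zero))) a

    isTheta : IsTheta G union
    isTheta = u , v , u≢v , (λ a → ToFun.toPath (path a) (simple a)) , (λ a → edges (path a)) ,
      (λ a → ToFun.toPath-edges (path a) (simple a)) , (λ a → long (path a)) ,
      (λ a b ne f i i′ → apart a b ne f (∈-edges⁻ (path a) i) (∈-edges⁻ (path b) i′)) ,
      (λ a b ne i j eq → meets a b ne _ (ToFun.vs-∈ (path a) i)
        (subst (_∈V path b) (sym eq) (ToFun.vs-∈ (path b) j))) , refl
      where
      long : (p : P u v) → 1 ≤ ToFun.len p
      long (nil _) = ⊥-elim (u≢v refl)
      long (cons _ _ _) = s≤s z≤n

    pair : ∀ a b → a ≢ b → Σ (Cyc u) λ Z → (∀ f → f ∈C Z → f ∈E path a ⊎ f ∈E path b) ×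
                                             (∀ f → f ∈E path a ⊎ f ∈E path b → f ∈C Z)
    pair a b ne = go (path a) (simple a) (meets a b ne) (apart a b ne)
      where
      r = rev (path b)
      go : (p : P u v) → Simple-path p → (∀ z → z ∈V p → z ∈V path b → z ≡ u ⊎ z ≡ v) →
           (∀ f → f ∈E p → ¬ (f ∈E path b)) →
           Σ (Cyc u) λ Z → (∀ f → f ∈C Z → f ∈E p ⊎ f ∈E path b) × (∀ f → f ∈E p ⊎ f ∈E path b → f ∈C Z)
      go (nil _) s h h′ = ⊥-elim (u≢v refl)
      go (cons e j q) (u∉ , s) h h′ = cyc e j (q ++ r) simple′ e∉ , to , from
        where
        meet : ∀ z → z ∈V q → z ∈V r → z ≡ v
        meet z zq zr with h z (inj₂ zq) (∈V-rev (path b) zr)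
        ... | inj₁ refl = ⊥-elim (u∉ zq)
        ... | inj₂ eq = eq
        simple′ : Simple-path (q ++ r)
        simple′ = simple-++⁺ q s (simple-rev (path b) (simple b)) meet
        e∉ : ¬ (e ∈E (q ++ r))
        e∉ i with ∈E-++⁻ q i
        ... | inj₁ i′ = first-∉ {j = j} {q} u∉ i′
        ... | inj₂ i′ = h′ e (inj₁ refl) (∈E-rev⁻ (path b) i′)
        to : ∀ f → f ≡ e ⊎ f ∈E (q ++ r) → (f ≡ e ⊎ f ∈E q) ⊎ f ∈E path b
        to f (inj₁ eq) = inj₁ (inj₁ eq)
        to f (inj₂ i) with ∈E-++⁻ q i
        ... | inj₁ i′ = inj₁ (inj₂ i′)
        ... | inj₂ i′ = inj₂ (∈E-rev⁻ (path b) i′)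
        from : ∀ f → (f ≡ e ⊎ f ∈E q) ⊎ f ∈E path b → f ≡ e ⊎ f ∈E (q ++ r)
        from f (inj₁ (inj₁ eq)) = inj₁ eq
        from f (inj₁ (inj₂ i)) = inj₂ (∈E-++⁺ q (inj₁ i))
        from f (inj₂ i) = inj₂ (∈E-++⁺ q (inj₂ (∈E-rev⁺ (path b) i)))

    first : ∀ a → ∃[ e ] (e ∈E path a)
    first a with vertex-at (path a) (start-∈ (path a)) u≢v
    ... | e , i , _ = e , i

    module _ {C} (C≡ : C ≡ union) (¬bal : ∀ B → B ⊆ C → IsCycle G B → ¬ Bal B) where

      pair-circuit : ∀ a b → a ≢ b →
        ∃[ B ] (K (true ∷ B) × (∀ f → f ∈ B → f ∈E path a ⊎ f ∈E path b) × (∀ f → f ∈E path a ⊎ f ∈E path b → f ∈ B))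
      pair-circuit a b ne with pair a b ne
      ... | Z , to , from with is-circuit Z (is-edges Z)
      ...   | inj₂ (_ , k) = cyc-edges Z , k , (λ f i → to f (∈-cyc⁻ Z i)) , (λ f i → ∈-cyc⁺ Z (from f i))
      ...   | inj₁ (g , _) = ⊥-elim (¬bal (cyc-edges Z) sub (isCycle Z (is-edges Z)) (is-balanced Z (is-edges Z) g))
        where
        into : ∀ {f} → f ∈E path a ⊎ f ∈E path b → f ∈ union
        into (inj₁ i) = ∈-union⁺ a i
        into (inj₂ i) = ∈-union⁺ b i
        sub : cyc-edges Z ⊆ C
        sub {f} i = subst (f ∈_) (sym C≡) (into (to f (∈-cyc⁻ Z i)))

      private
        module Within {C′} (k : K (false ∷ C′)) (sub : ∀ {g} → g ∈ C′ → g ∈ union) where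

          whole : ∀ a {e f} → e ∈E path a → e ∈ C′ → f ∈E path a → f ∈ C′
          whole a = path-all C′ (leafless k) (path a) (simple a) inner
            where
            inner : ∀ z g → z ∈V path a → z ≢ u → z ≢ v → g ∈ C′ → At g z → g ∈E path a
            inner z g zi zu zv gC at with ∈-union⁻ (sub gC)
            ... | b , i with a Finₚ.≟ b
            ...   | yes refl = i
            ...   | no ne with meets a b ne z zi (edge-ends (path b) i at)
            ...     | inj₁ eq = ⊥-elim (zu eq)
            ...     | inj₂ eq = ⊥-elim (zv eq)

          -- A circuit that misses one path lies in the cycle formed by the other two, which is a
          -- circuit only together with x.
          used : ∀ a b c → b ≢ c → (∀ x → x ≡ a ⊎ x ≡ b ⊎ x ≡ c) → ∀ {f} → f ∈E path a → f ∈ C′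
          used a b c b≢c cover {f} i with first a
          ... | e , ei with e ∈? C′
          ...   | yes eC = whole a ei eC i
          ...   | no e∉ with pair-circuit b c b≢c
          ...     | B , kB , _ , from = ⊥-elim (incomp-x k kB into)
            where
            into : C′ ⊆ B
            into {g} gC with ∈-union⁻ (sub gC)
            ... | x , gx with cover x
            ...   | inj₁ refl = ⊥-elim (e∉ (whole x gx gC ei))
            ...   | inj₂ (inj₁ refl) = from g (inj₁ gx)
            ...   | inj₂ (inj₂ refl) = from g (inj₂ gx)

          full : ∀ a {f} → f ∈E path a → f ∈ C′
          full zero = used zero (suc zero) (suc (suc zero)) (λ ())
            λ { zero → inj₁ refl ; (suc zero) → inj₂ (inj₁ refl) ; (suc (suc zero)) → inj₂ (inj₂ refl) }
          full (suc zero) = used (suc zero) zero (suc (suc zero)) (λ ())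
            λ { zero → inj₂ (inj₁ refl) ; (suc zero) → inj₁ refl ; (suc (suc zero)) → inj₂ (inj₂ refl) }
          full (suc (suc zero)) = used (suc (suc zero)) zero (suc zero) (λ ())
            λ { zero → inj₂ (inj₁ refl) ; (suc zero) → inj₂ (inj₂ refl) ; (suc (suc zero)) → inj₁ refl }

      -- x is eliminated from two of the three unbalanced cycles. The x-free circuit obtained lies
      -- in the theta, contains each path wholly or not at all, and by `used` omits none.
      theta-circuit : K (false ∷ C)
      theta-circuit with pair-circuit zero (suc zero) (λ ()) | pair-circuit zero (suc (suc zero)) (λ ()) | first (suc zero)
      ... | B₁ , k₁ , to₁ , from₁ | B₂ , k₂ , to₂ , from₂ | e , ei with elim-x k₁ k₂ (from₁ e (inj₂ ei)) e∉
        where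
        e∉ : e ∉ B₂
        e∉ i with to₂ e i
        ... | inj₁ i′ = apart (suc zero) zero (λ ()) e ei i′
        ... | inj₂ i′ = apart (suc zero) (suc (suc zero)) (λ ()) e ei i′
      ...   | C′ , k , _ , bound =
        subst (λ C → K (false ∷ C)) (trans (⊆-antisym sub (λ {g} i → Within.full k sub _ (proj₂ (∈-union⁻ i)))) (sym C≡)) k
        where
        into : ∀ {g} → (g ∈E path zero ⊎ g ∈E path (suc zero)) ⊎ (g ∈E path zero ⊎ g ∈E path (suc (suc zero))) → g ∈ union
        into (inj₁ (inj₁ i)) = ∈-union⁺ zero i
        into (inj₁ (inj₂ i)) = ∈-union⁺ (suc zero) i
        into (inj₂ (inj₁ i)) = ∈-union⁺ zero i
        into (inj₂ (inj₂ i)) = ∈-union⁺ (suc (suc zero)) i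
        sub : ∀ {g} → g ∈ C′ → g ∈ union
        sub {g} i = into (Sum.map (to₁ g) (to₂ g) (bound g i))

  fromTheta : ∀ {C} → IsTheta G C → ∃[ u ] ∃[ v ] Σ (ThreePaths u v) λ θ → C ≡ ThreePaths.union θ
  fromTheta {C} (u , v , u≢v , Q , PE , pe , long , disjoint , meet , refl) = u , v , θ , ⊆-antisym into out
    where
    path : ∀ a → P u v
    path a = proj₁ (fromPath (Q a))
    edge⁻ : ∀ a {f} → f ∈E path a → f ∈ PE a
    edge⁻ a {f} i = Equivalence.from (pe a f) (proj₁ (proj₂ (proj₂ (fromPath (Q a)))) i)
    edge⁺ : ∀ a {f} → f ∈ PE a → f ∈E path a
    edge⁺ a {f} i with Equivalence.to (pe a f) i
    ... | k , refl = proj₁ (proj₂ (proj₂ (proj₂ (fromPath (Q a))))) k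
    vert : ∀ a {z} → z ∈V path a → ∃[ i ] (Path.vs (Q a) i ≡ z)
    vert a = proj₂ (proj₂ (proj₂ (proj₂ (fromPath (Q a)))))
    meets : ∀ a b → a ≢ b → ∀ z → z ∈V path a → z ∈V path b → z ≡ u ⊎ z ≡ v
    meets a b ne z za zb with vert a za | vert b zb
    ... | i , refl | k , eq = meet a b ne i k (sym eq)
    θ : ThreePaths u v
    θ = record
      { u≢v = u≢v ; path = path ; simple = λ a → proj₁ (proj₂ (fromPath (Q a))) ; meets = meets
      ; apart = λ a b ne f i i′ → disjoint a b ne f (edge⁻ a i) (edge⁻ b i′) }
    open ThreePaths θ using (union; ∈-union⁺; ∈-union⁻)
    into : C ⊆ union
    into i with ∈-∪⁻ i
    ... | inj₁ a = ∈-union⁺ zero (edge⁺ zero a)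
    ... | inj₂ i′ with ∈-∪⁻ i′
    ...   | inj₁ a = ∈-union⁺ (suc zero) (edge⁺ (suc zero) a)
    ...   | inj₂ a = ∈-union⁺ (suc (suc zero)) (edge⁺ (suc (suc zero)) a)
    out : union ⊆ C
    out i with ∈-union⁻ i
    ... | zero , a = x∈p∪q⁺ (inj₁ (edge⁻ zero a))
    ... | suc zero , a = x∈p∪q⁺ (inj₂ (x∈p∪q⁺ (inj₁ (edge⁻ (suc zero) a))))
    ... | suc (suc zero) , a = x∈p∪q⁺ (inj₂ (x∈p∪q⁺ (inj₂ (edge⁻ (suc (suc zero)) a))))

  LG⇒circuit : ∀ {C} → LG C → K (false ∷ C)
  LG⇒circuit (inj₁ (_ , b)) = balanced⇒circuit b
  LG⇒circuit (inj₂ (inj₁ (C₁ , C₂ , u₁ , u₂ , disjoint , refl))) with unbalanced u₁ | unbalanced u₂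
  ... | w₁ , Z₁ , is₁ , k₁ | w₂ , Z₂ , is₂ , k₂ = handcuff Z₁ Z₂ is₁ is₂ k₁ k₂
    λ z i₁ i₂ → ⊥-elim (disjoint z (is-vertex⁺ Z₁ is₁ i₁) (is-vertex⁺ Z₂ is₂ i₂))
  LG⇒circuit (inj₂ (inj₂ (inj₁ (C₁ , C₂ , u₁ , u₂ , (v , v₁ , v₂ , only) , refl)))) with unbalanced u₁ | unbalanced u₂
  -- Both cycles are rotated so that the common vertex becomes their base vertex, as `handcuff`
  -- requires.
  ... | w₁ , Z₁ , is₁ , k₁ | w₂ , Z₂ , is₂ , k₂ with rotate Z₁ (is-vertex⁻ Z₁ is₁ v₁) | rotate Z₂ (is-vertex⁻ Z₂ is₂ v₂)
  ...   | Y₁ , to₁ , from₁ | Y₂ , to₂ , from₂ = handcuff Y₁ Y₂ is₁′ is₂′ k₁ k₂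
    λ z i₁ i₂ → let eq = only z (is-vertex⁺ Y₁ is₁′ i₁) (is-vertex⁺ Y₂ is₂′ i₂) in eq , eq
    where
    is₁′ : Is Y₁ C₁
    is₁′ = (λ f i → to₁ f (proj₁ is₁ f i)) , (λ f i → proj₂ is₁ f (from₁ f i))
    is₂′ : Is Y₂ C₂
    is₂′ = (λ f i → to₂ f (proj₁ is₂ f i)) , (λ f i → proj₂ is₂ f (from₂ f i))
  LG⇒circuit (inj₂ (inj₂ (inj₂ (θ , ¬bal)))) with fromTheta θ
  ... | _ , _ , θ′ , eq = ThreePaths.theta-circuit θ′ eq ¬bal

-- Recognising the circuits of the deletion and of the contraction

module Recognition {n t} (D : FilledLift n t) where

  open FilledLift D
  open LiftGraphic D public

  three-sym : {R : Fin 3 → Fin 3 → Set} → (∀ {a b} → R a b → R b a) →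
              R zero (suc zero) → R zero (suc (suc zero)) → R (suc zero) (suc (suc zero)) →
              ∀ a b → a ≢ b → R a b
  three-sym sy r s q zero zero ne = ⊥-elim (ne refl)
  three-sym sy r s q zero (suc zero) ne = r
  three-sym sy r s q zero (suc (suc zero)) ne = s
  three-sym sy r s q (suc zero) zero ne = sy r
  three-sym sy r s q (suc zero) (suc zero) ne = ⊥-elim (ne refl)
  three-sym sy r s q (suc zero) (suc (suc zero)) ne = q
  three-sym sy r s q (suc (suc zero)) zero ne = sy s
  three-sym sy r s q (suc (suc zero)) (suc zero) ne = sy q
  three-sym sy r s q (suc (suc zero)) (suc (suc zero)) ne = ⊥-elim (ne refl)

  ear-theta : ∀ {w v} (Z : Cyc w) → v ∈VC Z → w ≢ v → (q : P w v) → Simple-path q →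
              (∀ z → z ∈V q → z ∈VC Z → z ≡ w ⊎ z ≡ v) → (∀ e → e ∈E q → ¬ (e ∈C Z)) →
              Σ (ThreePaths w v) λ θ → ∀ {f} → f ∈ ThreePaths.union θ → f ∈C Z ⊎ f ∈E q
  ear-theta {w} {v} (cyc {y} d j p s d∉) v∈ w≢v q sq meet-q apart-q with split p v∈
  ... | l , r , refl = θ , λ i → into (ThreePaths.∈-union⁻ θ i)
    where
    parts = simple-++⁻ l s
    meet-lr = proj₂ (proj₂ parts)
    w∉l : ¬ (w ∈V l)
    w∉l i = w≢v (meet-lr w i (end-∈ r))
    path : Fin 3 → P w v
    path zero = cons d j l
    path (suc zero) = rev r
    path (suc (suc zero)) = q
    simple : ∀ a → Simple-path (path a)
    simple zero = w∉l , proj₁ parts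
    simple (suc zero) = simple-rev r (proj₁ (proj₂ parts))
    simple (suc (suc zero)) = sq
    r-in : ∀ {z} → z ∈V rev r → z ∈V (l ++ r)
    r-in i = ∈V-++⁺ʳ l (∈V-rev r i)
    l-in : ∀ {z} → z ∈V cons d j l → z ∈V (l ++ r)
    l-in (inj₁ refl) = ∈V-++⁺ʳ l (end-∈ r)
    l-in (inj₂ i) = ∈V-++⁺ˡ l i
    meets : ∀ a b → a ≢ b → ∀ z → z ∈V path a → z ∈V path b → z ≡ w ⊎ z ≡ v
    meets = three-sym {λ a b → ∀ z → z ∈V path a → z ∈V path b → z ≡ w ⊎ z ≡ v}
      (λ h z a b → h z b a)
      (λ { z (inj₁ eq) b → inj₁ eq ; z (inj₂ a) b → inj₂ (meet-lr z a (∈V-rev r b)) })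
      (λ z a b → meet-q z b (l-in a))
      (λ z a b → meet-q z b (r-in a))
    both : ∀ f → f ∈E l → ¬ (f ∈E r)
    both f fl fr = loopless f (trans (at (inj₁ refl)) (sym (at (inj₂ refl))))
      where
      at : ∀ {z} → At f z → z ≡ v
      at h = meet-lr _ (edge-ends l fl h) (edge-ends r fr h)
    apart : ∀ a b → a ≢ b → ∀ f → f ∈E path a → ¬ (f ∈E path b)
    apart = three-sym {λ a b → ∀ f → f ∈E path a → ¬ (f ∈E path b)}
      (λ h f a b → h f b a)
      (λ { f (inj₁ refl) b → d∉ (∈E-++⁺ l (inj₂ (∈E-rev⁻ r b))) ; f (inj₂ a) b → both f a (∈E-rev⁻ r b) })
      (λ { f (inj₁ eq) b → apart-q f b (inj₁ eq) ; f (inj₂ a) b → apart-q f b (inj₂ (∈E-++⁺ l (inj₁ a))) })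
      (λ f a b → apart-q f b (inj₂ (∈E-++⁺ l (inj₂ (∈E-rev⁻ r a)))))
    θ : ThreePaths w v
    θ = record { u≢v = w≢v ; path = path ; simple = simple ; meets = meets ; apart = apart }
    into : ∀ {f} → ∃[ a ] (f ∈E path a) → (f ≡ d ⊎ f ∈E (l ++ r)) ⊎ f ∈E q
    into (zero , inj₁ eq) = inj₁ (inj₁ eq)
    into (zero , inj₂ i) = inj₁ (inj₂ (∈E-++⁺ l (inj₁ i)))
    into (suc zero , i) = inj₁ (inj₂ (∈E-++⁺ l (inj₂ (∈E-rev⁻ r i))))
    into (suc (suc zero) , i) = inj₂ i

  module _ {C} (kC : K (false ∷ C)) where

    private
      whole-cycle : ∀ {w} (Z : Cyc w) → (∀ e → e ∈C Z → e ∈ C) → cyc-gain Z ≡ ε Γ →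
                    K (false ∷ cyc-edges Z) → LG C
      whole-cycle Z sub g k = inj₁ (isCycle Z is , is-balanced Z is g)
        where
        is : Is Z C
        is = (λ f i → ∈-cyc⁻ Z (incomp k kC (λ {e} i → sub e (∈-cyc⁻ Z i)) i)) , sub

    -- Two unbalanced cycles Z₀ ∌ f and Z ∋ f inside C: eliminating x shows that they cover C,
    -- and the ear of Z through f decides between handcuff and theta.
    module Covered {w₀} (Z₀ : Cyc w₀) (sub₀ : ∀ e → e ∈C Z₀ → e ∈ C) (k₀ : K (true ∷ cyc-edges Z₀))
                   (f : E) (fC : f ∈ C) (f∉₀ : f ∉ cyc-edges Z₀)
                   {u w} (j : J f w u) (q : P u w) (sq : Simple-path q) (f∉q : ¬ (f ∈E q))
                   (subq : ∀ e → e ∈E q → e ∈ C) where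

      Z : Cyc w
      Z = cyc f j q sq f∉q

      subZ : ∀ e → e ∈C Z → e ∈ C
      subZ e (inj₁ refl) = fC
      subZ e (inj₂ i) = subq e i

      C₀ = cyc-edges Z₀
      C₁ = cyc-edges Z

      module _ (k₁ : K (true ∷ C₁)) where

        covers : C ≡ C₀ ∪ C₁
        covers with elim-x k₁ k₀ (∈-cyc⁺ Z (inj₁ refl)) f∉₀
        ... | C′ , k′ , _ , bound = ⊆-antisym (λ i → x∈p∪q⁺ (Sum.swap (bound _ (incomp k′ kC (λ {e} i → inC (bound e i)) i))))
                                              (λ i → inC (Sum.swap (∈-∪⁻ i)))
          where
          inC : ∀ {e} → e ∈ C₁ ⊎ e ∈ C₀ → e ∈ C
          inC (inj₁ i) = subZ _ (∈-cyc⁻ Z i)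
          inC (inj₂ i) = sub₀ _ (∈-cyc⁻ Z₀ i)

        u₀ : Unbal C₀
        u₀ = is-unbalanced Z₀ (is-edges Z₀) k₀

        u₁ : Unbal C₁
        u₁ = is-unbalanced Z (is-edges Z) k₁

        disjoint : (∀ y → y ∈V q → ¬ (y ∈VC Z₀)) → LG C
        disjoint h = inj₂ (inj₁ (C₀ , C₁ , u₀ , u₁ ,
          (λ v v₀ v₁ → h v (is-vertex⁻ Z (is-edges Z) v₁) (is-vertex⁻ Z₀ (is-edges Z₀) v₀)) , covers))

        touching : ∀ z → z ∈V q → z ∈VC Z₀ → (∀ y → y ∈V q → y ∈VC Z₀ → y ≡ z) → LG C
        touching z zq z₀ only = inj₂ (inj₂ (inj₁ (C₀ , C₁ , u₀ , u₁ ,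
          (z , is-vertex⁺ Z₀ (is-edges Z₀) z₀ , is-vertex⁺ Z (is-edges Z) zq ,
           λ y y₀ y₁ → only y (is-vertex⁻ Z (is-edges Z) y₁) (is-vertex⁻ Z₀ (is-edges Z₀) y₀)) , covers)))

        -- A balanced cycle inside C is a circuit and therefore equals C. The cycle `Z₀` inside it
        -- would then be all of it, but `Z₀` misses f.
        no-balanced : ∀ B → B ⊆ C → IsCycle G B → ¬ Bal B
        no-balanced B sub (Y , ce) b with toCyc Y ce
        ... | Z′ , (to , from) , _ = f∉₀ (all-of-cycle k₀ Z′ (λ g i → to g (big (sub₀ g (∈-cyc⁻ Z₀ i)))) f (to f (big fC)))
          where
          big : C ⊆ B
          big = incomp (balanced⇒circuit b) kC sub

        -- The theta formed by `Z₀` and the ear p is itself a circuit inside C, so by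
        -- incomparability it is C.
        theta : ∀ {w v} → w ≢ v → w ∈VC Z₀ → v ∈VC Z₀ → (p : P w v) → Simple-path p →
                (∀ z → z ∈V p → z ∈VC Z₀ → z ≡ w ⊎ z ≡ v) → (∀ e → e ∈E p → ¬ (e ∈C Z₀)) →
                (∀ e → e ∈E p → e ∈ C) → LG C
        theta w≢v w₀ v₀ p sp meet apart subp with rotate Z₀ w₀
        ... | Y , to , from with ear-theta Y (vertex v₀) w≢v p sp (λ z i j → meet z i (vertex′ j)) (λ e i j → apart e i (from e j))
          where
          vertex : ∀ {z} → z ∈VC Z₀ → z ∈VC Y
          vertex i with cyc-at Z₀ i
          ... | e , eZ , at = cyc-ends Y (to e eZ) at
          vertex′ : ∀ {z} → z ∈VC Y → z ∈VC Z₀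
          vertex′ i with cyc-at Y i
          ... | e , eY , at = cyc-ends Z₀ (from e eY) at
        ...   | θ , into = subst LG (⊆-antisym sub (incomp k kC sub)) lg
          where
          T = ThreePaths.union θ
          inC : ∀ {e} → e ∈C Y ⊎ e ∈E p → e ∈ C
          inC (inj₁ i) = sub₀ _ (from _ i)
          inC (inj₂ i) = subp _ i
          sub : T ⊆ C
          sub i = inC (into i)
          lg : LG T
          lg = inj₂ (inj₂ (inj₂ (ThreePaths.isTheta θ , λ B B⊆ → no-balanced B (λ i → sub (B⊆ i)))))
          k : K (false ∷ T)
          k = LG⇒circuit lg

        conclude : LG C
        conclude with first-hit (λ v → v ∈V? Cyc.p Z₀) q
        ... | inj₂ none = disjoint none
        ... | inj₁ (z , z₀ , l , r , refl , l-only) with last-hit (λ v → v ∈V? Cyc.p Z₀) r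
        ...   | inj₂ none = ⊥-elim (none z (start-∈ r) z₀)
        ...   | inj₁ (z′ , z′₀ , l′ , r′ , refl , r-only) with z Finₚ.≟ z′
        ...     | yes refl = touching z (∈V-++⁺ˡ l (end-∈ l)) z₀ only
          where
          loop : (p : P z z) → Simple-path p → ∀ y → y ∈V p → y ≡ z
          loop (nil _) s y i = i
          loop (cons e j p) (z∉ , _) y i = ⊥-elim (z∉ (end-∈ p))
          only : ∀ y → y ∈V (l ++ l′ ++ r′) → y ∈VC Z₀ → y ≡ z
          only y i y₀ with ∈V-++⁻ l i
          ... | inj₁ a = l-only y a y₀
          ... | inj₂ b with ∈V-++⁻ l′ b
          ...   | inj₁ c = loop l′ (proj₁ (simple-++⁻ l′ (proj₁ (proj₂ (simple-++⁻ l sq))))) y c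
          ...   | inj₂ c = r-only y c y₀
        ...     | no z≢z′ = theta (≢-sym z≢z′) z′₀ z₀ p simple-p meet apart subp
          where
          parts = simple-++⁻ l sq
          -- The ear through f: from the last meeting point z′ along r′ to the end of q, across f,
          -- and along l to the first meeting point z. The middle part l′ may meet `Z₀` many times
          -- and is left out.
          p : P z′ z
          p = r′ ++ cons f j l
          cross : ∀ y → y ∈V l → ¬ (y ∈V r′)
          cross y yl yr with proj₂ (proj₂ parts) y yl (∈V-++⁺ʳ l′ yr)
          ... | refl = z≢z′ (r-only z yr z₀)
          simple-p : Simple-path p
          simple-p = simple-++⁺ r′ (proj₁ (proj₂ (simple-++⁻ l′ (proj₁ (proj₂ parts)))))
            ((λ i → cross _ i (end-∈ r′)) , proj₁ parts)
            (λ { y i (inj₁ eq) → eq ; y i (inj₂ i′) → ⊥-elim (cross y i′ i) })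
          meet : ∀ y → y ∈V p → y ∈VC Z₀ → y ≡ z′ ⊎ y ≡ z
          meet y i y₀ with ∈V-++⁻ r′ i
          ... | inj₁ a = inj₁ (r-only y a y₀)
          ... | inj₂ (inj₁ refl) = inj₁ (r-only y (end-∈ r′) y₀)
          ... | inj₂ (inj₂ a) = inj₂ (l-only y a y₀)
          apart : ∀ e → e ∈E p → ¬ (e ∈C Z₀)
          apart e i e₀ with ∈E-++⁻ r′ i
          ... | inj₁ a = loopless e (trans (at (inj₁ refl)) (sym (at (inj₂ refl))))
            where
            at : ∀ {y} → At e y → y ≡ z′
            at h = r-only _ (edge-ends r′ a h) (cyc-ends Z₀ e₀ h)
          ... | inj₂ (inj₁ refl) = f∉₀ (∈-cyc⁺ Z₀ e₀)
          ... | inj₂ (inj₂ a) = loopless e (trans (at (inj₁ refl)) (sym (at (inj₂ refl))))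
            where
            at : ∀ {y} → At e y → y ≡ z
            at h = l-only _ (edge-ends l a h) (cyc-ends Z₀ e₀ h)
          subp : ∀ e → e ∈E p → e ∈ C
          subp e i with ∈E-++⁻ r′ i
          ... | inj₁ a = subq e (∈E-++⁺ l (inj₂ (∈E-++⁺ l′ (inj₂ a))))
          ... | inj₂ (inj₁ refl) = fC
          ... | inj₂ (inj₂ a) = subq e (∈E-++⁺ l (inj₁ a))

    circuit⇒LG : LG C
    circuit⇒LG with an-edge kC
    ... | f₀ , f₀C with cycle-through (cuts kC) f₀ f₀C
    ...   | Z₀ , _ , sub₀ with is-circuit Z₀ (is-edges Z₀)
    ...     | inj₁ (g , k₀) = whole-cycle Z₀ sub₀ g k₀
    ...     | inj₂ (_ , k₀) with find-∉ C (cyc-edges Z₀)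
    ...       | inj₂ sub = ⊥-elim (incomp-x kC k₀ sub)
    ...       | inj₁ (f , fC , f∉) with cycle-through (cuts kC) f fC
    ...         | Z@(cyc .f j q sq f∉q) , refl , subZ with is-circuit Z (is-edges Z)
    ...           | inj₁ (g , k₁) = whole-cycle Z subZ g k₁
    ...           | inj₂ (_ , k₁) =
      Covered.conclude Z₀ sub₀ k₀ f fC f∉ j q sq f∉q (λ e i → subZ e (inj₂ i)) k₁

  LG⇔circuit : ∀ C → K (false ∷ C) ⇔ LG C
  LG⇔circuit C = mk⇔ circuit⇒LG LG⇒circuit

  L : CircuitSys
  L = record { size = suc (nE G) ; ground = ⊤ ; Circuit = K }

  private
    ∷-remove : ∀ {m} s (C : Subset m) → (s ∷ C) - zero ≡ false ∷ C
    ∷-remove s C = cong₂ _∷_ (side s) (p─⊥≡p C)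
      where
      side : ∀ s → Data.Vec.head ((s ∷ C) - zero) ≡ false
      side true = refl
      side false = refl

    candidate : ∀ {C} → ∃[ C′ ] (K C′ × false ∷ C ≡ C′ - zero) → ∃[ s ] K (s ∷ C)
    candidate (s ∷ C′ , k , eq) with ∷-injective (trans eq (∷-remove s C′))
    ... | _ , refl = s , k

    contains-cycle : ∀ {s C} → K (s ∷ C) → ∃[ w ] Σ (Cyc w) λ Z → ∀ e → e ∈C Z → e ∈ C
    contains-cycle k with an-edge k
    ... | f , fC with cycle-through (cuts k) f fC
    ...   | Z , _ , sub = _ , Z , sub

    cycle-candidate : ∀ {w C} (Z : Cyc w) → Is Z C → ∃[ C′ ] (K C′ × false ∷ C ≡ C′ - zero)
    cycle-candidate {C = C} Z is with is-circuit Z is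
    ... | inj₁ (_ , k) = false ∷ C , k , sym (∷-remove false C)
    ... | inj₂ (_ , k) = true ∷ C , k , sym (∷-remove true C)

  -- The edges of every circuit contain a cycle, by the cut property, and every cycle is the edge
  -- set of a circuit with or without x. The minimal edge sets are hence the cycles.
  contraction⇔cycle : ∀ C → Circuit (contract L zero) (false ∷ C) ⇔ IsCycle G C
  contraction⇔cycle C = mk⇔ to from
    where
    to : Circuit (contract L zero) (false ∷ C) → IsCycle G C
    to (_ , cand , minimal) with candidate cand
    ... | s , k with contains-cycle k
    ...   | w , Z , sub with minimal (false ∷ cyc-edges Z) (suc (Cyc.d Z) , i₀) (cycle-candidate Z (is-edges Z)) sub′
      where
      i₀ = there (∈-cyc⁺ Z (inj₁ refl))
      sub′ : false ∷ cyc-edges Z ⊆ false ∷ C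
      sub′ = s⊆s (λ {e} i → sub e (∈-cyc⁻ Z i))
    ...     | eq with ∷-injective eq
    ...       | _ , refl = isCycle Z (is-edges Z)
    from : IsCycle G C → Circuit (contract L zero) (false ∷ C)
    from (Y , ce) with toCyc Y ce
    ... | Z , is , _ = (suc (Cyc.d Z) , there (proj₂ is _ (inj₁ refl))) , cycle-candidate Z is , minimal
      where
      minimal : ∀ D′ → Nonempty D′ → ∃[ C′ ] (K C′ × D′ ≡ C′ - zero) → D′ ⊆ false ∷ C → D′ ≡ false ∷ C
      minimal (true ∷ D′) _ _ sub with sub here
      ... | ()
      minimal (false ∷ D′) _ cand sub with candidate cand
      ... | s , k = cong (false ∷_) (⊆-antisym (drop-∷-⊆ sub)
        (λ {e} i → all-of-cycle k Z (λ g j → proj₁ is g (drop-∷-⊆ sub j)) e (proj₁ is e i)))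

-- From the matroid to its lift data

∣p∪q∣≤∣p∣+∣q∣ : ∀ {n} (p q : Subset n) → ∣ p ∪ q ∣ ≤ ∣ p ∣ + ∣ q ∣
∣p∪q∣≤∣p∣+∣q∣ [] [] = z≤n
∣p∪q∣≤∣p∣+∣q∣ (true ∷ p) (true ∷ q) =
  s≤s (ℕₚ.≤-trans (∣p∪q∣≤∣p∣+∣q∣ p q) (ℕₚ.+-monoʳ-≤ ∣ p ∣ (ℕₚ.n≤1+n _)))
∣p∪q∣≤∣p∣+∣q∣ (true ∷ p) (false ∷ q) = s≤s (∣p∪q∣≤∣p∣+∣q∣ p q)
∣p∪q∣≤∣p∣+∣q∣ (false ∷ p) (true ∷ q) =
  subst (suc ∣ p ∪ q ∣ ≤_) (sym (ℕₚ.+-suc ∣ p ∣ ∣ q ∣)) (s≤s (∣p∪q∣≤∣p∣+∣q∣ p q))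
∣p∪q∣≤∣p∣+∣q∣ (false ∷ p) (false ∷ q) = ∣p∪q∣≤∣p∣+∣q∣ p q

pair-card : ∀ {n} {C : Subset n} a b → (∀ z → z ∈ C → z ≡ a ⊎ z ≡ b) → ∣ C ∣ ≤ 2
pair-card {C = C} a b h = ℕₚ.≤-trans (p⊆q⇒∣p∣≤∣q∣ sub) (ℕₚ.≤-trans (∣p∪q∣≤∣p∣+∣q∣ ⁅ a ⁆ ⁅ b ⁆)
  (ℕₚ.≤-reflexive (cong₂ _+_ (∣⁅x⁆∣≡1 a) (∣⁅x⁆∣≡1 b))))
  where
  sub : C ⊆ ⁅ a ⁆ ∪ ⁅ b ⁆
  sub {z} i with h z i
  ... | inj₁ refl = x∈p∪q⁺ (inj₁ (x∈⁅x⁆ z))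
  ... | inj₂ refl = x∈p∪q⁺ (inj₂ (x∈⁅x⁆ z))

-- The ground set may be a proper part of `Fin (size M)`. It is renumbered as `Fin (suc m)` with x
-- at index zero, the place of e₀ in `IsoLGPlus`.
module Transport (M : CircuitSys) (isM : IsMatroid M) (simpleM : Simple M)
                 (x : Fin (size M)) (x∈ : x ∈ ground M) where

  open IsMatroid isM

  small : ∀ {C} a b → Circuit M C → ¬ (∀ z → z ∈ C → z ≡ a ⊎ z ≡ b)
  small a b c h = ℕₚ.<⇒≱ (simpleM _ c) (pair-card a b h)

  abstract
    Rest : Subset (size M)
    Rest = ground M - x

    Rest-≡ : Rest ≡ ground M - x
    Rest-≡ = refl

  rest⁻ : ∀ {y} → y ∈ Rest → y ∈ ground M - x
  rest⁻ {y} = subst (y ∈_) Rest-≡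

  rest⁺ : ∀ {y} → y ∈ ground M - x → y ∈ Rest
  rest⁺ {y} = subst (y ∈_) (sym Rest-≡)

  m : ℕ
  m = ∣ Rest ∣

  open Enum (enum Rest)

  rest-ground : ∀ {y} → y ∈ Rest → y ∈ ground M
  rest-ground i = proj₁ (∈-remove⁻ {p = ground M} (rest⁻ i))

  rest-≢ : ∀ {y} → y ∈ Rest → y ≢ x
  rest-≢ i = proj₂ (∈-remove⁻ {p = ground M} (rest⁻ i))

  ι : Fin (suc m) → Fin (size M)
  ι zero = x
  ι (suc i) = elt i

  to : Fin (size M) → Fin (suc m)
  to y with y ∈? Rest
  ... | yes p = suc (idx p)
  -- Elements outside the ground set are sent here along with x; `img` discards them by intersecting
  -- with the ground set.
  ... | no _ = zero

  ι-ground : ∀ i → ι i ∈ ground M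
  ι-ground zero = x∈
  ι-ground (suc i) = rest-ground (elt-∈ i)

  ι-inj : ∀ {i j} → ι i ≡ ι j → i ≡ j
  ι-inj {zero} {zero} eq = refl
  ι-inj {zero} {suc j} eq = ⊥-elim (rest-≢ (elt-∈ j) (sym eq))
  ι-inj {suc i} {zero} eq = ⊥-elim (rest-≢ (elt-∈ i) eq)
  ι-inj {suc i} {suc j} eq = cong suc (elt-inj eq)

  ι-to : ∀ {y} → y ∈ ground M → ι (to y) ≡ y
  ι-to {y} y∈ with y ∈? Rest
  ... | yes p = elt-idx p
  ... | no ∉ with x Finₚ.≟ y
  ...   | yes eq = eq
  ...   | no ne = ⊥-elim (∉ (rest⁺ (x∈p∧x≢y⇒x∈p-y y∈ (≢-sym ne))))

  to-ι : ∀ i → to (ι i) ≡ i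
  to-ι i = ι-inj (ι-to (ι-ground i))

  abstract
    img : Subset (suc m) → Subset (size M)
    img D = preimage to D ∩ ground M

    ∈-img⁺ : ∀ {D i} → i ∈ D → ι i ∈ img D
    ∈-img⁺ {D} {i} i∈ = x∈p∩q⁺ (∈-preimage⁺ (subst (_∈ D) (sym (to-ι i)) i∈) , ι-ground i)

    img-ground : ∀ {D y} → y ∈ img D → y ∈ ground M
    img-ground {D} i = proj₂ (x∈p∩q⁻ (preimage to D) (ground M) i)

    ∈-img-to : ∀ {D y} → y ∈ img D → to y ∈ D
    ∈-img-to {D} i = ∈-preimage⁻ (proj₁ (x∈p∩q⁻ (preimage to D) (ground M) i))

    img-≡ : ∀ D → img D ≡ preimage to D ∩ ground M
    img-≡ D = refl

  ∈-img⁻ : ∀ {D i} → ι i ∈ img D → i ∈ D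
  ∈-img⁻ {D} {i} h = subst (_∈ D) (to-ι i) (∈-img-to h)

  img-elt : ∀ {D y} → y ∈ img D → ∃[ i ] (i ∈ D × ι i ≡ y)
  img-elt {y = y} h = to y , ∈-img-to h , ι-to (img-ground h)

  pull : Subset (size M) → Subset (suc m)
  pull C = preimage ι C

  ∈-pull⁻ : ∀ {C i} → i ∈ pull C → ι i ∈ C
  ∈-pull⁻ = ∈-preimage⁻ {f = ι}

  ∈-pull⁺ : ∀ {C i} → ι i ∈ C → i ∈ pull C
  ∈-pull⁺ = ∈-preimage⁺ {f = ι}

  img-pull : ∀ {C} → C ⊆ ground M → img (pull C) ≡ C
  img-pull {C} sub = ⊆-antisym
    (λ h → subst (_∈ C) (ι-to (img-ground h)) (∈-pull⁻ (∈-img-to h)))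
    (λ {y} h → subst (_∈ img (pull C)) (ι-to (sub h))
      (∈-img⁺ {i = to y} (∈-pull⁺ (subst (_∈ C) (sym (ι-to (sub h))) h))))

  K : Subset (suc m) → Set
  K D = Circuit M (img D)

  K-pull : ∀ {C} → Circuit M C → K (pull C)
  K-pull c = subst (Circuit M) (sym (img-pull (circ-ground _ c))) c

  img-mono : ∀ {C D} → C ⊆ D → img C ⊆ img D
  img-mono {C} {D} sub h with img-elt h
  ... | i , i∈ , refl = ∈-img⁺ (sub i∈)

  circuits : Circuits K
  circuits = record { nonempty = ne ; incomp = inc ; elim = el }
    where
    ne : ∀ {C} → K C → Nonempty C
    ne k with circ-nonempty _ k
    ... | y , h = to y , ∈-img-to h
    inc : ∀ {C D} → K C → K D → C ⊆ D → D ⊆ C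
    inc {C} {D} kC kD sub {i} i∈ = ∈-img⁻ (subst (ι i ∈_) (sym (circ-incomp _ _ kC kD (img-mono sub))) (∈-img⁺ i∈))
    el : ∀ {C D e f} → K C → K D → e ∈ C → e ∈ D → f ∈ C → f ∉ D →
         ∃[ C′ ] (K C′ × (∀ {y} → y ∈ C′ → y ≢ e × (y ∈ C ⊎ y ∈ D)))
    el {C} {D} {e} {f} kC kD eC eD fC f∉
      with circ-elim (img C) (img D) (ι e) kC kD (λ eq → f∉ (∈-img⁻ (subst (ι f ∈_) eq (∈-img⁺ fC)))) (∈-img⁺ eC) (∈-img⁺ eD)
    ... | C′ , k , sub = pull C′ , K-pull k , bound
      where
      bound : ∀ {y} → y ∈ pull C′ → y ≢ e × (y ∈ C ⊎ y ∈ D)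
      bound {y} h with ∈-remove⁻ {p = img C ∪ img D} (sub (∈-pull⁻ h))
      ... | u , ne = (λ { refl → ne refl }) , Sum.map ∈-img⁻ ∈-img⁻ (∈-∪⁻ u)

  open Pointed K circuits public

  K-small : ∀ {C} i j → K C → ¬ (∀ z → z ∈ C → z ≡ i ⊎ z ≡ j)
  K-small i j k h = small (ι i) (ι j) k bound
    where
    bound : ∀ z → z ∈ img _ → z ≡ ι i ⊎ z ≡ ι j
    bound z zi with img-elt zi
    ... | l , l∈ , refl with h l l∈
    ...   | inj₁ refl = inj₁ refl
    ...   | inj₂ refl = inj₂ refl

  nonloop : ∀ {y} → y ∈ Rest → NonLoop (contract M x) y
  nonloop {y} y∈ = rest⁻ y∈ , λ { (_ , (C , c , eq) , _) → small x y c λ z z∈ → near C eq z z∈ }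
    where
    near : ∀ C → ⁅ y ⁆ ≡ C - x → ∀ z → z ∈ C → z ≡ x ⊎ z ≡ y
    near C eq z z∈ with z Finₚ.≟ x
    ... | yes e = inj₁ e
    ... | no ne = inj₂ (∈-⁅⁆⁻ (subst (z ∈_) (sym eq) (x∈p∧x≢y⇒x∈p-y z∈ ne)))

  img-remove : ∀ s C → img (s ∷ C) - x ≡ img (false ∷ C)
  img-remove s C = ⊆-antisym to′ from′
    where
    to′ : img (s ∷ C) - x ⊆ img (false ∷ C)
    to′ h with ∈-remove⁻ {p = img (s ∷ C)} h
    ... | h′ , ne with img-elt h′
    ...   | zero , _ , refl = ⊥-elim (ne refl)
    ...   | suc i , there i∈ , refl = ∈-img⁺ (there i∈)
    from′ : img (false ∷ C) ⊆ img (s ∷ C) - x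
    from′ h with img-elt h
    ... | suc i , there i∈ , refl = x∈p∧x≢y⇒x∈p-y (∈-img⁺ (there i∈)) (rest-≢ (elt-∈ i))

  contract-in : ∀ {C} → K (true ∷ C) → Circuit (contract M x) (img (false ∷ C))
  contract-in {C} k = ne , (img (true ∷ C) , k , sym (img-remove true C)) , minimal
    where
    ne : Nonempty (img (false ∷ C))
    ne with nonempty? (img (false ∷ C))
    ... | yes h = h
    ... | no e = ⊥-elim (K-small zero zero k λ { zero _ → inj₁ refl ; (suc i) (there h) → ⊥-elim (e (_ , ∈-img⁺ (there h))) })
    minimal : ∀ D → Nonempty D → ∃[ C₁ ] (Circuit M C₁ × D ≡ C₁ - x) → D ⊆ img (false ∷ C) → D ≡ img (false ∷ C)
    minimal D _ (C₁ , c₁ , refl) sub = trans (cong (_- x) (circ-incomp _ _ c₁ k big)) (img-remove true C)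
      where
      big : C₁ ⊆ img (true ∷ C)
      big {z} z∈ with z Finₚ.≟ x
      ... | yes refl = ∈-img⁺ {i = zero} here
      ... | no ne′ = img-mono {D = true ∷ C} (out⊆ (λ i → i)) (sub (x∈p∧x≢y⇒x∈p-y z∈ ne′))

  -- The assumption excludes traces of circuits through x, so any candidate below comes from a
  -- circuit avoiding x, to which incomparability applies.
  contract-out : ∀ {C} → K (false ∷ C) → (∀ {C′} → K (true ∷ C′) → ¬ (C′ ⊆ C)) →
                 Circuit (contract M x) (img (false ∷ C))
  contract-out {C} k none = circ-nonempty _ k , (img (false ∷ C) , k , sym (img-remove false C)) , minimal
    where
    minimal : ∀ D → Nonempty D → ∃[ C₁ ] (Circuit M C₁ × D ≡ C₁ - x) → D ⊆ img (false ∷ C) → D ≡ img (false ∷ C)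
    minimal D _ (C₁ , c₁ , refl) sub with K-pull c₁ | img-pull (circ-ground _ c₁)
    ... | k₁ | eq with pull C₁
    ...   | true ∷ C′ = ⊥-elim (none k₁ λ {i} i∈ → drop-there (∈-img⁻ (sub (x∈p∧x≢y⇒x∈p-y
                (subst (ι (suc i) ∈_) eq (∈-img⁺ (there i∈))) (rest-≢ (elt-∈ i))))))
    ...   | false ∷ C′ = trans (cong (_- x) (circ-incomp _ _ c₁ k big)) (img-remove false C)
      where
      big : C₁ ⊆ img (false ∷ C)
      big {z} z∈ with img-elt (subst (z ∈_) (sym eq) z∈)
      ... | suc i , there i∈ , refl = sub (x∈p∧x≢y⇒x∈p-y z∈ (rest-≢ (elt-∈ i)))

  contract-circuit : ∀ {D} → Circuit (contract M x) D → ∃[ s ] ∃[ C ] (K (s ∷ C) × D ≡ img (false ∷ C))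
  contract-circuit (_ , (C₁ , c₁ , refl) , _) with K-pull c₁ | img-pull (circ-ground _ c₁)
  ... | k₁ | eq with pull C₁
  ...   | s ∷ C = s , C , k₁ , trans (cong (_- x) (sym eq)) (img-remove s C)

-- ρ picks representatives of the parallel classes of the contraction by x; a circuit meeting a
-- cut in one edge can be pushed onto representatives without losing that property.
module CutReduction {n} (G : Graph n) (loopless : ∀ e → tail G e ≢ head G e)
  (K : Subset (suc (nE G)) → Set) (circuits : Circuits K)
  (an-edge : ∀ {s C} → K (s ∷ C) → Nonempty C)
  (ρ : Fin (nE G) → Fin (nE G)) (ρ-idem : ∀ e → ρ (ρ e) ≡ ρ e)
  (ρ-line : ∀ e → e ≢ ρ e → Pointed.IsC K circuits true (λ g → g ≡ e ⊎ g ≡ ρ e))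
  (ρ-crosses⁺ : ∀ {A e} → Walks.Crosses G loopless A e → Walks.Crosses G loopless A (ρ e))
  (ρ-crosses⁻ : ∀ {A e} → Walks.Crosses G loopless A (ρ e) → Walks.Crosses G loopless A e)
  (rep-cuts-x : ∀ {C} → K (true ∷ C) → (∀ e → e ∈ C → e ≡ ρ e) → Walks.Cuts G loopless C)
  (rep-cuts : ∀ {C} → K (false ∷ C) → (∀ {C′} → K (true ∷ C′) → ¬ (C′ ⊆ C)) → (∀ e → e ∈ C → e ≡ ρ e) →
              Walks.Cuts G loopless C)
  where

  open Walks G loopless
  open Pointed K circuits

  module _ (A : Subset n) where

    Lone : E → Subset (nE G) → Set
    Lone e C = e ∈ C × Crosses A e × (∀ f → f ∈ C → Crosses A f → f ≡ e)

    Reduced : ℕ → Subset (nE G) → Set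
    Reduced k C = ∀ j → j ∈ C → toℕ j ℕ.< k → j ≡ ρ j

    -- The edge j of index k gives way to r = ρ j by elimination with {x , j , r}. Both cross the
    -- same cuts. If j is not the lone edge, neither crosses A and e can be retained; if it is, r is
    -- retained and becomes the lone edge.
    replace : ∀ {s C e} k (lt : k ℕ.< nE G) → K (s ∷ C) → Lone e C → Reduced k C →
              ∃[ s′ ] ∃[ C′ ] ∃[ e′ ] (K (s′ ∷ C′) × Lone e′ C′ × Reduced (suc k) C′)
    replace {s} {C} {e} k lt kC lone@(e∈ , ce , only) red = go (j ∈? C) (j Finₚ.≟ r)
      where
      j = fromℕ< lt
      r = ρ j
      j-k : toℕ j ≡ k
      j-k = Finₚ.toℕ-fromℕ< lt
      Goal = ∃[ s′ ] ∃[ C′ ] ∃[ e′ ] (K (s′ ∷ C′) × Lone e′ C′ × Reduced (suc k) C′)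
      upto : ∀ {C′} → (∀ i → i ∈ C′ → i ≢ j → toℕ i ℕ.< k → i ≡ ρ i) → (j ∈ C′ → j ≡ r) → Reduced (suc k) C′
      upto h hj i i∈ (s≤s le) with i Finₚ.≟ j
      ... | yes refl = hj i∈
      ... | no ne = h i i∈ ne (ℕₚ.≤∧≢⇒< le (λ eq → ne (Finₚ.toℕ-injective (trans eq (sym j-k)))))
      r-rep : r ≡ ρ r
      r-rep = sym (ρ-idem j)
      go : Dec (j ∈ C) → Dec (j ≡ r) → Goal
      go (no j∉) _ = s , C , e , kC , lone , upto (λ i i∈ _ lt′ → red i i∈ lt′) (λ j∈ → ⊥-elim (j∉ j∈))
      go (yes _) (yes jr) = s , C , e , kC , lone , upto (λ i i∈ _ lt′ → red i i∈ lt′) (λ _ → jr)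
      go (yes j∈) (no j≢r) with ρ-line j j≢r
      ... | C₁ , k₁ , to₁ , from₁ = swap (j Finₚ.≟ e)
        where
        reduced : ∀ {C′} → (∀ g → g ∈ C′ → g ≢ j × (g ∈ C ⊎ g ∈ C₁)) → Reduced (suc k) C′
        reduced {C′} bound = upto old (λ h → ⊥-elim (proj₁ (bound j h) refl))
          where
          old : ∀ i → i ∈ C′ → i ≢ j → toℕ i ℕ.< k → i ≡ ρ i
          old i i∈ ne lt′ with proj₂ (bound i i∈)
          ... | inj₁ c = red i c lt′
          ... | inj₂ c with to₁ i c
          ...   | inj₁ eq = ⊥-elim (ne eq)
          ...   | inj₂ refl = r-rep
        swap : Dec (j ≡ e) → Goal
        swap (no j≢e) with elim-edge kC k₁ j∈ (from₁ j (inj₁ refl)) e∈ e∉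
          where
          e∉ : e ∉ C₁
          e∉ h with to₁ e h
          ... | inj₁ eq = j≢e (sym eq)
          ... | inj₂ refl = j≢e (only j j∈ (ρ-crosses⁻ {A} ce))
        ... | s′ , C′ , k′ , e∈′ , bound = s′ , C′ , e , k′ , (e∈′ , ce , only′) , reduced bound
          where
          only′ : ∀ f → f ∈ C′ → Crosses A f → f ≡ e
          only′ f f∈ cf with bound f f∈
          ... | ne , inj₁ c = only f c cf
          ... | ne , inj₂ c with to₁ f c
          ...   | inj₁ eq = ⊥-elim (ne eq)
          ...   | inj₂ refl = ⊥-elim (j≢e (only j j∈ (ρ-crosses⁻ {A} cf)))
        swap (yes refl) with elim-edge k₁ kC (from₁ j (inj₁ refl)) j∈ (from₁ r (inj₂ refl)) r∉
          where
          r∉ : r ∉ C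
          r∉ h = j≢r (sym (only r h (ρ-crosses⁺ {A} ce)))
        ... | s′ , C′ , k′ , r∈′ , bound =
          s′ , C′ , r , k′ , (r∈′ , ρ-crosses⁺ {A} ce , only′) ,
          reduced (λ g h → proj₁ (bound g h) , Sum.swap (proj₂ (bound g h)))
          where
          only′ : ∀ f → f ∈ C′ → Crosses A f → f ≡ r
          only′ f f∈ cf with bound f f∈
          ... | ne , inj₂ c = ⊥-elim (ne (only f c cf))
          ... | ne , inj₁ c with to₁ f c
          ...   | inj₁ eq = ⊥-elim (ne eq)
          ...   | inj₂ eq = eq

    reduce : ∀ {s C e} k → k ≤ nE G → K (s ∷ C) → Lone e C →
             ∃[ s′ ] ∃[ C′ ] ∃[ e′ ] (K (s′ ∷ C′) × Lone e′ C′ × Reduced k C′)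
    reduce zero le k lone = _ , _ , _ , k , lone , λ j _ ()
    reduce (suc i) le k lone with reduce i (ℕₚ.≤-trans (ℕₚ.n≤1+n i) le) k lone
    ... | s′ , C′ , e′ , k′ , lone′ , red = replace i le k′ lone′ red

    -- Among representatives `rep-cuts-x` applies at once, but `rep-cuts` also needs that no circuit
    -- through x has its edges inside C. The edges C′ of such a circuit would miss e; eliminating an
    -- edge y of C′ while retaining e leaves a circuit through x and e, or an x-free circuit inside
    -- C without y. Both are impossible.
    lone-absurd : ∀ {s C e} → K (s ∷ C) → Lone e C → Void
    lone-absurd kC lone with reduce (nE G) ℕₚ.≤-refl kC lone
    ... | s , C , e , k , lone′@(e∈ , ce , only) , red = flag s k
      where
      reps : ∀ j → j ∈ C → j ≡ ρ j
      reps j j∈ = red j j∈ (Finₚ.toℕ<n j)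
      with-x : ∀ {C′} → K (true ∷ C′) → C′ ⊆ C → e ∉ C′
      with-x k′ sub e∈′ with rep-cuts-x k′ (λ j j∈ → reps j (sub j∈)) A e e∈′ ce
      ... | f , f∈ , ne , cf = ne (only f (sub f∈) cf)
      without-x : K (false ∷ C) → ∀ {C′} → K (true ∷ C′) → ¬ (C′ ⊆ C)
      without-x k {C′} k′ sub with nonempty? C′
      ... | no none = none (an-edge k′)
      ... | yes (y , y∈) with elim-edge k k′ (sub y∈) y∈ e∈ (with-x k′ sub)
      ...   | s″ , C″ , k″ , e∈″ , bound = last s″ k″
        where
        sub″ : C″ ⊆ C
        sub″ {g} h with bound g h
        ... | _ , inj₁ c = c
        ... | _ , inj₂ c = sub c
        last : ∀ s″ → K (s″ ∷ C″) → Void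
        last true k″ = with-x k″ sub″ e∈″
        last false k″ = proj₁ (bound y (incomp k″ k sub″ (sub y∈))) refl
      flag : ∀ s → K (s ∷ C) → Void
      flag true k = with-x k (λ h → h) e∈
      flag false k with rep-cuts k (without-x k) reps A e e∈ ce
      ... | f , f∈ , ne , cf = ne (only f f∈ cf)

  cuts : ∀ {s C} → K (s ∷ C) → Cuts C
  cuts {s} {C} k A e e∈ cr with find (λ f → (f ∈? C) ×-dec (¬? (f Finₚ.≟ e) ×-dec Crosses? A f))
  ... | inj₁ r = r
  ... | inj₂ none = ⊥-elim (lone-absurd A k (e∈ , cr , only))
    where
    only : ∀ f → f ∈ C → Crosses A f → f ≡ e
    only f f∈ cf with f Finₚ.≟ e
    ... | yes eq = eq
    ... | no ne = ⊥-elim (none f (f∈ , ne , cf))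

record Hypotheses (n t : ℕ) : Set₁ where
  field
    M        : CircuitSys
    isM      : IsMatroid M
    simpleM  : Simple M
    x        : Fin (size M)
    x∈       : x ∈ ground M
    S        : Subset (size M)
    isS      : IsSimplificationSet (contract M x) S
    G₀       : Graph (4 + n)
    complete : IsComplete G₀
    iso      : restrict (contract M x) S ≅ cycleSys G₀
    classes  : ParallelClassesOfSize (contract M x) t
    no-U     : ¬ (∃[ e ] (e ∈ ground M × HasURestriction (contract M e) 2 (2 + t)))

module Build {n t : ℕ} (H : Hypotheses n t) where

  open Hypotheses H
  open Transport M isM simpleM x x∈ public
  open Enum (enum Rest)
  module I = _≅_ iso

  N : CircuitSys
  N = contract M x

  loopless₀ : ∀ e → tail G₀ e ≢ head G₀ e
  loopless₀ = proj₁ complete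

  module W₀ = Walks G₀ loopless₀

  E₀ : Set
  E₀ = Fin (nE G₀)

  S⊆Rest : S ⊆ Rest
  S⊆Rest i = rest⁺ (proj₁ isS i)

  from-S : ∀ g → I.from g ∈ S
  from-S g = I.from-gr g ∈⊤

  abstract
    rep : E₀ → Fin m
    rep g = idx (S⊆Rest (from-S g))

    elt-rep : ∀ g → elt (rep g) ≡ I.from g
    elt-rep g = elt-idx (S⊆Rest (from-S g))

    para : ∀ i → ∃[ s ] (s ∈ S × Parallel N (elt i) s)
    para i = proj₁ (proj₂ (proj₂ isS)) (elt i) (nonloop (elt-∈ i))

    -- The edge of `G₀` that stands for the parallel class of i. With `rep` as a section,
    -- `rep (κ i)` is the chosen representative of this class.
    κ : Fin m → E₀
    κ i = I.to (proj₁ (para i))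

    κ-rep : ∀ g → κ (rep g) ≡ g
    κ-rep g with para (rep g)
    ... | s , s∈ , p = trans (cong I.to (sym eq)) (I.to-from g ∈⊤)
      where
      eq : I.from g ≡ s
      eq = proj₂ (proj₂ (proj₂ isS)) _ _ (from-S g) s∈ (subst (λ y → Parallel N y s) (elt-rep g) p)

    elt-rep-κ : ∀ i → Parallel N (elt i) (elt (rep (κ i)))
    elt-rep-κ i with para i
    ... | s , s∈ , p = subst (Parallel N (elt i)) (sym (trans (elt-rep _) (I.from-to s s∈))) p

  pair-set : ∀ {C i j} → (∀ g → g ∈ C → g ≡ i ⊎ g ≡ j) → (∀ g → g ≡ i ⊎ g ≡ j → g ∈ C) →
             ⁅ elt i ⁆ ∪ ⁅ elt j ⁆ ≡ img (false ∷ C)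
  pair-set {C} {i} {j} to′ from′ = ⊆-antisym there′ back
    where
    there′ : ⁅ elt i ⁆ ∪ ⁅ elt j ⁆ ⊆ img (false ∷ C)
    there′ h with ∈-∪⁻ h
    ... | inj₁ a = subst (_∈ img _) (sym (∈-⁅⁆⁻ a)) (∈-img⁺ {i = suc i} (there (from′ i (inj₁ refl))))
    ... | inj₂ a = subst (_∈ img _) (sym (∈-⁅⁆⁻ a)) (∈-img⁺ {i = suc j} (there (from′ j (inj₂ refl))))
    back : img (false ∷ C) ⊆ ⁅ elt i ⁆ ∪ ⁅ elt j ⁆
    back h with img-elt h
    ... | suc g , there g∈ , refl with to′ g g∈
    ...   | inj₁ refl = x∈p∪q⁺ (inj₁ (x∈⁅x⁆ _))
    ...   | inj₂ refl = x∈p∪q⁺ (inj₂ (x∈⁅x⁆ _))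

  -- The two-element circuit of the contraction comes from a circuit of M, and since M is simple
  -- that circuit must contain x.
  parallel⇒line : ∀ {i j} → Parallel N (elt i) (elt j) → i ≢ j → IsC true (λ g → g ≡ i ⊎ g ≡ j)
  parallel⇒line (_ , _ , inj₁ eq) ne = ⊥-elim (ne (elt-inj eq))
  parallel⇒line {i} {j} (_ , _ , inj₂ (_ , c)) ne with contract-circuit c
  ... | s , C , k , eq = flag s k
    where
    only : ∀ g → g ∈ C → g ≡ i ⊎ g ≡ j
    only g g∈ with ∈-∪⁻ (subst (elt g ∈_) (sym eq) (∈-img⁺ {i = suc g} (there g∈)))
    ... | inj₁ a = inj₁ (elt-inj (∈-⁅⁆⁻ a))
    ... | inj₂ a = inj₂ (elt-inj (∈-⁅⁆⁻ a))
    all : ∀ g → g ≡ i ⊎ g ≡ j → g ∈ C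
    all g (inj₁ refl) = drop-there (∈-img⁻ {i = suc g} (subst (elt g ∈_) eq (x∈p∪q⁺ (inj₁ (x∈⁅x⁆ _)))))
    all g (inj₂ refl) = drop-there (∈-img⁻ {i = suc g} (subst (elt g ∈_) eq (x∈p∪q⁺ (inj₂ (x∈⁅x⁆ _)))))
    flag : ∀ s → K (s ∷ C) → IsC true (λ g → g ≡ i ⊎ g ≡ j)
    flag true k = C , k , only , all
    flag false k = ⊥-elim (K-small (suc i) (suc j) k λ { (suc g) (there g∈) → Sum.map (cong suc) (cong suc) (only g g∈) })

  line⇒parallel : ∀ {i j} → i ≢ j → IsC true (λ g → g ≡ i ⊎ g ≡ j) → Parallel N (elt i) (elt j)
  line⇒parallel ne (C , k , to′ , from′) = nonloop (elt-∈ _) , nonloop (elt-∈ _) ,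
    inj₂ ((λ eq → ne (elt-inj eq)) , subst (Circuit N) (sym (pair-set to′ from′)) (contract-in k))

  rep-line : ∀ i → i ≢ rep (κ i) → IsC true (λ g → g ≡ i ⊎ g ≡ rep (κ i))
  rep-line i ne = parallel⇒line (elt-rep-κ i) ne

  -- Elements i and j are both parallel to the representative. Eliminating the latter leaves a
  -- circuit within {x , i , j}, which cannot be smaller since M is simple.
  same-class : ∀ {i j} → κ i ≡ κ j → i ≢ j → IsC true (λ g → g ≡ i ⊎ g ≡ j)
  same-class {i} {j} eq ne with i Finₚ.≟ rep (κ i) | j Finₚ.≟ rep (κ i)
  ... | yes p | yes q = ⊥-elim (ne (trans p (sym q)))
  ... | no p | yes q = subst (λ z → IsC true (λ g → g ≡ i ⊎ g ≡ z)) (sym q) (rep-line i p)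
  ... | yes p | no q = subst (λ z → IsC true (λ g → g ≡ z ⊎ g ≡ j)) (trans (cong rep (sym eq)) (sym p))
        (IsC-map (λ _ → Sum.swap) (λ _ → Sum.swap)
          (rep-line j λ e → q (trans e (cong rep (sym eq)))))
  ... | no p | no q with rep-line i p | rep-line j (λ e → q (trans e (cong rep (sym eq))))
  ...   | C₁ , k₁ , to₁ , from₁ | C₂ , k₂ , to₂ , from₂
    with elim-edge k₁ k₂ (from₁ _ (inj₂ refl)) (from₂ _ (inj₂ (cong rep eq))) (from₁ i (inj₁ refl)) i∉
    where
    i∉ : i ∉ C₂
    i∉ h with to₂ i h
    ... | inj₁ e = ne e
    ... | inj₂ e = p (trans e (cong rep (sym eq)))
  ...     | s , C , k , i∈ , bound = flag s k
    where
    only : ∀ g → g ∈ C → g ≡ i ⊎ g ≡ j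
    only g h with bound g h
    ... | ne′ , inj₁ a with to₁ g a
    ...   | inj₁ e = inj₁ e
    ...   | inj₂ e = ⊥-elim (ne′ e)
    only g h | ne′ , inj₂ a with to₂ g a
    ...   | inj₁ e = inj₂ e
    ...   | inj₂ e = ⊥-elim (ne′ (trans e (cong rep (sym eq))))
    flag : ∀ s → K (s ∷ C) → IsC true (λ g → g ≡ i ⊎ g ≡ j)
    flag false k = ⊥-elim (K-small (suc i) (suc j) k λ { (suc g) (there h) → Sum.map (cong suc) (cong suc) (only g h) })
    flag true k with j ∈? C
    ... | yes j∈ = C , k , only , λ { g (inj₁ refl) → i∈ ; g (inj₂ refl) → j∈ }
    ... | no j∉ = ⊥-elim (K-small zero (suc i) k bound′)
      where
      bound′ : ∀ z → z ∈ true ∷ C → z ≡ zero ⊎ z ≡ suc i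
      bound′ zero _ = inj₁ refl
      bound′ (suc g) (there h) with only g h
      ... | inj₁ e = inj₂ (cong suc e)
      ... | inj₂ refl = ⊥-elim (j∉ h)

  abstract
    -- The orientation of `G₀` is arbitrary; it is replaced by the increasing one, which depends
    -- only on the pair of ends.
    orient : ∀ g → ∃[ u ] ∃[ v ] (u < v × W₀.J g u v)
    orient g with Finₚ.<-cmp (tail G₀ g) (head G₀ g)
    ... | tri< lt _ _ = _ , _ , lt , W₀.J-self g
    ... | tri≈ _ eq _ = ⊥-elim (loopless₀ g eq)
    ... | tri> _ _ gt = _ , _ , gt , W₀.J-sym (W₀.J-self g)

  G : Graph (4 + n)
  G = record { nE = m ; tail = λ i → proj₁ (orient (κ i)) ; head = λ i → proj₁ (proj₂ (orient (κ i))) }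

  ordered : ∀ i → tail G i < head G i
  ordered i = proj₁ (proj₂ (proj₂ (orient (κ i))))

  loopless : ∀ e → tail G e ≢ head G e
  loopless e = Finₚ.<⇒≢ (ordered e)

  open Walks G loopless

  J₀-self : ∀ i → W₀.J (κ i) (tail G i) (head G i)
  J₀-self i = proj₂ (proj₂ (proj₂ (orient (κ i))))

  J⇒J₀ : ∀ {i u v} → J i u v → W₀.J (κ i) u v
  J⇒J₀ {i} (inj₁ (refl , refl)) = J₀-self i
  J⇒J₀ {i} (inj₂ (refl , refl)) = W₀.J-sym (J₀-self i)

  J₀⇒J : ∀ {i u v} → W₀.J (κ i) u v → J i u v
  J₀⇒J {i} {u} {v} j with W₀.J-ends j (W₀.J-at₁ (J₀-self i)) | W₀.J-ends j (W₀.J-at₂ (J₀-self i))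
  ... | inj₁ a | inj₁ b = ⊥-elim (loopless i (trans a (sym b)))
  ... | inj₁ a | inj₂ b = inj₁ (a , b)
  ... | inj₂ a | inj₁ b = inj₂ (a , b)
  ... | inj₂ a | inj₂ b = ⊥-elim (loopless i (trans a (sym b)))

  unique₀ : ∀ {e f u v} → W₀.J e u v → W₀.J f u v → e ≡ f
  unique₀ p q = proj₂ (proj₂ complete) _ _ (same p q)
    where
    same : ∀ {e f u v} → W₀.J e u v → W₀.J f u v → SameEnds G₀ e f
    same (inj₁ (a , b)) (inj₁ (c , d)) = inj₁ (trans a (sym c) , trans b (sym d))
    same (inj₁ (a , b)) (inj₂ (c , d)) = inj₂ (trans a (sym d) , trans b (sym c))
    same (inj₂ (a , b)) (inj₁ (c , d)) = inj₂ (trans a (sym d) , trans b (sym c))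
    same (inj₂ (a , b)) (inj₂ (c , d)) = inj₁ (trans a (sym c) , trans b (sym d))

  parallel : ∀ {i j e f} → J e i j → J f i j → e ≢ f → IsC true (λ g → g ≡ e ⊎ g ≡ f)
  parallel p q ne = same-class (unique₀ (J⇒J₀ p) (J⇒J₀ q)) ne

  crosses⇒crosses₀ : ∀ {A i} → Crosses A i → W₀.Crosses A (κ i)
  crosses⇒crosses₀ {A} {i} c with crosses-sides (J-self i) c
  ... | inj₁ (a , b) = W₀.crosses-J (J₀-self i) a b
  ... | inj₂ (a , b) = W₀.crosses-J (W₀.J-sym (J₀-self i)) a b

  crosses₀⇒crosses : ∀ {A i} → W₀.Crosses A (κ i) → Crosses A i
  crosses₀⇒crosses {A} {i} c with W₀.crosses-sides (J₀-self i) c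
  ... | inj₁ (a , b) = crosses-J (J-self i) a b
  ... | inj₂ (a , b) = crosses-J (J-sym (J-self i)) a b

  crosses-class : ∀ {A i j} → κ i ≡ κ j → Crosses A i → Crosses A j
  crosses-class {A} eq c = crosses₀⇒crosses (subst (W₀.Crosses A) eq (crosses⇒crosses₀ c))

  private
    -- All elements of the circuit lie in `S`, so the isomorphism makes it a cycle of `G₀`. A second
    -- edge of that cycle in the cut is brought back by `rep`.
    rep-cuts : ∀ {C} → Circuit N (img (false ∷ C)) → (∀ j → j ∈ C → j ≡ rep (κ j)) → Cuts C
    rep-cuts {C} c reps A e e∈ cr with Equivalence.to (I.circ-from (img (false ∷ C)) in-S) (c , in-S)
      where
      in-S : img (false ∷ C) ⊆ S
      in-S h with img-elt h
      ... | suc i , there i∈ , refl =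
        subst (_∈ S) (sym (trans (cong elt (reps i i∈)) (elt-rep (κ i)))) (from-S (κ i))
    ... | Y , ce with W₀.fromCycle Y
    ...   | Z , out , into , _ with W₀.cycle-cuts Z A (κ e) (on-cycle (Equivalence.to (ce (κ e)) e∈D)) (crosses⇒crosses₀ cr)
      where
      on-cycle : ∀ {g} → ∃[ i ] (Cycle.es Y i ≡ g) → g W₀.∈C Z
      on-cycle (i , refl) = into i
      e∈D : κ e ∈ preimage I.from (img (false ∷ C)) ∩ ⊤
      e∈D = x∈p∩q⁺ (∈-preimage⁺ (subst (_∈ img (false ∷ C)) (trans (cong elt (reps e e∈)) (elt-rep (κ e)))
                     (∈-img⁺ {i = suc e} (there e∈))) , ∈⊤)
    ...     | g , gZ , ne , cg = rep g , drop-there (∈-img⁻ {i = suc (rep g)} (subst (_∈ img (false ∷ C)) (sym (elt-rep g)) g∈)) ,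
      (λ eq → ne (trans (sym (κ-rep g)) (cong κ eq))) , crosses₀⇒crosses (subst (W₀.Crosses A) (sym (κ-rep g)) cg)
      where
      g∈ : I.from g ∈ img (false ∷ C)
      g∈ = ∈-preimage⁻ (proj₁ (x∈p∩q⁻ (preimage I.from (img (false ∷ C))) ⊤ (Equivalence.from (ce g) (out gZ))))

  an-edge : ∀ {s C} → K (s ∷ C) → Nonempty C
  an-edge {s} {C} k with nonempty? C
  ... | yes h = h
  ... | no e = ⊥-elim (K-small zero zero k λ { zero _ → inj₁ refl ; (suc g) (there h) → ⊥-elim (e (g , h)) })

  module Reduction = CutReduction G loopless K circuits an-edge (λ i → rep (κ i))
    (λ i → cong rep (κ-rep (κ i))) rep-line
    (λ {A} {e} → crosses-class {A} (sym (κ-rep (κ e)))) (λ {A} {e} → crosses-class {A} (κ-rep (κ e)))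
    (λ k → rep-cuts (contract-in k)) (λ k none → rep-cuts (contract-out k none))

  abstract
    cuts : ∀ {s C} → K (s ∷ C) → Cuts C
    cuts = Reduction.cuts

-- Long lines in a contraction

module _ {n} {P : Fin n → Set} (P? : ∀ i → Dec (P i)) where

  comprehend : Subset n
  comprehend = tabulate (λ i → does (P? i))

  ∈-comprehend⁺ : ∀ {i} → P i → i ∈ comprehend
  ∈-comprehend⁺ {i} p = lookup⇒[]= i _ (trans (lookup∘tabulate (λ i → does (P? i)) i) (dec-true (P? i) p))

  ∈-comprehend⁻ : ∀ {i} → i ∈ comprehend → P i
  ∈-comprehend⁻ {i} h with P? i | trans (sym (lookup∘tabulate (λ i → does (P? i)) i)) ([]=⇒lookup h)
  ... | yes p | _ = p
  ... | no _ | ()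

module _ {b : ℕ} where

  Distinct : Fin b → Fin b → Fin b → Set
  Distinct i j k = i ≢ j × i ≢ k × j ≢ k

  Within : Subset b → Fin b → Fin b → Fin b → Set
  Within D i j k = ∀ z → z ∈ D → z ≡ i ⊎ z ≡ j ⊎ z ≡ k

  card-3 : ∀ {D i j k} → Distinct i j k → i ∈ D → j ∈ D → k ∈ D → Within D i j k → ∣ D ∣ ≡ 3
  card-3 {D} {i} {j} {k} (ij , ik , jk) i∈ j∈ k∈ w = ℕₚ.≤-antisym upper lower
    where
    sub : D ⊆ ⁅ i ⁆ ∪ (⁅ j ⁆ ∪ ⁅ k ⁆)
    sub {z} h with w z h
    ... | inj₁ refl = x∈p∪q⁺ (inj₁ (x∈⁅x⁆ z))
    ... | inj₂ (inj₁ refl) = x∈p∪q⁺ (inj₂ (x∈p∪q⁺ (inj₁ (x∈⁅x⁆ z))))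
    ... | inj₂ (inj₂ refl) = x∈p∪q⁺ (inj₂ (x∈p∪q⁺ (inj₂ (x∈⁅x⁆ z))))
    upper : ∣ D ∣ ≤ 3
    upper = ℕₚ.≤-trans (p⊆q⇒∣p∣≤∣q∣ sub) (ℕₚ.≤-trans (∣p∪q∣≤∣p∣+∣q∣ ⁅ i ⁆ _)
      (ℕₚ.+-mono-≤ (ℕₚ.≤-reflexive (∣⁅x⁆∣≡1 i)) (ℕₚ.≤-trans (∣p∪q∣≤∣p∣+∣q∣ ⁅ j ⁆ _)
        (ℕₚ.+-mono-≤ (ℕₚ.≤-reflexive (∣⁅x⁆∣≡1 j)) (ℕₚ.≤-reflexive (∣⁅x⁆∣≡1 k))))))
    open Enum (enum D)
    place : Fin 3 → Fin ∣ D ∣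
    place zero = idx i∈
    place (suc zero) = idx j∈
    place (suc (suc zero)) = idx k∈
    clash : ∀ {y z} (p : y ∈ D) (q : z ∈ D) → idx p ≡ idx q → y ≡ z
    clash p q eq = trans (sym (elt-idx p)) (trans (cong elt eq) (elt-idx q))
    place-inj : Injective _≡_ _≡_ place
    place-inj {zero} {zero} eq = refl
    place-inj {zero} {suc zero} eq = ⊥-elim (ij (clash i∈ j∈ eq))
    place-inj {zero} {suc (suc zero)} eq = ⊥-elim (ik (clash i∈ k∈ eq))
    place-inj {suc zero} {zero} eq = ⊥-elim (ij (sym (clash j∈ i∈ eq)))
    place-inj {suc zero} {suc zero} eq = refl
    place-inj {suc zero} {suc (suc zero)} eq = ⊥-elim (jk (clash j∈ k∈ eq))
    place-inj {suc (suc zero)} {zero} eq = ⊥-elim (ik (sym (clash k∈ i∈ eq)))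
    place-inj {suc (suc zero)} {suc zero} eq = ⊥-elim (jk (sym (clash k∈ j∈ eq)))
    place-inj {suc (suc zero)} {suc (suc zero)} eq = refl
    lower : 3 ≤ ∣ D ∣
    lower = Finₚ.injective⇒≤ place-inj

  -- The surplus c lets one statement serve sets of exactly three elements and larger sets, in which
  -- the three are merely some elements.
  three-of : ∀ D {c} → ∣ D ∣ ≡ 3 + c →
             ∃[ i ] ∃[ j ] ∃[ k ] (Distinct i j k × i ∈ D × j ∈ D × k ∈ D × (c ≡ 0 → Within D i j k))
  three-of D {c} eq with ∣ D ∣ | enum D
  three-of D {c} refl | .(3 + c) | en = elt zero , elt (suc zero) , elt (suc (suc zero)) ,
    ((λ e → 0≢ (elt-inj e)) , (λ e → 0≢ (elt-inj e)) , (λ e → 0≢ (Finₚ.suc-injective (elt-inj e)))) ,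
    elt-∈ _ , elt-∈ _ , elt-∈ _ , within
    where
    open Enum en
    0≢ : ∀ {n} {i : Fin n} → _≢_ {A = Fin (suc n)} zero (suc i)
    0≢ ()
    within : c ≡ 0 → ∀ z → z ∈ D → z ≡ _ ⊎ z ≡ _ ⊎ z ≡ _
    within refl z z∈ with idx z∈ | elt-idx z∈
    ... | zero | e = inj₁ (sym e)
    ... | suc zero | e = inj₂ (inj₁ (sym e))
    ... | suc (suc zero) | e = inj₂ (inj₂ (sym e))

  -- The two elements may coincide, and the given element of `Fin b` stands in for both when D is
  -- empty.
  at-most-two : ∀ D → ∣ D ∣ ≤ 2 → Fin b → ∃[ i ] ∃[ j ] (∀ z → z ∈ D → z ≡ i ⊎ z ≡ j)
  at-most-two D le d with ∣ D ∣ | enum D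
  ... | 0 | en = d , d , λ z h → ⊥-elim (Finₚ.¬Fin0 (Enum.idx en h))
  ... | 1 | en = elt zero , elt zero , only
    where
    open Enum en
    only : ∀ z → z ∈ D → z ≡ elt zero ⊎ z ≡ elt zero
    only z h with idx h | elt-idx h
    ... | zero | e = inj₁ (sym e)
  ... | 2 | en = elt zero , elt (suc zero) , only
    where
    open Enum en
    only : ∀ z → z ∈ D → z ≡ elt zero ⊎ z ≡ elt (suc zero)
    only z h with idx h | elt-idx h
    ... | zero | e = inj₁ (sym e)
    ... | suc zero | e = inj₂ (sym e)
  at-most-two D (s≤s (s≤s ())) d | suc (suc (suc _)) | _

-- A criterion in terms of circuits of M only: contracting e makes every three points dependent
-- (`line`) and leaves no loops or parallel pairs among them (`no-pair`, where i = j is allowed).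
module UniformRestriction (M : CircuitSys) (e : Fin (size M)) {b : ℕ} (f : Fin (suc b) → Fin (size M))
  (f-inj : ∀ {i j} → f i ≡ f j → i ≡ j) (f-ground : ∀ i → f i ∈ ground M) (f-≢ : ∀ i → f i ≢ e)
  (line : ∀ i j k → Distinct i j k → ∃[ C ] (Circuit M C × (∀ z → z ∈ C → z ≡ e ⊎ z ≡ f i ⊎ z ≡ f j ⊎ z ≡ f k) ×
                                             f i ∈ C × f j ∈ C × f k ∈ C))
  (no-pair : ∀ i j {C} → Circuit M C → ¬ (∀ z → z ∈ C → z ≡ e ⊎ z ≡ f i ⊎ z ≡ f j)) where

  private
    N = contract M e

    X : Subset (size M)
    X = comprehend (λ y → Finₚ.any? (λ i → f i Finₚ.≟ y))

    f-X : ∀ i → f i ∈ X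
    f-X i = ∈-comprehend⁺ (λ y → Finₚ.any? (λ i → f i Finₚ.≟ y)) (i , refl)

    X-f : ∀ {y} → y ∈ X → ∃[ i ] (f i ≡ y)
    X-f = ∈-comprehend⁻ (λ y → Finₚ.any? (λ i → f i Finₚ.≟ y))

    h : Fin (size M) → Fin (suc b)
    h y with Finₚ.any? (λ i → f i Finₚ.≟ y)
    ... | yes (i , _) = i
    ... | no _ = zero

    h-f : ∀ i → h (f i) ≡ i
    h-f i with Finₚ.any? (λ j → f j Finₚ.≟ f i)
    ... | yes (j , eq) = f-inj eq
    ... | no none = ⊥-elim (none (i , refl))

    f-h : ∀ {y} → y ∈ X → f (h y) ≡ y
    f-h y∈ with X-f y∈
    ... | i , refl = cong f (h-f i)

    W : Subset (suc b) → Subset (size M)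
    W D = preimage h D ∩ X

    ∈-W⁺ : ∀ {D i} → i ∈ D → f i ∈ W D
    ∈-W⁺ {D} {i} i∈ = x∈p∩q⁺ (∈-preimage⁺ (subst (_∈ D) (sym (h-f i)) i∈) , f-X i)

    ∈-W⁻ : ∀ {D i} → f i ∈ W D → i ∈ D
    ∈-W⁻ {D} {i} hi = subst (_∈ D) (h-f i) (∈-preimage⁻ (proj₁ (x∈p∩q⁻ (preimage h D) X hi)))

    W-elt : ∀ {D y} → y ∈ W D → ∃[ i ] (i ∈ D × f i ≡ y)
    W-elt {D} {y} hy with x∈p∩q⁻ (preimage h D) X hy
    ... | p , q = h y , ∈-preimage⁻ p , f-h q

    Cand : Subset (size M) → Set
    Cand D = ∃[ C ] (Circuit M C × D ≡ C - e)

    not-pair : ∀ {D C i j} → Circuit M C → C - e ⊆ W D → ¬ (∀ l → l ∈ D → f l ∈ C - e → l ≡ i ⊎ l ≡ j)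
    not-pair {D} {C} {i} {j} c sub only = no-pair i j c bound
      where
      bound : ∀ z → z ∈ C → z ≡ e ⊎ z ≡ f i ⊎ z ≡ f j
      bound z z∈ with z Finₚ.≟ e
      ... | yes eq = inj₁ eq
      ... | no ne with W-elt (sub (x∈p∧x≢y⇒x∈p-y z∈ ne))
      ...   | l , l∈ , refl with only l l∈ (x∈p∧x≢y⇒x∈p-y z∈ ne)
      ...     | inj₁ refl = inj₂ (inj₁ refl)
      ...     | inj₂ refl = inj₂ (inj₂ refl)

    triple-cand : ∀ {D i j k} → Distinct i j k → i ∈ D → j ∈ D → k ∈ D → Within D i j k → Cand (W D)
    triple-cand {D} {i} {j} {k} d i∈ j∈ k∈ w with line i j k d
    ... | C , c , only , fi , fj , fk = C , c , ⊆-antisym to from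
      where
      to : W D ⊆ C - e
      to hz with W-elt hz
      ... | l , l∈ , refl with w l l∈
      ...   | inj₁ refl = x∈p∧x≢y⇒x∈p-y fi (f-≢ l)
      ...   | inj₂ (inj₁ refl) = x∈p∧x≢y⇒x∈p-y fj (f-≢ l)
      ...   | inj₂ (inj₂ refl) = x∈p∧x≢y⇒x∈p-y fk (f-≢ l)
      from : C - e ⊆ W D
      from {z} hz with ∈-remove⁻ {p = C} hz
      ... | z∈ , ne with only z z∈
      ...   | inj₁ eq = ⊥-elim (ne eq)
      ...   | inj₂ (inj₁ refl) = ∈-W⁺ i∈
      ...   | inj₂ (inj₂ (inj₁ refl)) = ∈-W⁺ j∈
      ...   | inj₂ (inj₂ (inj₂ refl)) = ∈-W⁺ k∈

    triple-circuit : ∀ {D} → ∣ D ∣ ≡ 3 → Circuit N (W D)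
    triple-circuit {D} eq with three-of D {0} eq
    ... | i , j , k , d , i∈ , j∈ , k∈ , w′ = (f i , ∈-W⁺ i∈) , triple-cand d i∈ j∈ k∈ w , minimal
      where
      w = w′ refl
      minimal : ∀ D′ → Nonempty D′ → Cand D′ → D′ ⊆ W D → D′ ≡ W D
      minimal .(C - e) _ (C , c , refl) sub = ⊆-antisym sub full
        where
        third : ∀ {l a₁ a₂ a₃} → l ≡ a₁ ⊎ l ≡ a₂ ⊎ l ≡ a₃ → l ≢ a₁ → l ≡ a₂ ⊎ l ≡ a₃
        third (inj₁ e₁) ne = ⊥-elim (ne e₁)
        third (inj₂ r) _ = r
        force : ∀ {a₁ a₂ a₃} → (∀ l → l ∈ D → l ≡ a₁ ⊎ l ≡ a₂ ⊎ l ≡ a₃) → f a₁ ∈ C - e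
        force {a₁} {a₂} {a₃} cover with f a₁ ∈? (C - e)
        ... | yes p = p
        ... | no ∉ = ⊥-elim (not-pair {D} {C} {a₂} {a₃} c sub (λ l l∈ fl → third {l} {a₁} (cover l l∈) λ { refl → ∉ fl }))
        full : W D ⊆ C - e
        full hz with W-elt hz
        ... | l , l∈ , refl with w l l∈
        ...   | inj₁ refl = force w
        ...   | inj₂ (inj₁ refl) = force {l} {i} {k} λ z z∈ → ⊎-second (w z z∈)
        ...   | inj₂ (inj₂ refl) = force {l} {i} {j} λ z z∈ → ⊎-third (w z z∈)

    -- With fewer than three points `no-pair` is violated. With more, three of them already form a
    -- candidate, and minimality makes D equal to these three.
    circuit-triple : ∀ {D} → Circuit N (W D) → ∣ D ∣ ≡ 3
    circuit-triple {D} (_ , (C , c , eqC) , minimal) with ℕₚ.<-cmp ∣ D ∣ 3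
    ... | tri≈ _ eq _ = eq
    ... | tri< (s≤s le) _ _ with at-most-two D le zero
    ...   | i , j , only = ⊥-elim (not-pair {D} {C} {i} {j} c (λ {z} p → subst (z ∈_) (sym eqC) p) (λ l l∈ _ → only l l∈))
    circuit-triple {D} (_ , _ , minimal) | tri> _ _ gt with three-of D (sym (ℕₚ.m+[n∸m]≡n (ℕₚ.<⇒≤ gt)))
    ...   | i , j , k , d , i∈ , j∈ , k∈ , _ = subst (λ D → ∣ D ∣ ≡ 3) eq card
      where
      T = ⁅ i ⁆ ∪ (⁅ j ⁆ ∪ ⁅ k ⁆)
      iT : i ∈ T
      iT = x∈p∪q⁺ (inj₁ (x∈⁅x⁆ i))
      jT : j ∈ T
      jT = x∈p∪q⁺ (inj₂ (x∈p∪q⁺ (inj₁ (x∈⁅x⁆ j))))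
      kT : k ∈ T
      kT = x∈p∪q⁺ (inj₂ (x∈p∪q⁺ (inj₂ (x∈⁅x⁆ k))))
      w : Within T i j k
      w z hz with ∈-∪⁻ hz
      ... | inj₁ p = inj₁ (∈-⁅⁆⁻ p)
      ... | inj₂ q with ∈-∪⁻ q
      ...   | inj₁ p = inj₂ (inj₁ (∈-⁅⁆⁻ p))
      ...   | inj₂ p = inj₂ (inj₂ (∈-⁅⁆⁻ p))
      card = card-3 d iT jT kT w
      T⊆D : T ⊆ D
      T⊆D {z} hz with w z hz
      ... | inj₁ refl = i∈
      ... | inj₂ (inj₁ refl) = j∈
      ... | inj₂ (inj₂ refl) = k∈
      W-mono : W T ⊆ W D
      W-mono hz with W-elt hz
      ... | l , l∈ , refl = ∈-W⁺ (T⊆D l∈)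
      same : W T ≡ W D
      same = minimal (W T) (f i , ∈-W⁺ iT) (triple-cand d iT jT kT w) W-mono
      eq : T ≡ D
      eq = ⊆-antisym T⊆D λ {z} hz → ∈-W⁻ (subst (f z ∈_) (sym same) (∈-W⁺ hz))

  uniform : HasURestriction (contract M e) 2 (suc b)
  uniform = X , X⊆ , record
    { to = h ; from = f ; to-gr = λ _ _ → ∈⊤ ; from-gr = λ i _ → f-X i
    ; from-to = λ y → f-h ; to-from = λ i _ → h-f i
    ; circ-to = λ D _ → mk⇔ (λ eq → triple-circuit {D} eq , λ {z} p → proj₂ (x∈p∩q⁻ (preimage h D) X p))
                            (λ { (c , _) → circuit-triple {D} c })
    ; circ-from = circ-from }
    where
    X⊆ : X ⊆ ground M - e
    X⊆ hy with X-f hy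
    ... | i , refl = x∈p∧x≢y⇒x∈p-y (f-ground i) (f-≢ i)
    circ-from : ∀ C → C ⊆ X → (Circuit N C × C ⊆ X) ⇔ (∣ preimage f C ∩ ⊤ ∣ ≡ 3)
    circ-from C sub = mk⇔ (λ { (c , _) → circuit-triple {preimage f C ∩ ⊤} (subst (Circuit N) (sym back) c) })
                          (λ eq → subst (Circuit N) back (triple-circuit {preimage f C ∩ ⊤} eq) , λ {z} → sub {z})
      where
      back : W (preimage f C ∩ ⊤) ≡ C
      back = ⊆-antisym to from
        where
        to : W (preimage f C ∩ ⊤) ⊆ C
        to hz with W-elt {preimage f C ∩ ⊤} hz
        ... | l , l∈ , refl = ∈-preimage⁻ {f = f} (proj₁ (x∈p∩q⁻ (preimage f C) ⊤ l∈))
        from : C ⊆ W (preimage f C ∩ ⊤)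
        from {z} z∈ with X-f (sub z∈)
        ... | l , refl = ∈-W⁺ {preimage f C ∩ ⊤} (x∈p∩q⁺ (∈-preimage⁺ {f = f} z∈ , ∈⊤))

sort-triple : ∀ {b} {Q : Fin b → Fin b → Fin b → Set} →
              (∀ {i j k} → Q i j k → Q j i k) → (∀ {i j k} → Q i j k → Q i k j) →
              (∀ {i j k} → i < j → j < k → Q i j k) → ∀ i j k → Distinct i j k → Q i j k
sort-triple {Q = Q} swap₁ swap₂ sorted i j k (ij , ik , jk) = go (Finₚ.<-cmp i j)
  where
  ordered : ∀ {i j k} → i < j → i ≢ k → j ≢ k → Q i j k
  ordered {i} {j} {k} lt ik jk with Finₚ.<-cmp j k | Finₚ.<-cmp i k
  ... | tri< lt′ _ _ | _ = sorted lt lt′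
  ... | tri≈ _ eq _ | _ = ⊥-elim (jk eq)
  ... | tri> _ _ gt | tri< lt′ _ _ = swap₂ (sorted lt′ gt)
  ... | tri> _ _ gt | tri≈ _ eq _ = ⊥-elim (ik eq)
  ... | tri> _ _ gt | tri> _ _ gt′ = swap₂ (swap₁ (sorted gt′ lt))
  go : Tri (i < j) (i ≡ j) (j < i) → Q i j k
  go (tri< lt _ _) = ordered lt ik jk
  go (tri≈ _ eq _) = ⊥-elim (ij eq)
  go (tri> _ _ gt) = swap₁ (ordered gt jk ik)

-- If no c ∈ L i k completes a ∈ L i j, b ∈ L j k to a circuit, then x, b and L i k become pairwise
-- non-parallel points of one line in the contraction by a.
module UniformPlane {n t} (D : LiftData n) {i j k} (ij : i ≢ j) (jk : j ≢ k) (ik : i ≢ k)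
  {a b : Fin (nE (LiftData.G D))} (Ja : LiftData.J D a i j) (Jb : LiftData.J D b j k)
  (L : Enum (λ e → LiftData.J D e i k) t)
  (quad : ∀ l → LiftData.IsC D true (λ g → g ≡ a ⊎ g ≡ b ⊎ g ≡ Enum.elt L l)) where

  open LiftData D
  open Enum L using () renaming (elt to c; elt-∈ to Jc; elt-inj to c-inj)

  private
    single : ∀ {s C e} → K (s ∷ C) → ¬ (∀ g → g ∈ C → g ≡ e)
    single {e = e} kC only with an-edge kC
    ... | g , g∈ with only g g∈
    ...   | refl = leaf kC (inj₁ refl) (λ f f∈ _ → only f f∈) g∈

    no-ab : ∀ {s C} → K (s ∷ C) → ¬ (∀ g → g ∈ C → g ≡ a ⊎ g ≡ b)
    no-ab {C = C} kC only = single kC rest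
      where
      a∉ : a ∉ C
      a∉ = leaf kC (J-at₁ Ja) at-i
        where
        at-i : ∀ g → g ∈ C → At g i → g ≡ a
        at-i g g∈ at with only g g∈
        ... | inj₁ eq = eq
        ... | inj₂ refl = ⊥-elim (J-miss Jb ij ik at)
      rest : ∀ g → g ∈ C → g ≡ b
      rest g g∈ with only g g∈
      ... | inj₁ refl = ⊥-elim (a∉ g∈)
      ... | inj₂ eq = eq

    drop-a : ∀ {s C l l′} → K (s ∷ C) → (∀ g → g ∈ C → g ≡ a ⊎ g ≡ c l ⊎ g ≡ c l′) →
             ∀ g → g ∈ C → g ≡ c l ⊎ g ≡ c l′
    drop-a {C = C} {l} {l′} kC only g g∈ with only g g∈
    ... | inj₂ r = r
    ... | inj₁ refl = ⊥-elim (leaf kC (J-at₂ Ja) at-j g∈)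
      where
      at-j : ∀ g → g ∈ C → At g j → g ≡ a
      at-j g g∈ at with only g g∈
      ... | inj₁ eq = eq
      ... | inj₂ (inj₁ refl) = ⊥-elim (J-miss (Jc l) (≢-sym ij) jk at)
      ... | inj₂ (inj₂ refl) = ⊥-elim (J-miss (Jc l′) (≢-sym ij) jk at)

    no-ac : ∀ {s C l} → K (s ∷ C) → ¬ (∀ g → g ∈ C → g ≡ a ⊎ g ≡ c l)
    no-ac {C = C} {l} kC only = single kC rest
      where
      both : ∀ g → g ∈ C → g ≡ a ⊎ g ≡ c l ⊎ g ≡ c l
      both g g∈ with only g g∈
      ... | inj₁ eq = inj₁ eq
      ... | inj₂ eq = inj₂ (inj₁ eq)
      rest : ∀ g → g ∈ C → g ≡ c l
      rest g g∈ with drop-a kC both g g∈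
      ... | inj₁ eq = eq
      ... | inj₂ eq = eq

    no-abc : ∀ {C l} → K (false ∷ C) → ¬ (∀ g → g ∈ C → g ≡ a ⊎ g ≡ b ⊎ g ≡ c l)
    no-abc {l = l} kC only with quad l
    ... | C₁ , k₁ , _ , from = incomp-x kC k₁ (λ {g} g∈ → from g (only g g∈))

    no-cc : ∀ {C l l′} → K (false ∷ C) → ¬ (∀ g → g ∈ C → g ≡ c l ⊎ g ≡ c l′)
    no-cc {C} {l} {l′} kC only with c l Finₚ.≟ c l′
    ... | no ne with parallel (Jc l) (Jc l′) ne
    ...   | C₁ , k₁ , _ , from = incomp-x kC k₁ (λ {g} g∈ → from g (only g g∈))
    no-cc {C} {l} {l′} kC only | yes eq = single kC same
      where
      same : ∀ g → g ∈ C → g ≡ c l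
      same g g∈ with only g g∈
      ... | inj₁ e = e
      ... | inj₂ e = trans e (sym eq)

  -- The t + 2 points of the forbidden line: x, b and the t edges between i and k. The contracted
  -- element is a.
  point : Fin (2 + t) → Fin (suc (nE G))
  point zero = zero
  point (suc zero) = suc b
  point (suc (suc l)) = suc (c l)

  point-inj : ∀ {p q} → point p ≡ point q → p ≡ q
  point-inj {zero} {zero} eq = refl
  point-inj {zero} {suc zero} ()
  point-inj {zero} {suc (suc q)} ()
  point-inj {suc zero} {zero} ()
  point-inj {suc (suc p)} {zero} ()
  point-inj {suc zero} {suc zero} eq = refl
  point-inj {suc zero} {suc (suc l)} refl = ⊥-elim (ij (J-det (J-sym (Jc l)) (J-sym Jb)))
  point-inj {suc (suc l)} {suc zero} refl = ⊥-elim (ij (J-det (J-sym (Jc l)) (J-sym Jb)))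
  point-inj {suc (suc l)} {suc (suc l′)} eq = cong (λ z → suc (suc z)) (c-inj (Finₚ.suc-injective eq))

  point-≢ : ∀ p → point p ≢ suc a
  point-≢ zero ()
  point-≢ (suc zero) refl = ik (J-det (J-sym Ja) Jb)
  point-≢ (suc (suc l)) refl = jk (J-det Ja (Jc l))

  private
    edge-bound : ∀ {s C p q} {B : Fin (nE G) → Set} → (∀ z → z ∈ s ∷ C → z ≡ suc a ⊎ z ≡ point p ⊎ z ≡ point q) →
            (∀ g → suc g ≡ suc a ⊎ suc g ≡ point p ⊎ suc g ≡ point q → B g) → ∀ g → g ∈ C → B g
    edge-bound h f g g∈ = f g (h (suc g) (there g∈))

    e⁻ : ∀ {g h : Fin (nE G)} → _≡_ {A = Fin (suc (nE G))} (suc g) (suc h) → g ≡ h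
    e⁻ = Finₚ.suc-injective

    no-x : ∀ {s C y z} → (∀ w → w ∈ s ∷ C → w ≡ suc a ⊎ w ≡ suc y ⊎ w ≡ suc z) → K (s ∷ C) → K (false ∷ C)
    no-x {true} h kC with h zero here
    ... | inj₁ ()
    ... | inj₂ (inj₁ ())
    ... | inj₂ (inj₂ ())
    no-x {false} h kC = kC

  -- With x and at most one further point the edges form a path, impossible without leaves. With b
  -- and a bundle edge, the circuit avoids x and lies inside one of the circuits `quad`. With two
  -- bundle edges, a is a leaf at j, and what remains lies inside a circuit {x , c , c′}, or is a
  -- single edge.
  no-pair : ∀ p q {C} → K C → ¬ (∀ z → z ∈ C → z ≡ suc a ⊎ z ≡ point p ⊎ z ≡ point q)
  no-pair zero zero {s ∷ C} kC h = single kC (edge-bound {p = zero} {zero} h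
    λ { g (inj₁ eq) → e⁻ eq ; g (inj₂ (inj₁ ())) ; g (inj₂ (inj₂ ())) })
  no-pair zero (suc zero) {s ∷ C} kC h = no-ab kC (edge-bound {p = zero} {suc zero} h
    λ { g (inj₁ eq) → inj₁ (e⁻ eq) ; g (inj₂ (inj₁ ())) ; g (inj₂ (inj₂ eq)) → inj₂ (e⁻ eq) })
  no-pair zero (suc (suc l)) {s ∷ C} kC h = no-ac kC (edge-bound {p = zero} {suc (suc l)} h
    λ { g (inj₁ eq) → inj₁ (e⁻ eq) ; g (inj₂ (inj₁ ())) ; g (inj₂ (inj₂ eq)) → inj₂ (e⁻ eq) })
  no-pair (suc zero) zero {s ∷ C} kC h = no-ab kC (edge-bound {p = suc zero} {zero} h
    λ { g (inj₁ eq) → inj₁ (e⁻ eq) ; g (inj₂ (inj₁ eq)) → inj₂ (e⁻ eq) ; g (inj₂ (inj₂ ())) })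
  no-pair (suc (suc l)) zero {s ∷ C} kC h = no-ac kC (edge-bound {p = suc (suc l)} {zero} h
    λ { g (inj₁ eq) → inj₁ (e⁻ eq) ; g (inj₂ (inj₁ eq)) → inj₂ (e⁻ eq) ; g (inj₂ (inj₂ ())) })
  no-pair (suc zero) (suc zero) {s ∷ C} kC h = no-ab kC (edge-bound {p = suc zero} {suc zero} h
    λ { g (inj₁ eq) → inj₁ (e⁻ eq) ; g (inj₂ (inj₁ eq)) → inj₂ (e⁻ eq) ; g (inj₂ (inj₂ eq)) → inj₂ (e⁻ eq) })
  no-pair (suc zero) (suc (suc l)) {s ∷ C} kC h = no-abc (no-x h kC) (edge-bound {p = suc zero} {suc (suc l)} h
    λ g → Sum.map e⁻ (Sum.map e⁻ e⁻))
  no-pair (suc (suc l)) (suc zero) {s ∷ C} kC h = no-abc (no-x h kC) (edge-bound {p = suc (suc l)} {suc zero} h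
    λ g r → Sum.map e⁻ (Sum.map e⁻ e⁻) (Sum.map₂ Sum.swap r))
  no-pair (suc (suc l)) (suc (suc l′)) {s ∷ C} kC h = no-cc (no-x h kC) (drop-a kC (edge-bound {p = suc (suc l)} {suc (suc l′)} h
    λ g → Sum.map e⁻ (Sum.map e⁻ e⁻)))

  Collinear : Fin (2 + t) → Fin (2 + t) → Fin (2 + t) → Set
  Collinear p q r = ∃[ C ] (K C × (∀ z → z ∈ C → z ≡ suc a ⊎ z ≡ point p ⊎ z ≡ point q ⊎ z ≡ point r) ×
                            point p ∈ C × point q ∈ C × point r ∈ C)

  private
    x-two : ∀ {l l′} → c l ≢ c l′ → Collinear zero (suc (suc l)) (suc (suc l′))
    x-two {l} {l′} ne with parallel (Jc l) (Jc l′) ne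
    ... | C , kC , to , from = true ∷ C , kC , bound , here , there (from _ (inj₁ refl)) , there (from _ (inj₂ refl))
      where
      bound : ∀ z → z ∈ true ∷ C → z ≡ suc a ⊎ z ≡ zero ⊎ z ≡ suc (c l) ⊎ z ≡ suc (c l′)
      bound zero _ = inj₂ (inj₁ refl)
      bound (suc g) (there g∈) = inj₂ (inj₂ (Sum.map (cong suc) (cong suc) (to g g∈)))

    x-b : ∀ l → Collinear zero (suc zero) (suc (suc l))
    x-b l with quad l
    ... | C , kC , to , from = true ∷ C , kC , bound , here , there (from _ (inj₂ (inj₁ refl))) , there (from _ (inj₂ (inj₂ refl)))
      where
      bound : ∀ z → z ∈ true ∷ C → z ≡ suc a ⊎ z ≡ zero ⊎ z ≡ suc b ⊎ z ≡ suc (c l)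
      bound zero _ = inj₂ (inj₁ refl)
      bound (suc g) (there g∈) = Sum.map (cong suc) (λ r → inj₂ (Sum.map (cong suc) (cong suc) r)) (to g g∈)

    force : ∀ {C e} {B : Fin (nE G) → Set} → (∀ g → g ∈ C → g ≡ e ⊎ B g) → ¬ (∀ g → g ∈ C → B g) → e ∈ C
    force {C} {e} {B} h none with e ∈? C
    ... | yes p = p
    ... | no ∉ = ⊥-elim (none λ g g∈ → drop g g∈ (h g g∈))
      where
      drop : ∀ g → g ∈ C → g ≡ e ⊎ B g → B g
      drop g g∈ (inj₁ refl) = ⊥-elim (∉ g∈)
      drop g g∈ (inj₂ Bg) = Bg

    -- x is eliminated from {x , a , b , c} and {x , c , c′} while a is retained. Then b is forced
    -- because a must not be a leaf at j, and each of c and c′ because without it the circuit would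
    -- lie inside one of the circuits `quad`.
    b-two : ∀ {l l′} → c l ≢ c l′ → Collinear (suc zero) (suc (suc l)) (suc (suc l′))
    b-two {l} {l′} ne with quad l | parallel (Jc l) (Jc l′) ne
    ... | C₁ , k₁ , to₁ , from₁ | C₂ , k₂ , to₂ , from₂ with elim-x k₁ k₂ (from₁ a (inj₁ refl)) a∉
      where
      a∉ : a ∉ C₂
      a∉ p with to₂ a p
      ... | inj₁ refl = jk (J-det Ja (Jc l))
      ... | inj₂ refl = jk (J-det Ja (Jc l′))
    ...   | C , kC , a∈ , bound = false ∷ C , kC , outer , there b∈ , there (force cover (no-abc kC)) , there (force cover′ (no-abc kC))
      where
      four : ∀ g → g ∈ C → g ≡ a ⊎ g ≡ b ⊎ g ≡ c l ⊎ g ≡ c l′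
      four g g∈ with bound g g∈
      ... | inj₁ p with to₁ g p
      ...   | inj₁ eq = inj₁ eq
      ...   | inj₂ (inj₁ eq) = inj₂ (inj₁ eq)
      ...   | inj₂ (inj₂ eq) = inj₂ (inj₂ (inj₁ eq))
      four g g∈ | inj₂ p with to₂ g p
      ...   | inj₁ eq = inj₂ (inj₂ (inj₁ eq))
      ...   | inj₂ eq = inj₂ (inj₂ (inj₂ eq))
      b∈ : b ∈ C
      b∈ with leafless kC j a a∈ (J-at₂ Ja)
      ... | f , f∈ , ne′ , at with four f f∈
      ...   | inj₁ eq = ⊥-elim (ne′ eq)
      ...   | inj₂ (inj₁ refl) = f∈
      ...   | inj₂ (inj₂ (inj₁ refl)) = ⊥-elim (J-miss (Jc l) (≢-sym ij) jk at)
      ...   | inj₂ (inj₂ (inj₂ refl)) = ⊥-elim (J-miss (Jc l′) (≢-sym ij) jk at)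
      cover : ∀ g → g ∈ C → g ≡ c l ⊎ (g ≡ a ⊎ g ≡ b ⊎ g ≡ c l′)
      cover g g∈ = ⊎-second (Sum.map₂ ⊎-second (four g g∈))
      cover′ : ∀ g → g ∈ C → g ≡ c l′ ⊎ (g ≡ a ⊎ g ≡ b ⊎ g ≡ c l)
      cover′ g g∈ = ⊎-second (Sum.map₂ ⊎-third (four g g∈))
      outer : ∀ z → z ∈ false ∷ C → z ≡ suc a ⊎ z ≡ suc b ⊎ z ≡ suc (c l) ⊎ z ≡ suc (c l′)
      outer (suc g) (there g∈) =
        Sum.map (cong suc) (Sum.map (cong suc) (Sum.map (cong suc) (cong suc))) (four g g∈)

    three : ∀ {l l′ l″} → c l ≢ c l′ → c l ≢ c l″ → c l′ ≢ c l″ →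
            Collinear (suc (suc l)) (suc (suc l′)) (suc (suc l″))
    three {l} {l′} {l″} ne₁ ne₂ ne₃ with parallel (Jc l) (Jc l′) ne₁ | parallel (Jc l′) (Jc l″) ne₃
    ... | C₁ , k₁ , to₁ , from₁ | C₂ , k₂ , to₂ , from₂ with elim-x k₁ k₂ (from₁ (c l) (inj₁ refl)) c∉
      where
      c∉ : c l ∉ C₂
      c∉ p with to₂ (c l) p
      ... | inj₁ eq = ne₁ eq
      ... | inj₂ eq = ne₂ eq
    ...   | C , kC , c∈ , bound = false ∷ C , kC , outer , there c∈ , there (force (λ g g∈ → ⊎-second (all g g∈)) (no-cc kC)) ,
        there (force (λ g g∈ → ⊎-third (all g g∈)) (no-cc kC))
      where
      all : ∀ g → g ∈ C → g ≡ c l ⊎ g ≡ c l′ ⊎ g ≡ c l″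
      all g g∈ with bound g g∈
      ... | inj₁ p with to₁ g p
      ...   | inj₁ eq = inj₁ eq
      ...   | inj₂ eq = inj₂ (inj₁ eq)
      all g g∈ | inj₂ p with to₂ g p
      ...   | inj₁ eq = inj₂ (inj₁ eq)
      ...   | inj₂ eq = inj₂ (inj₂ eq)
      outer : ∀ z → z ∈ false ∷ C → z ≡ suc a ⊎ z ≡ suc (c l) ⊎ z ≡ suc (c l′) ⊎ z ≡ suc (c l″)
      outer (suc g) (there g∈) = inj₂ (Sum.map (cong suc) (Sum.map (cong suc) (cong suc)) (all g g∈))

    c-≢ : ∀ {l l′} → l < l′ → c l ≢ c l′
    c-≢ lt eq = Finₚ.<⇒≢ lt (c-inj eq)

    sorted : ∀ {p q r} → p < q → q < r → Collinear p q r
    sorted {zero} {suc zero} {suc zero} _ (s≤s ())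
    sorted {zero} {suc zero} {suc (suc l)} _ _ = x-b l
    sorted {zero} {suc (suc l)} {suc zero} _ (s≤s ())
    sorted {zero} {suc (suc l)} {suc (suc l′)} _ (s≤s (s≤s lt)) = x-two (c-≢ lt)
    sorted {suc zero} {suc zero} (s≤s ()) _
    sorted {suc zero} {suc (suc l)} {suc zero} _ (s≤s ())
    sorted {suc zero} {suc (suc l)} {suc (suc l′)} _ (s≤s (s≤s lt)) = b-two (c-≢ lt)
    sorted {suc (suc l)} {suc zero} (s≤s ()) _
    sorted {suc (suc l)} {suc (suc l′)} {suc zero} _ (s≤s ())
    sorted {suc (suc l)} {suc (suc l′)} {suc (suc l″)} (s≤s (s≤s lt)) (s≤s (s≤s lt′)) =
      three (c-≢ lt) (c-≢ (Finₚ.<-trans {i = l} {l′} {l″} lt lt′)) (c-≢ lt′)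

  collinear : ∀ p q r → Distinct p q r → Collinear p q r
  collinear = sort-triple
    (λ { (C , kC , h , p , q , r) → C , kC , (λ z z∈ → swap₁ (h z z∈)) , q , p , r })
    (λ { (C , kC , h , p , q , r) → C , kC , (λ z z∈ → swap₂ (h z z∈)) , p , r , q })
    sorted
    where
    swap₁ : ∀ {A B C D : Set} → A ⊎ B ⊎ C ⊎ D → A ⊎ C ⊎ B ⊎ D
    swap₁ = Sum.map₂ ⊎-second
    swap₂ : ∀ {A B C D : Set} → A ⊎ B ⊎ C ⊎ D → A ⊎ B ⊎ D ⊎ C
    swap₂ = Sum.map₂ (Sum.map₂ Sum.swap)

-- Triangles, bundles and the filling of triangles

module Assemble {n t : ℕ} (H : Hypotheses n t) where

  open Hypotheses H
  open Build H
  open Enum (enum Rest)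
  open Walks G loopless

  liftData : LiftData n
  liftData = record
    { G = G ; ordered = ordered ; K = K ; circuits = circuits ; cuts = cuts ; an-edge = an-edge
    ; parallel = parallel }

  open Exchange liftData

  -- The three classes form a triangle of `G₀`. The isomorphism turns it into a circuit of the
  -- contraction made of representatives, and the circuit of M behind it has the same edges and may
  -- contain x.
  rep-triangle : ∀ {i j k a b c} → i ≢ j → j ≢ k → i ≢ k → J a i j → J b j k → J c k i →
                 ∃[ s ] IsC s (Triple (rep (κ a)) (rep (κ b)) (rep (κ c)))
  rep-triangle {i} {j} {k} {a} {b} {c} ij jk ik Ja Jb Jc
    with contract-circuit (proj₁ (Equivalence.to (I.circ-to (W₀.cyc-edges Z) (λ _ → ∈⊤)) (W₀.isCycle Z is)))
    where
    α = J⇒J₀ Ja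
    β = J⇒J₀ Jb
    χ = J⇒J₀ Jc
    p = W₀.cons (κ b) β (W₀.cons (κ c) χ (W₀.nil i))
    d∉ : ¬ (κ a W₀.∈E p)
    d∉ (inj₁ eq) with W₀.J-ends (subst (λ e → W₀.J e j k) (sym eq) β) (W₀.J-at₁ α)
    ... | inj₁ e = ij e
    ... | inj₂ e = ik e
    d∉ (inj₂ (inj₁ eq)) with W₀.J-ends (subst (λ e → W₀.J e k i) (sym eq) χ) (W₀.J-at₂ α)
    ... | inj₁ e = jk e
    ... | inj₂ e = ij (sym e)
    Z : W₀.Cyc i
    Z = W₀.cyc (κ a) α p ((λ { (inj₁ e) → jk e ; (inj₂ e) → ij (sym e) }) , (λ e → ik (sym e)) , refl) d∉
    is : W₀.Is Z (W₀.cyc-edges Z)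
    is = (λ f → W₀.∈-cyc⁻ Z) , (λ f → W₀.∈-cyc⁺ Z)
  ... | s , C , k′ , eq = s , C , k′ , only , all
    where
    D = ⁅ κ a ⁆ ∪ (⁅ κ b ⁆ ∪ (⁅ κ c ⁆ ∪ ⊥))
    at-rep : ∀ {g e} → elt g ∈ S → I.to (elt g) ≡ e → g ≡ rep e
    at-rep {g} g∈ refl = elt-inj (trans (sym (I.from-to (elt g) g∈)) (sym (elt-rep _)))
    only : ∀ g → g ∈ C → Triple (rep (κ a)) (rep (κ b)) (rep (κ c)) g
    only g g∈ with x∈p∩q⁻ (preimage I.to D) S (subst (elt g ∈_) (sym eq) (∈-img⁺ {i = suc g} (there g∈)))
    ... | p , q with ∈-∪⁻ (∈-preimage⁻ {f = I.to} {D = D} p)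
    ...   | inj₁ e = inj₁ (at-rep q (∈-⁅⁆⁻ e))
    ...   | inj₂ r with ∈-∪⁻ r
    ...     | inj₁ e = inj₂ (inj₁ (at-rep q (∈-⁅⁆⁻ e)))
    ...     | inj₂ r′ with ∈-∪⁻ r′
    ...       | inj₁ e = inj₂ (inj₂ (at-rep q (∈-⁅⁆⁻ e)))
    ...       | inj₂ e = ⊥-elim (∉⊥ e)
    in-D : ∀ {e} → e ∈ D → rep e ∈ C
    in-D {e} e∈ = drop-there (∈-img⁻ {i = suc (rep e)} (subst (elt (rep e) ∈_) eq (x∈p∩q⁺
      (∈-preimage⁺ {f = I.to} {D = D} (subst (_∈ D) (sym (trans (cong I.to (elt-rep e)) (I.to-from e ∈⊤))) e∈) ,
       subst (_∈ S) (sym (elt-rep e)) (from-S e)))))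
    all : ∀ g → Triple (rep (κ a)) (rep (κ b)) (rep (κ c)) g → g ∈ C
    all g (inj₁ refl) = in-D (x∈p∪q⁺ (inj₁ (x∈⁅x⁆ _)))
    all g (inj₂ (inj₁ refl)) = in-D (x∈p∪q⁺ (inj₂ (x∈p∪q⁺ (inj₁ (x∈⁅x⁆ _)))))
    all g (inj₂ (inj₂ refl)) = in-D (x∈p∪q⁺ (inj₂ (x∈p∪q⁺ (inj₂ (x∈p∪q⁺ (inj₁ (x∈⁅x⁆ _)))))))

  J-rep : ∀ {i u v} → J i u v → J (rep (κ i)) u v
  J-rep {i} {u} {v} p = J₀⇒J (subst (λ g → W₀.J g u v) (sym (κ-rep (κ i))) (J⇒J₀ p))

  abstract
    triangle : ∀ {i j k a b c} → i ≢ j → j ≢ k → i ≢ k → J a i j → J b j k → J c i k →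
               IsC false (Triple a b c) ⊎ IsC true (Triple a b c)
    triangle ij jk ik Ja Jb Jc with rep-triangle ij jk ik Ja Jb (J-sym Jc)
    ... | s₀ , t₀ with exchange ij jk ik Ja (J-rep Ja) (J-rep Jb) (J-rep (J-sym Jc)) t₀
    -- Representatives give way to the actual edges one at a time: each exchange acts on the first
    -- entry, and `turn` brings the next one to the front.
    ...   | s₁ , t₁ with exchange jk (≢-sym ik) (≢-sym ij) Jb (J-rep Jb) (J-rep (J-sym Jc)) Ja (turn t₁)
    ...     | s₂ , t₂ with exchange (≢-sym ik) ij (≢-sym jk) (J-sym Jc) (J-rep (J-sym Jc)) Ja Jb (turn t₂)
    ...       | false , t₃ = inj₁ (turn t₃)
    ...       | true , t₃ = inj₂ (turn t₃)

  abstract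
    some : ∀ {i j} → i ≢ j → ∃[ a ] J a i j
    some {i} {j} ne with proj₁ (proj₂ complete) i j ne
    ... | g , p = rep g , J₀⇒J (subst (λ g → W₀.J g i j) (sym (κ-rep g)) p)

  At-J : ∀ {e u v} → At e u → At e v → u ≢ v → J e u v
  At-J (inj₁ p) (inj₁ q) ne = ⊥-elim (ne (trans (sym p) q))
  At-J (inj₁ p) (inj₂ q) ne = inj₁ (p , q)
  At-J (inj₂ p) (inj₁ q) ne = inj₂ (q , p)
  At-J (inj₂ p) (inj₂ q) ne = ⊥-elim (ne (trans (sym p) q))

  -- As r and e together have no leaf, every end of e is an end of r.
  line⇒class : ∀ {r e i j} → J r i j → IsC true (λ g → g ≡ r ⊎ g ≡ e) → J e i j
  line⇒class {r} {e} {i} {j} Jr (C , k , to , from) =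
    J₀⇒J (subst (λ g → W₀.J g i j) (unique₀ (J⇒J₀ (At-J (at (inj₁ refl)) (at (inj₂ refl)) (loopless e))) (J₀-self e)) (J⇒J₀ Jr))
    where
    at : ∀ {v} → At e v → At r v
    at {v} h with cuts⇒leafless (cuts k) v e (from e (inj₂ refl)) h
    ... | f , f∈ , ne , h′ with to f f∈
    ...   | inj₁ refl = h′
    ...   | inj₂ eq = ⊥-elim (ne eq)

  abstract
    -- The bundle between i and j is the parallel class of any edge r in it, so its size is the one
    -- given by `classes`.
    lines : ∀ {i j} → i ≢ j → Enum (λ e → J e i j) t
    lines {i} {j} ne with some ne
    ... | r , Jr with classes (elt r) (nonloop (elt-∈ r))
    ...   | Pᵣ , iff , size-P = subst (Enum (λ e → J e i j)) size-P record
      { elt = λ l → idx (member l)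
      ; elt-∈ = λ l → class⁻ (subst (Parallel N (elt r)) (sym (elt-idx (member l))) (Equivalence.to (iff _) (Q.elt-∈ l)))
      ; idx = λ p → Q.idx (Equivalence.from (iff _) (class⁺ p))
      ; elt-idx = λ p → elt-inj (trans (elt-idx _) (Q.elt-idx _))
      ; elt-inj = λ {k} {l} eq → Q.elt-inj (trans (sym (elt-idx (member k))) (trans (cong elt eq) (elt-idx (member l)))) }
      where
      module Q = Enum (enum Pᵣ)
      member : ∀ l → Q.elt l ∈ Rest
      member l = rest⁺ (proj₁ (proj₁ (proj₂ (Equivalence.to (iff _) (Q.elt-∈ l)))))
      class⁻ : ∀ {e} → Parallel N (elt r) (elt e) → J e i j
      class⁻ {e} p with r Finₚ.≟ e
      ... | yes refl = Jr
      ... | no r≢e = line⇒class Jr (parallel⇒line p r≢e)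
      class⁺ : ∀ {e} → J e i j → Parallel N (elt r) (elt e)
      class⁺ {e} p with r Finₚ.≟ e
      ... | yes refl = nonloop (elt-∈ r) , nonloop (elt-∈ r) , inj₁ refl
      ... | no r≢e = line⇒parallel r≢e (parallel Jr p r≢e)

  private
    module NoQuads {i j k a b} (ij : i ≢ j) (jk : j ≢ k) (ik : i ≢ k) (Ja : J a i j) (Jb : J b j k)
      (quads : ∀ l → IsC true (Triple a b (Enum.elt (lines ik) l))) where

      open UniformPlane liftData ij jk ik Ja Jb (lines ik) quads
      bounded : ∀ {C p q r} → (∀ z → z ∈ C → z ≡ suc a ⊎ z ≡ point p ⊎ z ≡ point q ⊎ z ≡ point r) →
                ∀ z → z ∈ img C → z ≡ elt a ⊎ z ≡ ι (point p) ⊎ z ≡ ι (point q) ⊎ z ≡ ι (point r)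
      bounded h z hz with img-elt hz
      ... | y , y∈ , refl = Sum.map (cong ι) (Sum.map (cong ι) (Sum.map (cong ι) (cong ι))) (h y y∈)
      line′ : ∀ p q r → Distinct p q r → ∃[ C ] (Circuit M C ×
              (∀ z → z ∈ C → z ≡ elt a ⊎ z ≡ ι (point p) ⊎ z ≡ ι (point q) ⊎ z ≡ ι (point r)) ×
              ι (point p) ∈ C × ι (point q) ∈ C × ι (point r) ∈ C)
      line′ p q r d with collinear p q r d
      ... | C , kC , h , p∈ , q∈ , r∈ = img C , kC , bounded {C} {p} {q} {r} h , ∈-img⁺ p∈ , ∈-img⁺ q∈ , ∈-img⁺ r∈
      no-pair′ : ∀ p q {C} → Circuit M C → ¬ (∀ z → z ∈ C → z ≡ elt a ⊎ z ≡ ι (point p) ⊎ z ≡ ι (point q))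
      no-pair′ p q {C} c h = no-pair p q (K-pull c) bound
        where
        bound : ∀ z → z ∈ pull C → z ≡ suc a ⊎ z ≡ point p ⊎ z ≡ point q
        bound z z∈ = Sum.map ι-inj (Sum.map ι-inj ι-inj) (h (ι z) (∈-pull⁻ z∈))
      absurd : Void
      absurd = no-U (elt a , rest-ground (elt-∈ a) ,
        UniformRestriction.uniform M (elt a) {suc t} (λ p → ι (point p)) (λ eq → point-inj (ι-inj eq))
          (λ p → ι-ground (point p)) (λ p eq → point-≢ p (ι-inj eq)) line′ no-pair′)

  abstract
    fill : ∀ {i j k a b} → i ≢ j → j ≢ k → i ≢ k → J a i j → J b j k →
           ∃[ c ] (J c i k × IsC false (Triple a b c))
    fill {i} {j} {k} {a} {b} ij jk ik Ja Jb =
      -- `no-U` is only a negation and provides no edge. The edge is found by going through the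
      -- bundle, where `triangle` gives a circuit with or without x for each candidate.
      pick (search (λ l → triangle ij jk ik Ja Jb (Enum.elt-∈ (lines ik) l)))
      where
      pick : (∃[ l ] IsC false (Triple a b (Enum.elt (lines ik) l))) ⊎ (∀ l → IsC true (Triple a b (Enum.elt (lines ik) l))) →
             ∃[ c ] (J c i k × IsC false (Triple a b c))
      pick (inj₁ (l , tri)) = Enum.elt (lines ik) l , Enum.elt-∈ (lines ik) l , tri
      pick (inj₂ quads) = ⊥-elim (NoQuads.absurd ij jk ik Ja Jb quads)

  filledLift : FilledLift n t
  filledLift = record { liftData = liftData ; triangle = triangle ; fill = fill ; some = some ; line = lines (λ ()) }

-- The gain graph and the final isomorphism

module GainGraph {n t : ℕ} (D : FilledLift n t) where

  open FilledLift D
  open Recognition D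

  forward : ∀ {e u v} → J e u v → u < v → tail G e ≡ u × head G e ≡ v
  forward (inj₁ p) _ = p
  forward {e} (inj₂ (refl , refl)) lt = ⊥-elim (Finₚ.<-asym lt (ordered e))

  -- Edges point to their larger end, so `φ` is the gain read in increasing direction; a prescribed
  -- value of `φ` is therefore realised from the smaller end.
  φ-γ : ∀ {e u v} (ne : u ≢ v) (p : J e u v) → u < v → φ e ≡ γ u v ne p
  φ-γ ne p lt with forward p lt
  ... | refl , refl = γ-irr _ _ _ ne _ p refl

  realised : ∀ i j → i ≢ j → ∀ g → ∃[ e ] (J e i j × φ e ≡ g)
  realised i j ne g with Finₚ.<-cmp i j
  ... | tri≈ _ eq _ = ⊥-elim (ne eq)
  ... | tri< lt _ _ with γ-surj i j ne g
  ...   | e , p , eq = e , p , trans (φ-γ ne p lt) eq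
  realised i j ne g | tri> _ _ gt with γ-surj j i (≢-sym ne) g
  ...   | e , p , eq = e , J-sym p , trans (φ-γ (≢-sym ne) p gt) eq

  same-tail : ∀ e f → SameEnds G e f → tail G e ≡ tail G f × head G e ≡ head G f
  same-tail e f (inj₁ p) = p
  same-tail e f (inj₂ (p , q)) = ⊥-elim (Finₚ.<-asym (ordered e) (subst₂ _<_ (sym q) (sym p) (ordered f)))

  isLGGraph : IsLGGraph Γ G φ
  isLGGraph = loopless , realised , distinct , λ e f s → proj₁ (same-tail e f s)
    where
    distinct : ∀ e f → SameEnds G e f → φ e ≡ φ f → e ≡ f
    distinct e f s eq = γ-inj _ _ (loopless e) (J-self e) p (trans eq (φ-γ (loopless e) p (ordered e)))
      where
      p : J f (tail G e) (head G e)
      p = inj₁ (sym (proj₁ (same-tail e f s)) , sym (proj₂ (same-tail e f s)))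

module Conclusion {n t : ℕ} (H : Hypotheses n t) where

  open Hypotheses H
  open Build H
  open Assemble H
  open Recognition filledLift
  open GainGraph filledLift

  M≅L : M ≅ L
  M≅L = record
    { to = to ; from = ι ; to-gr = λ _ _ → ∈⊤ ; from-gr = λ i _ → ι-ground i
    ; from-to = λ y → ι-to ; to-from = λ i _ → to-ι i
    ; circ-to = λ D _ → mk⇔ (subst (Circuit M) (img-≡ D)) (subst (Circuit M) (sym (img-≡ D)))
    ; circ-from = λ C sub → mk⇔
        (λ c → subst K (sym (∩-identityʳ (pull C))) (K-pull c))
        (λ k → subst (Circuit M) (img-pull sub) (subst K (∩-identityʳ (pull C)) k)) }

  deletion⇔LG : ∀ C → Circuit (delete L zero) (false ∷ C) ⇔ LGCircuit Γ G φ C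
  deletion⇔LG C = mk⇔ (λ { (k , _) → Equivalence.to (LG⇔circuit C) k })
                      (λ lg → Equivalence.from (LG⇔circuit C) lg , λ ())

  isoLGPlus : IsoLGPlus M (4 + n) Γ
  isoLGPlus = G , φ , isLGGraph , K , deletion⇔LG , contraction⇔cycle , M≅L

theorem4p6 : (M : CircuitSys) → IsMatroid M → Simple M →
    (x : Fin (size M)) → x ∈ ground M →
    (n t : ℕ) → 4 ≤ n → 2 ≤ t →
    SiIsoMK (contract M x) n →
    ParallelClassesOfSize (contract M x) t →
    ¬ (∃[ e ] (e ∈ ground M × HasURestriction (contract M e) 2 (t + 2))) →
    Σ FinGroup λ Γ → 2 ≤ order Γ × IsoLGPlus M n Γ
theorem4p6 M isM simpleM x x∈ (suc (suc (suc (suc n)))) t (s≤s (s≤s (s≤s (s≤s z≤n)))) 2≤t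
           (S , isS , G₀ , complete , iso) classes no-U =
  Recognition.Γ (Assemble.filledLift H) , 2≤t , Conclusion.isoLGPlus H
  where
  H : Hypotheses n t
  H = record
    { M = M ; isM = isM ; simpleM = simpleM ; x = x ; x∈ = x∈ ; S = S ; isS = isS ; G₀ = G₀
    ; complete = complete ; iso = iso ; classes = classes
    ; no-U = subst (λ b → ¬ (∃[ e ] (e ∈ ground M × HasURestriction (contract M e) 2 b))) (ℕₚ.+-comm t 2) no-U }
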